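{- Let $D$ and $b$ be positive integers. If $\Gamma$ is a distance-regular graph with classical parameters $(D,b,\alpha,\beta)$ such that $D\geq 9$ and $b\geq 2$, then $(b+1)\alpha$ is a non-negative integer and one of the following holds: (i) $\alpha\leq b(b+1)$; (ii) $b(b+1)<\alpha<b^2(b+1)+1$ and $\beta<\bigl(b(b+1)^2-\alpha\bigr)\left[\begin{smallmatrix} D\\ 1\end{smallmatrix}\right]_b+(b+1)^6b+\Bigl(\frac{(b+1)^3((b+1)^2+1)}{2}+1\Bigr)\alpha-b$. Moreover, if $D\geq 10$ then $\alpha\leq b^2(b+1)$.
   Context: A connected graph $\Gamma$ of diameter $D$ is distance-regular if for each $0\le i\le D$ there are integers $b_i,c_i$ such that for any two vertices $x,y$ at distance $i$, exactly $c_i$ neighbours of $y$ are at distance $i-1$ from $x$ and exactly $b_i$ at distance $i+1$. Write $\left[\begin{smallmatrix} i\\ 1\end{smallmatrix}\right]_b=1+b+\dots+b^{i-1}$. $\Gamma$ has classical parameters $(D,b,\alpha,\beta)$ if $c_i=\left[\begin{smallmatrix} i\\ 1\end{smallmatrix}\right]_b(1+\alpha\left[\begin{smallmatrix} i-1\\ 1\end{smallmatrix}\right]_b)$ and $b_i=(\left[\begin{smallmatrix} D\\ 1\end{smallmatrix}\right]_b-\left[\begin{smallmatrix} i\\ 1\end{smallmatrix}\right]_b)(\beta-\alpha\left[\begin{smallmatrix} i\\ 1\end{smallmatrix}\right]_b)$ for all $0\le i\le D$. -}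

module Defs where

open import Data.Nat using (ℕ; zero; suc; _+_; _*_; _∸_; _^_; _≤_)
open import Data.Bool using (Bool; true; false; _∧_; _∨_; not; if_then_else_)
open import Data.Fin using (Fin; zero; suc)
open import Data.Product using (Σ; ∃; _×_; _,_)
open import Relation.Binary.PropositionalEquality using (_≡_)
open import Data.Integer using (+_)
open import Data.Rational using (ℚ; _/_)
import Data.Rational as Q

record Graph : Set where
  field
    n         : ℕ
    adj       : Fin n → Fin n → Bool
    adj-sym   : ∀ x y → adj x y ≡ adj y x
    adj-irr   : ∀ x → adj x x ≡ false

anyFin : ∀ {m} → (Fin m → Bool) → Bool
anyFin {zero}  p = false
anyFin {suc m} p = p zero ∨ anyFin (λ z → p (suc z))

countFin : ∀ {m} → (Fin m → Bool) → ℕ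
countFin {zero}  p = 0
countFin {suc m} p = (if p zero then 1 else 0) + countFin (λ z → p (suc z))

module _ (G : Graph) where
  open Graph G

  within : ℕ → Fin n → Fin n → Bool
  within zero    x y = eqFin x y
    where
    eqFin : ∀ {m} → Fin m → Fin m → Bool
    eqFin zero    zero    = true
    eqFin zero    (suc _) = false
    eqFin (suc _) zero    = false
    eqFin (suc a) (suc b) = eqFin a b
  within (suc k) x y = within k x y ∨ anyFin (λ z → within k x z ∧ adj z y)

  atDist : Fin n → Fin n → ℕ → Bool
  atDist x y zero    = within zero x y
  atDist x y (suc i) = within (suc i) x y ∧ not (within i x y)

  HasDiameter : ℕ → Set
  HasDiameter D = (∀ x y → within D x y ≡ true)
                × Σ (Fin n) (λ x → Σ (Fin n) (λ y → atDist x y D ≡ true))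

  -- c_i(x,y) : neighbours of y at distance i-1 from x  (for i = 0: none, since
  -- i ∸ 1 = 0 and y has no neighbour equal to x = y)
  cNum : Fin n → Fin n → ℕ → ℕ
  cNum x y i = countFin (λ z → adj y z ∧ atDist x z (i ∸ 1))

  bNum : Fin n → Fin n → ℕ → ℕ
  bNum x y i = countFin (λ z → adj y z ∧ atDist x z (suc i))

  IsDistanceRegular : ℕ → (ℕ → ℕ) → (ℕ → ℕ) → Set
  IsDistanceRegular D bs cs =
    HasDiameter D ×
    (∀ i → i ≤ D → ∀ x y → atDist x y i ≡ true →
       (cNum x y i ≡ cs i) × (bNum x y i ≡ bs i))

ℕ→ℚ : ℕ → ℚ
ℕ→ℚ k = + k / 1

gauss : ℕ → ℕ → ℕ
gauss zero    b = 0
gauss (suc i) b = gauss i b + b ^ i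

HasClassicalParameters : Graph → ℕ → ℕ → ℚ → ℚ → Set
HasClassicalParameters G D b α β =
  Σ (ℕ → ℕ) λ bs → Σ (ℕ → ℕ) λ cs →
    IsDistanceRegular G D bs cs ×
    (∀ i → i ≤ D →
      (ℕ→ℚ (cs i) ≡ ℕ→ℚ (gauss i b) Q.* (Q.1ℚ Q.+ α Q.* ℕ→ℚ (gauss (i ∸ 1) b))) ×
      (ℕ→ℚ (bs i) ≡ (ℕ→ℚ (gauss D b) Q.- ℕ→ℚ (gauss i b)) Q.* (β Q.- α Q.* ℕ→ℚ (gauss i b))))

module Submission where

-- Put m = b + 1, h = b m and let N be the local graph of a vertex x: it has k vertices and is regular of
-- valency a₁. Positivity of the primitive idempotent of the second largest eigenvalue gives N + m I ≥ 0, and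
-- that of the smallest eigenvalue -[D] gives |C| ≤ β for every clique C of N. Three consequences:
--
-- * If C is a clique of N with c elements, a vertex y outside C with r neighbours in C satisfies
--   r (c - r) ≤ h c, while r ≤ c₂ if C is maximal; hence r ≤ h as soon as c > c₂ + h + h².
-- * Double counting the edges leaving a maximal C yields c (a₁ + 1 - c) ≤ h (k - c), which is impossible for
--   h [D] ≤ c ≤ β when α > h, and already for a₁ + 1 ≤ 2 m c when α > b² m.
-- * On the other hand the neighbourhood Λ of a vertex of N contains at most m² pairwise nonadjacent vertices.
--   Taking as many as possible, the points of Λ close to exactly one of them form cliques, the remaining ones
--   number at most C(m², 2) c₂, and the form N + m I on the union of the cliques bounds a₁ by m times the
--   largest clique size, up to a term depending only on m and α.
--
-- Comparing the two clique sizes gives α ≤ b² m, and the bound on β if α > h.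

open import Defs
open import Data.Bool using (Bool; true; false; _∧_; _∨_; not; if_then_else_)
open import Data.Empty using (⊥; ⊥-elim)
open import Data.Fin using (Fin; zero; suc)
import Data.Fin as Fin
open import Data.Integer using (ℤ; +_; 0ℤ; 1ℤ)
import Data.Integer as ℤ
import Data.Integer.DivMod as ℤᵈ
import Data.Integer.Properties as ℤₚ
import Data.Integer.Tactic.RingSolver as ℤ-Solver
open import Data.List using (List; []; _∷_)
open import Data.Nat using (zero; suc; s≤s; z≤n; _∸_)
import Data.Nat as ℕ
import Data.Nat.Properties as ℕₚ
open import Data.Product using (∃; _,_; proj₁; proj₂)
open import Data.Rational using (0ℚ; 1ℚ; toℚᵘ)
import Data.Rational as ℚ
import Data.Rational.Properties as ℚₚ
open import Data.Rational.Unnormalised using (mkℚᵘ; *≡*; *≤*; *<*) renaming (_≃_ to _≃ᵘ_)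
import Data.Rational.Unnormalised.Properties as ℚᵘₚ
open import Data.Sum using (inj₁; inj₂)
import Data.Sum as Sum
open import Level using (0ℓ)
open import Relation.Binary.Definitions using (tri<; tri≈; tri>)
open import Relation.Binary.PropositionalEquality using (_≢_; refl; sym; trans; cong; cong₂; subst; subst₂; module ≡-Reasoning)
open import Relation.Nullary using (¬_; yes; no; does)
open import Relation.Nullary.Decidable using (dec-true; dec-false; dec⇒maybe)
import Tactic.RingSolver as RingSolver
open import Tactic.RingSolver.Core.AlmostCommutativeRing using (AlmostCommutativeRing; fromCommutativeRing)

-- Positivity is obtained without diagonalising A. As every c_i with 1 ≤ i ≤ D is positive, each
-- matrix whose entries depend only on the distance acts as a scalar on each eigenspace of A. If `w`
-- is a radial eigenfunction, the columns of E = (w (dist x y)) are eigenvectors, so E² = cE; the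
-- diagonal shows c > 0, and the form of E is a positive multiple of a sum of squares. All
-- quantities stay in ℤ: c₂ = m + mα makes mα an integer, b₀ - b₁ then does the same for mβ, and
-- cosine sequences are multiplied by their common denominators. The constants come from one
-- comparison. Requiring a₁ + 1 ≤ 2 m c makes m times the largest clique account for only about half
-- of a₁. The other half would have to fit into an error of about (m⁴ + 2 m³) mα, whereas a₁ + 1 >
-- mα [D - 1]. The size of D enters as m⁵ ≤ [D - 1]. Maximal cliques and maximal independent sets
-- are reached by growth with a bounded number of steps, so no choice of a maximum is made.

module Integral where

  open import Algebra.Properties.Semiring.Sum ℤₚ.+-*-semiring using (sum; sum-cong-≗; ∑-distrib-+; ∑-comm; *-distribˡ-sum; sum-replicate-zero)
  open import Data.Integer using (-_; _+_; _-_; _*_; _≤_; _<_)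
  open import Data.Nat using (ℕ)
  open import Data.Product using (_×_)
  open import Data.Sum using (_⊎_)
  open import Relation.Binary.PropositionalEquality using (_≡_)
  open ℤ-Solver using (solve-∀)

  -- Finite sums over ℤ

  ⟦_⟧ : Bool → ℤ
  ⟦ p ⟧ = if p then 1ℤ else 0ℤ

  ⟦⟧-nonneg : ∀ p → 0ℤ ≤ ⟦ p ⟧
  ⟦⟧-nonneg false = ℤ.+≤+ ℕ.z≤n
  ⟦⟧-nonneg true  = ℤ.+≤+ ℕ.z≤n

  ⟦⟧-∧ : ∀ p q → ⟦ p ∧ q ⟧ ≡ ⟦ p ⟧ * ⟦ q ⟧
  ⟦⟧-∧ false q = refl
  ⟦⟧-∧ true  q = sym (ℤₚ.*-identityˡ ⟦ q ⟧)

  ⟦⟧-idem : ∀ p → ⟦ p ⟧ * ⟦ p ⟧ ≡ ⟦ p ⟧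
  ⟦⟧-idem false = refl
  ⟦⟧-idem true  = refl

  nonneg-+ : ∀ {i j} → 0ℤ ≤ i → 0ℤ ≤ j → 0ℤ ≤ i + j
  nonneg-+ p q = ℤₚ.+-mono-≤ p q

  nonneg-* : ∀ {i j} → 0ℤ ≤ i → 0ℤ ≤ j → 0ℤ ≤ i * j
  nonneg-* {i} {j} p q = subst (_≤ i * j) (ℤₚ.*-zeroʳ i) (ℤₚ.*-monoˡ-≤-nonNeg i {{ℤ.nonNegative p}} q)

  pos-* : ∀ {i j} → 0ℤ < i → 0ℤ < j → 0ℤ < i * j
  pos-* {i} {j} p q = subst (_< i * j) (ℤₚ.*-zeroʳ i) (ℤₚ.*-monoˡ-<-pos i {{ℤ.positive p}} q)

  square-nonneg : ∀ i → 0ℤ ≤ i * i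
  square-nonneg (+ n)      = nonneg-* {+ n} {+ n} (ℤ.+≤+ ℕ.z≤n) (ℤ.+≤+ ℕ.z≤n)
  square-nonneg ℤ.-[1+ n ] = ℤ.+≤+ ℕ.z≤n

  *-mono : ∀ i {j k} → 0ℤ ≤ i → j ≤ k → i * j ≤ i * k
  *-mono i p = ℤₚ.*-monoˡ-≤-nonNeg i {{ℤ.nonNegative p}}

  cancel-nonneg : ∀ i {j} → 0ℤ < i → 0ℤ ≤ i * j → 0ℤ ≤ j
  cancel-nonneg i {j} p q = ℤₚ.*-cancelˡ-≤-pos 0ℤ j i {{ℤ.positive p}} (subst (_≤ i * j) (sym (ℤₚ.*-zeroʳ i)) q)

  cancel-pos : ∀ i {j} → 0ℤ ≤ i → 0ℤ < i * j → 0ℤ < j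
  cancel-pos i {j} p q = ℤₚ.*-cancelˡ-<-nonNeg i {{ℤ.nonNegative p}} (subst (_< i * j) (sym (ℤₚ.*-zeroʳ i)) q)

  ≤-by : ∀ {i j} → 0ℤ ≤ j - i → i ≤ j
  ≤-by = ℤₚ.0≤i-j⇒j≤i

  ≤-diff : ∀ {i j} → i ≤ j → 0ℤ ≤ j - i
  ≤-diff = ℤₚ.i≤j⇒0≤j-i

  <-diff : ∀ {i j} → i < j → 0ℤ < j - i
  <-diff {i} {j} p = subst (_< j - i) (ℤₚ.+-inverseʳ i) (ℤₚ.+-monoˡ-< (- i) p)

  sum-≡0 : ∀ {n} {f : Fin n → ℤ} → (∀ i → f i ≡ 0ℤ) → sum f ≡ 0ℤ
  sum-≡0 {n} h = trans (sum-cong-≗ h) (sum-replicate-zero n)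

  sum-≤ : ∀ {n} {f g : Fin n → ℤ} → (∀ i → f i ≤ g i) → sum f ≤ sum g
  sum-≤ {zero}  h = ℤₚ.≤-refl
  sum-≤ {suc n} h = ℤₚ.+-mono-≤ (h zero) (sum-≤ (λ i → h (suc i)))

  sum-nonneg : ∀ {n} {f : Fin n → ℤ} → (∀ i → 0ℤ ≤ f i) → 0ℤ ≤ sum f
  sum-nonneg {zero}  h = ℤₚ.≤-refl
  sum-nonneg {suc n} h = nonneg-+ (h zero) (sum-nonneg (λ i → h (suc i)))

  term≤sum : ∀ {n} {f : Fin n → ℤ} → (∀ i → 0ℤ ≤ f i) → ∀ i → f i ≤ sum f
  term≤sum {f = f} h zero = subst (_≤ sum f) (ℤₚ.+-identityʳ (f zero)) (ℤₚ.+-monoʳ-≤ (f zero) (sum-nonneg (λ i → h (suc i))))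
  term≤sum {f = f} h (suc i) =
    ℤₚ.≤-trans (term≤sum (λ j → h (suc j)) i)
               (subst (_≤ sum f) (ℤₚ.+-identityˡ _) (ℤₚ.+-monoˡ-≤ _ (h zero)))

  sum-* : ∀ {n} c (f : Fin n → ℤ) → sum (λ i → c * f i) ≡ c * sum f
  sum-* c f = sym (*-distribˡ-sum c f)

  sum²-* : ∀ {m n} c (f : Fin m → Fin n → ℤ) → (sum λ x → sum λ y → c * f x y) ≡ c * (sum λ x → sum λ y → f x y)
  sum²-* c f = trans (sum-cong-≗ (λ x → sum-* c (f x))) (sum-* c (λ x → sum (f x)))

  sum-linear : ∀ {n} c d (f g : Fin n → ℤ) → sum (λ i → c * f i + d * g i) ≡ c * sum f + d * sum g
  sum-linear c d f g = trans (∑-distrib-+ (λ i → c * f i) (λ i → d * g i)) (cong₂ _+_ (sum-* c f) (sum-* d g))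

  sum-+ : ∀ {n} (f g : Fin n → ℤ) → sum (λ i → f i + g i) ≡ sum f + sum g
  sum-+ = ∑-distrib-+

  sum-- : ∀ {n} (f g : Fin n → ℤ) → sum (λ i → f i - g i) ≡ sum f - sum g
  sum-- f g = trans (sum-cong-≗ (λ i → eq (f i) (g i))) (trans (sum-linear 1ℤ (- 1ℤ) f g) (sym (eq (sum f) (sum g))))
    where
    eq : ∀ x y → x - y ≡ 1ℤ * x + - 1ℤ * y
    eq = solve-∀

  δ : ∀ {n} → Fin n → Fin n → ℤ
  δ x y = ⟦ does (x Fin.≟ y) ⟧

  δ-refl : ∀ {n} (x : Fin n) → δ x x ≡ 1ℤ
  δ-refl x with x Fin.≟ x
  ... | yes _ = refl
  ... | no ne = ⊥-elim (ne refl)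

  δ-≢ : ∀ {n} {x y : Fin n} → x ≢ y → δ x y ≡ 0ℤ
  δ-≢ {x = x} {y} ne with x Fin.≟ y
  ... | yes e = ⊥-elim (ne e)
  ... | no _  = refl

  δ-sym : ∀ {n} (x y : Fin n) → δ x y ≡ δ y x
  δ-sym x y with x Fin.≟ y
  ... | yes refl = sym (δ-refl x)
  ... | no ne    = sym (δ-≢ (λ e → ne (sym e)))

  δ-suc : ∀ {n} (x y : Fin n) → δ (suc x) (suc y) ≡ δ x y
  δ-suc x y with x Fin.≟ y
  ... | yes e = refl
  ... | no _  = refl

  sum-δ : ∀ {n} (x : Fin n) (f : Fin n → ℤ) → sum (λ y → δ x y * f y) ≡ f x
  sum-δ zero f = trans (cong₂ _+_ (ℤₚ.*-identityˡ (f zero)) (sum-≡0 (λ i → ℤₚ.*-zeroˡ (f (suc i))))) (ℤₚ.+-identityʳ (f zero))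
  sum-δ (suc x) f = trans (cong₂ _+_ (ℤₚ.*-zeroˡ (f zero)) (trans (sum-cong-≗ (λ y → cong (_* f (suc y)) (δ-suc x y))) (sum-δ x (λ y → f (suc y))))) (ℤₚ.+-identityˡ _)

  countFin-sum : ∀ {n} (p : Fin n → Bool) → + countFin p ≡ sum (λ z → ⟦ p z ⟧)
  countFin-sum {zero}  p = refl
  countFin-sum {suc n} p with p zero
  ... | true  = cong (λ t → 1ℤ + t) (countFin-sum (λ z → p (suc z)))
  ... | false = trans (countFin-sum (λ z → p (suc z))) (sym (ℤₚ.+-identityˡ _))

  countFin-pos : ∀ {n} (p : Fin n → Bool) z → p z ≡ true → 1 ℕ.≤ countFin p
  countFin-pos p zero h rewrite h = ℕ.s≤s ℕ.z≤n
  countFin-pos p (suc z) h with p zero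
  ... | true  = ℕ.s≤s ℕ.z≤n
  ... | false = countFin-pos (λ i → p (suc i)) z h

  anyFin-witness : ∀ {n} (p : Fin n → Bool) → anyFin p ≡ true → ∃ λ z → p z ≡ true
  anyFin-witness {suc n} p h with p zero in eq
  ... | true  = zero , eq
  ... | false = let z , pz = anyFin-witness (λ i → p (suc i)) h in suc z , pz

  anyFin-intro : ∀ {n} (p : Fin n → Bool) z → p z ≡ true → anyFin p ≡ true
  anyFin-intro p zero h rewrite h = refl
  anyFin-intro p (suc z) h with p zero
  ... | true  = refl
  ... | false = anyFin-intro (λ i → p (suc i)) z h

  size : ∀ {n} → (Fin n → Bool) → ℤ
  size C = sum λ p → ⟦ C p ⟧

  ⟦⟧-mono : ∀ {p q} → (p ≡ true → q ≡ true) → ⟦ p ⟧ ≤ ⟦ q ⟧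
  ⟦⟧-mono {false} {q} _ = ⟦⟧-nonneg q
  ⟦⟧-mono {true}      h rewrite h refl = ℤₚ.≤-refl

  size-mono : ∀ {n} {C K : Fin n → Bool} → (∀ p → C p ≡ true → K p ≡ true) → size C ≤ size K
  size-mono h = sum-≤ (λ p → ⟦⟧-mono (h p))

  size-nonneg : ∀ {n} (C : Fin n → Bool) → 0ℤ ≤ size C
  size-nonneg C = sum-nonneg (λ p → ⟦⟧-nonneg (C p))

  size-pos : ∀ {n} {C : Fin n → Bool} {p} → C p ≡ true → 0ℤ < size C
  size-pos {C = C} {p} h = ℤₚ.<-≤-trans (ℤ.+<+ (ℕ.s≤s ℕ.z≤n)) (subst (_≤ size C) (cong ⟦_⟧ h) (term≤sum (λ q → ⟦⟧-nonneg (C q)) p))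

  two-terms≤sum : ∀ {n} {f : Fin n → ℤ} → (∀ i → 0ℤ ≤ f i) → ∀ {i j} → i ≢ j → f i + f j ≤ sum f
  two-terms≤sum {f = f} h {i} {j} i≢j = ℤₚ.≤-trans (ℤₚ.≤-reflexive pick) (sum-≤ bound)
    where
    pick : f i + f j ≡ sum (λ l → δ i l * f l + δ j l * f l)
    pick = sym (trans (sum-+ (λ l → δ i l * f l) (λ l → δ j l * f l)) (cong₂ _+_ (sum-δ i f) (sum-δ j f)))
    bound : ∀ l → δ i l * f l + δ j l * f l ≤ f l
    bound l with i Fin.≟ l | j Fin.≟ l
    ... | yes refl | yes refl = ⊥-elim (i≢j refl)
    ... | yes _    | no _     = ℤₚ.≤-reflexive (eq (f l))
      where
      eq : ∀ x → 1ℤ * x + 0ℤ * x ≡ x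
      eq = solve-∀
    ... | no _     | yes _    = ℤₚ.≤-reflexive (eq (f l))
      where
      eq : ∀ x → 0ℤ * x + 1ℤ * x ≡ x
      eq = solve-∀
    ... | no _     | no _     = subst (_≤ f l) (eq (f l)) (h l)
      where
      eq : ∀ x → 0ℤ ≡ 0ℤ * x + 0ℤ * x
      eq = solve-∀

  insert : ∀ {n} → Fin n → (Fin n → Bool) → Fin n → Bool
  insert y C p = does (y Fin.≟ p) ∨ C p

  remove : ∀ {n} → Fin n → (Fin n → Bool) → Fin n → Bool
  remove y C p = not (does (y Fin.≟ p)) ∧ C p

  insert-elim : ∀ {n} {y p : Fin n} {C} → insert y C p ≡ true → y ≡ p ⊎ C p ≡ true
  insert-elim {y = y} {p} h with y Fin.≟ p
  ... | yes e = inj₁ e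
  ... | no _  = inj₂ h

  remove-elim : ∀ {n} {y p : Fin n} {C} → remove y C p ≡ true → y ≢ p × C p ≡ true
  remove-elim {y = y} {p} h with y Fin.≟ p
  ... | no ne = ne , h

  size-insert : ∀ {n} {y : Fin n} {C} → C y ≡ false → size (insert y C) ≡ 1ℤ + size C
  size-insert {y = y} {C} h = trans (sum-cong-≗ term) (trans (sum-+ (λ p → δ y p * 1ℤ) (λ p → ⟦ C p ⟧)) (cong (_+ size C) (sum-δ y (λ _ → 1ℤ))))
    where
    term : ∀ p → ⟦ insert y C p ⟧ ≡ δ y p * 1ℤ + ⟦ C p ⟧
    term p with y Fin.≟ p
    ... | yes refl rewrite h = refl
    ... | no _ = sym (ℤₚ.+-identityˡ ⟦ C p ⟧)

  size-remove : ∀ {n} {y : Fin n} {C} → C y ≡ true → 1ℤ + size (remove y C) ≡ size C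
  size-remove {y = y} {C} h = trans (cong (_+ size (remove y C)) (sym (sum-δ y (λ _ → 1ℤ)))) (trans (sym (sum-+ (λ p → δ y p * 1ℤ) (λ p → ⟦ remove y C p ⟧))) (sum-cong-≗ term))
    where
    term : ∀ p → δ y p * 1ℤ + ⟦ remove y C p ⟧ ≡ ⟦ C p ⟧
    term p with y Fin.≟ p
    ... | yes refl rewrite h = refl
    ... | no _ = ℤₚ.+-identityˡ ⟦ C p ⟧

  -- Distances in a graph

  ∧-true : ∀ {p q} → p ∧ q ≡ true → p ≡ true × q ≡ true
  ∧-true {true} h = refl , h

  ∧-intro : ∀ {p q} → p ≡ true → q ≡ true → p ∧ q ≡ true
  ∧-intro refl h = h

  not-true : ∀ {p} → not p ≡ true → p ≡ false
  not-true {false} _ = refl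

  true≢false : ∀ {p} → p ≡ true → p ≡ false → ⊥
  true≢false refl ()

  ≢true : ∀ {p} → ¬ (p ≡ true) → p ≡ false
  ≢true {false} _ = refl
  ≢true {true}  h = ⊥-elim (h refl)

  -- The equality test used by `within 0` is local to its clause and cannot be named;
  -- unification against the unfolded `within 0` recovers it.
  mutual
    eqFin : ∀ M (adj : Fin M → Fin M → Bool) → (∀ x y → adj x y ≡ adj y x) → (∀ x → adj x x ≡ false) →
            (c d : Fin M) → ∀ N → Fin N → Fin N → Bool
    eqFin = _

    within₀-suc : ∀ N adj s i (a b : Fin N) →
      let G = record { n = suc N ; adj = adj ; adj-sym = s ; adj-irr = i } in
      within G zero (suc a) (suc b) ≡ eqFin (suc N) adj s i (suc a) (suc b) N a b
    within₀-suc N adj s i a b with suc N | suc a | suc b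
    ... | M | c | d = refl

  module Within (G : Graph) where
    open Graph G

    private
      eq : (c d : Fin n) → ∀ {N} → Fin N → Fin N → Bool
      eq c d {N} = eqFin n adj adj-sym adj-irr c d N

      eq-sound : ∀ {c d} {N} (a b : Fin N) → eq c d a b ≡ true → a ≡ b
      eq-sound zero    zero    _ = refl
      eq-sound {c} {d} (suc a) (suc b) h = cong suc (eq-sound {c} {d} a b h)

      eq-refl : ∀ {c d} {N} (a : Fin N) → eq c d a a ≡ true
      eq-refl zero    = refl
      eq-refl {c} {d} (suc a) = eq-refl {c} {d} a

    within₀-sound : ∀ {x y} → within G 0 x y ≡ true → x ≡ y
    within₀-sound {x} {y} = eq-sound {x} {y} x y

    within₀-refl : ∀ x → within G 0 x x ≡ true
    within₀-refl x = eq-refl {x} {x} x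

    adj-comm : ∀ {x y} → adj x y ≡ true → adj y x ≡ true
    adj-comm {x} {y} = trans (adj-sym y x)

    adj-≢ : ∀ {x y} → adj x y ≡ true → x ≢ y
    adj-≢ h refl = true≢false h (adj-irr _)

    within-suc : ∀ i {x y} → within G i x y ≡ true → within G (suc i) x y ≡ true
    within-suc i h rewrite h = refl

    within-step : ∀ i {x y z} → within G i x y ≡ true → adj y z ≡ true → within G (suc i) x z ≡ true
    within-step i {x} {y} {z} h e with within G i x z
    ... | true  = refl
    ... | false = anyFin-intro _ y (∧-intro h e)

    within-mono : ∀ {i j} → i ℕ.≤ j → ∀ {x y} → within G i x y ≡ true → within G j x y ≡ true
    within-mono le {x} {y} h = go (ℕₚ.≤⇒≤′ le)
      where
      go : ∀ {j} → _ ℕ.≤′ j → within G j x y ≡ true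
      go (ℕ.≤′-reflexive refl) = h
      go (ℕ.≤′-step {j} p)     = within-suc j (go p)

    atDist⇒within : ∀ i {x y} → atDist G x y i ≡ true → within G i x y ≡ true
    atDist⇒within zero    h = h
    atDist⇒within (suc i) h = proj₁ (∧-true h)

    atDist-least : ∀ {i j x y} → atDist G x y i ≡ true → within G j x y ≡ true → i ℕ.≤ j
    atDist-least {zero} _ _ = ℕ.z≤n
    atDist-least {suc i} {j} h w with suc i ℕ.≤? j
    ... | yes p = p
    ... | no  p = ⊥-elim (true≢false (within-mono (ℕₚ.≤-pred (ℕₚ.≰⇒> p)) w) (not-true (proj₂ (∧-true h))))

    atDist-unique : ∀ {i j x y} → atDist G x y i ≡ true → atDist G x y j ≡ true → i ≡ j
    atDist-unique {i} {j} p q =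
      ℕₚ.≤-antisym (atDist-least p (atDist⇒within j q)) (atDist-least q (atDist⇒within i p))

    within⇒atDist : ∀ j {x y} → within G j x y ≡ true → ∃ λ i → i ℕ.≤ j × atDist G x y i ≡ true
    within⇒atDist zero h = 0 , ℕ.z≤n , h
    within⇒atDist (suc j) {x} {y} h with within G j x y in eq
    ... | true  = let i , le , p = within⇒atDist j eq in i , ℕₚ.m≤n⇒m≤1+n le , p
    ... | false = suc j , ℕₚ.≤-refl , atD
      where
      atD : atDist G x y (suc j) ≡ true
      atD rewrite eq = ∧-intro h refl

    atDist-pred : ∀ i {x y} → atDist G x y (suc i) ≡ true → ∃ λ z → adj y z ≡ true × atDist G x z i ≡ true
    atDist-pred i {x} {y} h with ∧-true {within G (suc i) x y} h
    ... | w , nw with within G i x y in eq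
    ...   | false with anyFin-witness _ w
    ...     | z , q with ∧-true {within G i x z} q
    ...       | wz , e with within⇒atDist i wz
    ...         | j , le , at with ℕₚ.m≤n⇒m<n∨m≡n le
    ...           | inj₂ refl = z , adj-comm e , at
    ...           | inj₁ lt   =
      ⊥-elim (true≢false (within-mono lt (within-step j (atDist⇒within j at) e)) eq)

    adj⇒atDist₁ : ∀ {x y} → adj x y ≡ true → atDist G x y 1 ≡ true
    adj⇒atDist₁ {x} {y} e with within⇒atDist 1 {x} {y} (within-step 0 {x} (within₀-refl x) e)
    ... | zero  , _ , at = ⊥-elim (adj-≢ e (within₀-sound {x} {y} at))
    ... | suc zero , _ , at = at
    ... | suc (suc _) , ℕ.s≤s () , _

    atDist₁⇒adj : ∀ {x y} → atDist G x y 1 ≡ true → adj x y ≡ true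
    atDist₁⇒adj {x} h with atDist-pred 0 {x} h
    ... | z , e , at with within₀-sound {x} {z} at
    ...   | refl = adj-comm e

    atDist₁-adj : ∀ x y → atDist G x y 1 ≡ adj x y
    atDist₁-adj x y with adj x y in eq
    ... | true  = adj⇒atDist₁ eq
    ... | false = ≢true (λ h → true≢false (atDist₁⇒adj {x} {y} h) eq)

    atDist₂ : ∀ {x y z} → x ≢ y → adj x y ≡ false → adj x z ≡ true → adj z y ≡ true → atDist G x y 2 ≡ true
    atDist₂ {x} {y} ne na e₁ e₂ with within⇒atDist 2 {x} {y} (within-step 1 {x} (within-step 0 {x} (within₀-refl x) e₁) e₂)
    ... | zero  , _ , at = ⊥-elim (ne (within₀-sound {x} {y} at))
    ... | suc zero , _ , at = ⊥-elim (true≢false (atDist₁⇒adj {x} {y} at) na)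
    ... | suc (suc zero) , _ , at = at
    ... | suc (suc (suc _)) , ℕ.s≤s (ℕ.s≤s ()) , _

  module Distance (G : Graph) (D : ℕ) (bounded : ∀ x y → within G D x y ≡ true) where
    open Graph G
    open Within G

    dist : Fin n → Fin n → ℕ
    dist x y = proj₁ (within⇒atDist D (bounded x y))

    dist≤D : ∀ x y → dist x y ℕ.≤ D
    dist≤D x y = proj₁ (proj₂ (within⇒atDist D (bounded x y)))

    atDist-dist : ∀ x y → atDist G x y (dist x y) ≡ true
    atDist-dist x y = proj₂ (proj₂ (within⇒atDist D (bounded x y)))

    dist-unique : ∀ {x y i} → atDist G x y i ≡ true → dist x y ≡ i
    dist-unique {x} {y} h = atDist-unique (atDist-dist x y) h

    atDist-false : ∀ {x y i} → dist x y ≢ i → atDist G x y i ≡ false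
    atDist-false ne = ≢true (λ h → ne (dist-unique h))

    dist-refl : ∀ x → dist x x ≡ 0
    dist-refl x = dist-unique {i = 0} (within₀-refl x)

    dist₀ : ∀ {x y} → dist x y ≡ 0 → x ≡ y
    dist₀ {x} {y} e = within₀-sound (subst (λ i → atDist G x y i ≡ true) e (atDist-dist x y))

    dist-step : ∀ {x y z} → adj y z ≡ true → dist x z ℕ.≤ suc (dist x y)
    dist-step {x} {y} {z} e =
      atDist-least (atDist-dist x z) (within-step (dist x y) {x} (atDist⇒within (dist x y) (atDist-dist x y)) e)

    -- By the triangle inequality `z` is at distance i - 1, i or i + 1 from `x`. Writing `g` as
    -- `g i` plus two corrections avoids counting the neighbours at distance i, for which no
    -- intersection number is given.
    neighbour-split : ∀ (g : ℕ → ℤ) x y z → let i = dist x y in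
      ⟦ adj y z ⟧ * g (dist x z) ≡
        g i * ⟦ adj y z ⟧ + ((g (i ℕ.∸ 1) - g i) * ⟦ adj y z ∧ atDist G x z (i ℕ.∸ 1) ⟧
                            + (g (suc i) - g i) * ⟦ adj y z ∧ atDist G x z (suc i) ⟧)
    neighbour-split g x y z with adj y z in e
    ... | false = lem (g (dist x z)) (g (dist x y)) (g (dist x y ℕ.∸ 1) - g (dist x y)) (g (suc (dist x y)) - g (dist x y))
      where
      lem : ∀ t a p q → 0ℤ * t ≡ a * 0ℤ + (p * 0ℤ + q * 0ℤ)
      lem = solve-∀
    ... | true with ℕₚ.<-cmp (dist x z) (dist x y)
    ...   | tri≈ _ eq _ rewrite eq = same (dist x y) eq
      where
      same : ∀ i → dist x z ≡ i → 1ℤ * g i ≡ g i * 1ℤ + ((g (i ℕ.∸ 1) - g i) * ⟦ atDist G x z (i ℕ.∸ 1) ⟧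
                            + (g (suc i) - g i) * ⟦ atDist G x z (suc i) ⟧)
      same zero eq' rewrite atDist-false {x} {z} {1} (λ q → ℕₚ.1+n≢n (trans (sym q) eq')) = lem (g 0) (g 1) ⟦ atDist G x z 0 ⟧
        where
        lem : ∀ a b t → 1ℤ * a ≡ a * 1ℤ + ((a - a) * t + (b - a) * 0ℤ)
        lem = solve-∀
      same (suc i) eq' rewrite atDist-false {x} {z} {suc (suc i)} (λ q → ℕₚ.1+n≢n (trans (sym q) eq'))
                             | atDist-false {x} {z} {i} (λ q → ℕₚ.1+n≢n (trans (sym eq') q)) = lem (g (suc i)) (g i) (g (suc (suc i)))
        where
        lem : ∀ a b t → 1ℤ * a ≡ a * 1ℤ + ((b - a) * 0ℤ + (t - a) * 0ℤ)
        lem = solve-∀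
    ...   | tri< lt _ _ = down (dist x y) (ℕₚ.≤-antisym lt (dist-step (adj-comm e)))
      where
      down : ∀ i → suc (dist x z) ≡ i → 1ℤ * g (dist x z) ≡ g i * 1ℤ + ((g (i ℕ.∸ 1) - g i) * ⟦ atDist G x z (i ℕ.∸ 1) ⟧
                            + (g (suc i) - g i) * ⟦ atDist G x z (suc i) ⟧)
      down (suc i) refl rewrite atDist-dist x z | atDist-false {x} {z} {suc (suc i)} (λ q → ℕₚ.m≢1+n+m i {1} q) = lem (g i) (g (suc i)) (g (suc (suc i)))
        where
        lem : ∀ a b t → 1ℤ * a ≡ b * 1ℤ + ((a - b) * 1ℤ + (t - b) * 0ℤ)
        lem = solve-∀
    ...   | tri> _ _ gt = up (dist x y) (ℕₚ.≤-antisym (dist-step e) gt)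
      where
      up : ∀ i → dist x z ≡ suc i → 1ℤ * g (dist x z) ≡ g i * 1ℤ + ((g (i ℕ.∸ 1) - g i) * ⟦ atDist G x z (i ℕ.∸ 1) ⟧
                            + (g (suc i) - g i) * ⟦ atDist G x z (suc i) ⟧)
      up i eq rewrite eq | subst (λ j → atDist G x z j ≡ true) eq (atDist-dist x z)
                    | atDist-false {x} {z} {i ℕ.∸ 1} (λ q → ℕₚ.<⇒≢ (ℕ.s≤s (ℕₚ.m∸n≤m i 1)) (trans (sym q) eq))
        = lem (g i) (g (suc i)) (g (i ℕ.∸ 1))
        where
        lem : ∀ a b t → 1ℤ * b ≡ a * 1ℤ + ((t - a) * 0ℤ + (b - a) * 1ℤ)
        lem = solve-∀

  -- Radial functions and positive semidefiniteness

  quad : ∀ {n} → (Fin n → Fin n → ℤ) → (Fin n → ℤ) → ℤ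
  quad M f = sum λ x → sum λ y → M x y * (f x * f y)

  sum-product : ∀ {m n} (f : Fin m → ℤ) (g : Fin n → ℤ) → (sum λ x → sum λ y → f x * g y) ≡ sum f * sum g
  sum-product f g = begin
    (sum λ x → sum λ y → f x * g y) ≡⟨ sum-cong-≗ (λ x → trans (sum-* (f x) g) (ℤₚ.*-comm (f x) (sum g))) ⟩
    (sum λ x → sum g * f x)         ≡⟨ sum-* (sum g) f ⟩
    sum g * sum f                   ≡⟨ ℤₚ.*-comm (sum g) (sum f) ⟩
    sum f * sum g                   ∎
    where open ≡-Reasoning

  quad-shift : ∀ {n} (M : Fin n → Fin n → ℤ) f x c d →
    quad M (λ y → c * f y + d * δ x y) ≡ c * c * quad M f + c * d * ((sum λ y → M x y * f y) + (sum λ y → M y x * f y)) + d * d * M x x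
  quad-shift M f x c d = begin
    quad M (λ y → c * f y + d * δ x y)
      ≡⟨ sum-cong-≗ (λ y → trans (sum-cong-≗ (λ z → expand (M y z) (f y) (f z) (δ x y) (δ x z) c d))
           (trans (sum-+ (λ z → c * c * (M y z * (f y * f z)) + c * d * δ x y * (M y z * f z)) (λ z → δ x z * (c * d * (M y z * f y) + d * d * δ x y * M y z)))
             (cong₂ _+_ (sum-linear (c * c) (c * d * δ x y) (λ z → M y z * (f y * f z)) (λ z → M y z * f z)) (sum-δ x (λ z → c * d * (M y z * f y) + d * d * δ x y * M y z))))) ⟩
    (sum λ y → c * c * (sum λ z → M y z * (f y * f z)) + c * d * δ x y * (sum λ z → M y z * f z) + (c * d * (M y x * f y) + d * d * δ x y * M y x))
      ≡⟨ trans (sum-cong-≗ (λ y → regroup (sum λ z → M y z * (f y * f z)) (sum λ z → M y z * f z) (M y x * f y) (M y x) (δ x y) c d))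
           (trans (sum-+ (λ y → c * c * (sum λ z → M y z * (f y * f z)) + c * d * (M y x * f y)) (λ y → δ x y * (c * d * (sum λ z → M y z * f z) + d * d * M y x)))
             (cong₂ _+_ (sum-linear (c * c) (c * d) (λ y → sum λ z → M y z * (f y * f z)) (λ y → M y x * f y)) (sum-δ x (λ y → c * d * (sum λ z → M y z * f z) + d * d * M y x)))) ⟩
    c * c * quad M f + c * d * (sum λ y → M y x * f y) + (c * d * (sum λ y → M x y * f y) + d * d * M x x)
      ≡⟨ final (quad M f) (sum λ y → M x y * f y) (sum λ y → M y x * f y) (M x x) c d ⟩
    c * c * quad M f + c * d * ((sum λ y → M x y * f y) + (sum λ y → M y x * f y)) + d * d * M x x ∎
    where
    open ≡-Reasoning
    expand : ∀ m p q u v c d → m * ((c * p + d * u) * (c * q + d * v)) ≡ c * c * (m * (p * q)) + c * d * u * (m * q) + v * (c * d * (m * p) + d * d * u * m)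
    expand = solve-∀
    regroup : ∀ q s r m u c d → c * c * q + c * d * u * s + (c * d * r + d * d * u * m) ≡ c * c * q + c * d * r + u * (c * d * s + d * d * m)
    regroup = solve-∀
    final : ∀ q r s m c d → c * c * q + c * d * s + (c * d * r + d * d * m) ≡ c * c * q + c * d * (r + s) + d * d * m
    final = solve-∀

  module DistanceRegular (G : Graph) (D : ℕ) (bs cs : ℕ → ℕ) (dr : IsDistanceRegular G D bs cs) where
    open Graph G
    open Within G public
    open Distance G D (proj₁ (proj₁ dr)) public

    A : Fin n → Fin n → ℤ
    A x y = ⟦ adj x y ⟧

    A-sym : ∀ x y → A x y ≡ A y x
    A-sym x y = cong ⟦_⟧ (adj-sym x y)

    k : ℕ
    k = bs 0

    c-count : ∀ {i x y} → i ℕ.≤ D → atDist G x y i ≡ true → cNum G x y i ≡ cs i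
    c-count le h = proj₁ (proj₂ dr _ le _ _ h)

    b-count : ∀ {i x y} → i ℕ.≤ D → atDist G x y i ≡ true → bNum G x y i ≡ bs i
    b-count le h = proj₂ (proj₂ dr _ le _ _ h)

    -- Stepping back along a geodesic between two vertices at distance D meets every smaller
    -- distance. This supplies the pairs that make c_i and b_i positive.
    at-distance : ∀ {i} → i ℕ.≤ D → ∃ λ x → ∃ λ y → atDist G x y i ≡ true
    at-distance le = let x , y , h = proj₂ (proj₁ dr) in x , descend x (ℕₚ.≤⇒≤′ le) (y , h)
      where
      descend : ∀ x {i j} → i ℕ.≤′ j → (∃ λ y → atDist G x y j ≡ true) → ∃ λ y → atDist G x y i ≡ true
      descend x (ℕ.≤′-reflexive refl) p = p
      descend x (ℕ.≤′-step {j} le) (y , h) = let z , _ , q = atDist-pred j {x} h in descend x le (z , q)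

    c-pos : ∀ {i} → suc i ℕ.≤ D → 1 ℕ.≤ cs (suc i)
    c-pos {i} le =
      let x , y , h = at-distance le
          z , e , q = atDist-pred i {x} h
      in subst (1 ℕ.≤_) (c-count le h) (countFin-pos _ z (∧-intro e q))

    b-pos : ∀ {i} → suc i ℕ.≤ D → 1 ℕ.≤ bs i
    b-pos {i} le =
      let x , y , h = at-distance le
          z , e , q = atDist-pred i {x} h
      in subst (1 ℕ.≤_) (b-count (ℕₚ.≤-trans (ℕₚ.n≤1+n i) le) q) (countFin-pos _ y (∧-intro (adj-comm e) h))

    degree : ∀ y → sum (A y) ≡ + k
    degree y = begin
      sum (A y)                                       ≡⟨ sum-cong-≗ (λ z → sym (trans (cong (λ t → ⟦ adj y z ∧ t ⟧) (atDist₁-adj y z)) (trans (⟦⟧-∧ (adj y z) (adj y z)) (⟦⟧-idem (adj y z))))) ⟩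
      (sum λ z → ⟦ adj y z ∧ atDist G y z 1 ⟧)        ≡⟨ sym (countFin-sum (λ z → adj y z ∧ atDist G y z 1)) ⟩
      + bNum G y y 0                                  ≡⟨ cong +_ (b-count {0} {y} {y} ℕ.z≤n (within₀-refl y)) ⟩
      + k                                             ∎
      where open ≡-Reasoning

    -- The tridiagonal action of the adjacency matrix on functions of the distance; at i = 0
    -- the truncated index i ∸ 1 is harmless, as the difference vanishes.
    T : (ℕ → ℤ) → ℕ → ℤ
    T g i = g i * + k + ((g (i ℕ.∸ 1) - g i) * + cs i + (g (suc i) - g i) * + bs i)

    A-radial : ∀ (g : ℕ → ℤ) x y → (sum λ z → A y z * g (dist x z)) ≡ T g (dist x y)
    A-radial g x y = begin
      (sum λ z → A y z * g (dist x z)) ≡⟨ sum-cong-≗ (neighbour-split g x y) ⟩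
      (sum λ z → g i * A y z + (dc * pc z + db * pb z)) ≡⟨ sum-+ (λ z → g i * A y z) (λ z → dc * pc z + db * pb z) ⟩
      (sum λ z → g i * A y z) + (sum λ z → dc * pc z + db * pb z) ≡⟨ cong₂ _+_ (sum-* (g i) (A y)) (sum-linear dc db pc pb) ⟩
      g i * sum (A y) + (dc * sum pc + db * sum pb) ≡⟨ cong₂ _+_ (cong (λ t → g i * t) (degree y)) (cong₂ _+_ (cong (λ t → dc * t) cc) (cong (λ t → db * t) bb)) ⟩
      T g i ∎
      where
      open ≡-Reasoning
      i = dist x y
      dc = g (i ℕ.∸ 1) - g i
      db = g (suc i) - g i
      pc pb : Fin n → ℤ
      pc z = ⟦ adj y z ∧ atDist G x z (i ℕ.∸ 1) ⟧
      pb z = ⟦ adj y z ∧ atDist G x z (suc i) ⟧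
      cc : sum pc ≡ + cs i
      cc = trans (sym (countFin-sum (λ z → adj y z ∧ atDist G x z (i ℕ.∸ 1)))) (cong +_ (c-count (dist≤D x y) (atDist-dist x y)))
      bb : sum pb ≡ + bs i
      bb = trans (sym (countFin-sum (λ z → adj y z ∧ atDist G x z (suc i)))) (cong +_ (b-count (dist≤D x y) (atDist-dist x y)))

    module Eigenspace (κ θ : ℤ) (κ>0 : 0ℤ < κ) where

      Eigen : (Fin n → ℤ) → Set
      Eigen f = ∀ y → κ * (sum λ z → A y z * f z) ≡ θ * f y

      convolve : (ℕ → ℤ) → (Fin n → ℤ) → Fin n → ℤ
      convolve g f x = sum λ y → g (dist x y) * f y

      -- The matrix with entries `g (dist x y)`, an element of the Bose-Mesner algebra, acts on the
      -- eigenspace for θ / κ as the fraction v / τ. Numerator and denominator are fixed before the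
      -- vector `f`.
      Scalar : (ℕ → ℤ) → Set
      Scalar g = ∃ λ τ → ∃ λ v → 0ℤ < τ × (∀ f → Eigen f → ∀ x → τ * convolve g f x ≡ v * f x)

      scalar-cong : ∀ {g h} → (∀ j → j ℕ.≤ D → g j ≡ h j) → Scalar g → Scalar h
      scalar-cong e (τ , v , τ>0 , s) = τ , v , τ>0 , λ f ef x →
        trans (cong (λ t → τ * t) (sum-cong-≗ (λ y → cong (_* f y) (sym (e (dist x y) (dist≤D x y)))))) (s f ef x)

      scalar-linear : ∀ {g h} r s → Scalar g → Scalar h → Scalar (λ j → r * g j + s * h j)
      scalar-linear {g} {h} r s (τ , v , τ>0 , p) (τ′ , v′ , τ′>0 , p′) =
        τ * τ′ , r * τ′ * v + s * τ * v′ , pos-* τ>0 τ′>0 , λ f ef x →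
          trans (cong (λ t → τ * τ′ * t) (trans (sum-cong-≗ (λ y → distr r s (g (dist x y)) (h (dist x y)) (f y))) (sum-linear r s (λ y → g (dist x y) * f y) (λ y → h (dist x y) * f y))))
         (trans (shuffle τ τ′ r s (convolve g f x) (convolve h f x))
         (trans (cong₂ (λ a b → r * τ′ * a + s * τ * b) (p f ef x) (p′ f ef x))
                (collect (r * τ′) (s * τ) v v′ (f x))))
        where
        distr : ∀ r s a b c → (r * a + s * b) * c ≡ r * (a * c) + s * (b * c)
        distr = solve-∀
        shuffle : ∀ t u r s a b → t * u * (r * a + s * b) ≡ r * u * (t * a) + s * t * (u * b)
        shuffle = solve-∀
        collect : ∀ p q v w c → p * (v * c) + q * (w * c) ≡ (p * v + q * w) * c
        collect = solve-∀

      scalar-cancel : ∀ {g} c → 0ℤ < c → Scalar (λ j → c * g j) → Scalar g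
      scalar-cancel {g} c c>0 (τ , v , τ>0 , p) = τ * c , v , pos-* τ>0 c>0 , λ f ef x →
        trans (assoc τ c (convolve g f x))
        (trans (cong (λ t → τ * t) (trans (sym (sum-* c (λ y → g (dist x y) * f y))) (sum-cong-≗ (λ y → sym (ℤₚ.*-assoc c (g (dist x y)) (f y)))))) (p f ef x))
        where
        assoc : ∀ a b c → a * b * c ≡ a * (b * c)
        assoc = solve-∀

      -- By `A-radial` and the symmetry of A, convolving with `T g` amounts to applying A to `f`
      -- before convolving with `g`, which contributes the factor θ / κ.
      scalar-T : ∀ {g} → Scalar g → Scalar (T g)
      scalar-T {g} (τ , v , τ>0 , p) = κ * τ , θ * v , pos-* κ>0 τ>0 , λ f ef x → begin
        κ * τ * convolve (T g) f x
          ≡⟨ cong (λ t → κ * τ * t) (sum-cong-≗ (λ y → trans (ℤₚ.*-comm (T g (dist x y)) (f y)) (trans (cong (λ t → f y * t) (sym (A-radial g x y))) (sym (sum-* (f y) (λ z → A y z * g (dist x z))))))) ⟩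
        κ * τ * (sum λ y → sum λ z → f y * (A y z * g (dist x z)))
          ≡⟨ cong (λ t → κ * τ * t) (trans (∑-comm (λ y z → f y * (A y z * g (dist x z)))) (sum-cong-≗ (λ z → trans (sum-cong-≗ (λ y → trans (cong (λ t → f y * (t * g (dist x z))) (A-sym y z)) (swap (f y) (A z y) (g (dist x z))))) (sum-* (g (dist x z)) (λ y → A z y * f y))))) ⟩
        κ * τ * (sum λ z → g (dist x z) * (sum λ y → A z y * f y))
          ≡⟨ trans (rot κ τ (sum λ z → g (dist x z) * (sum λ y → A z y * f y))) (cong (λ t → τ * t) (sym (sum-* κ (λ z → g (dist x z) * (sum λ y → A z y * f y))))) ⟩
        τ * (sum λ z → κ * (g (dist x z) * (sum λ y → A z y * f y)))
          ≡⟨ cong (λ t → τ * t) (sum-cong-≗ (λ z → trans (front κ (g (dist x z)) (sum λ y → A z y * f y)) (trans (cong (λ t → g (dist x z) * t) (ef z)) (front (g (dist x z)) θ (f z))))) ⟩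
        τ * (sum λ z → θ * (g (dist x z) * f z))
          ≡⟨ cong (λ t → τ * t) (sum-* θ (λ z → g (dist x z) * f z)) ⟩
        τ * (θ * convolve g f x)
          ≡⟨ front τ θ (convolve g f x) ⟩
        θ * (τ * convolve g f x)
          ≡⟨ cong (λ t → θ * t) (p f ef x) ⟩
        θ * (v * f x)
          ≡⟨ sym (ℤₚ.*-assoc θ v (f x)) ⟩
        θ * v * f x ∎
        where
        open ≡-Reasoning
        swap : ∀ a b c → a * (b * c) ≡ c * (b * a)
        swap = solve-∀
        rot : ∀ a b c → a * b * c ≡ b * (a * c)
        rot = solve-∀
        front : ∀ a b c → a * (b * c) ≡ b * (a * c)
        front = solve-∀

      scalar-δ : ∀ {g} → (∀ j → 0 ℕ.< j → j ℕ.≤ D → g j ≡ 0ℤ) → Scalar g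
      scalar-δ {g} v = 1ℤ , g 0 , ℤ.+<+ (ℕ.s≤s ℕ.z≤n) , λ f _ x →
        trans (ℤₚ.*-identityˡ _) (trans (sum-cong-≗ (term f x)) (sum-δ x (λ y → g 0 * f y)))
        where
        term : ∀ f x y → g (dist x y) * f y ≡ δ x y * (g 0 * f y)
        term f x y with x Fin.≟ y
        ... | yes refl = trans (cong (λ i → g i * f x) (dist-refl x)) (sym (ℤₚ.*-identityˡ _))
        ... | no ne    = trans (cong (_* f y) (v (dist x y) (ℕₚ.n≢0⇒n>0 (λ e → ne (dist₀ e))) (dist≤D x y)))
                               (trans (ℤₚ.*-zeroˡ (f y)) (sym (ℤₚ.*-zeroˡ (g 0 * f y))))

      -- Induction on the support of `g`, in place of writing its matrix as a polynomial in A. For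
      -- the indicator `h` of 0, ..., i, the function `T h` equals c_{i+1} at i + 1 and vanishes
      -- above. Hence c_{i+1} g - g (i + 1) T h is supported on 0, ..., i, and c_{i+1} > 0 can be
      -- cancelled.
      scalar-below : ∀ i → i ℕ.≤ D → ∀ g → (∀ j → i ℕ.< j → j ℕ.≤ D → g j ≡ 0ℤ) → Scalar g
      scalar-below zero _ g v = scalar-δ {g} v
      scalar-below (suc i) le g v =
        scalar-cancel {g} c (ℤ.+<+ (c-pos le))
          (scalar-cong {λ j → 1ℤ * rest j + g (suc i) * T h j} {λ j → c * g j} (λ j _ → recombine c (g (suc i)) (g j) (T h j))
            (scalar-linear {rest} {T h} 1ℤ (g (suc i)) (scalar-below i i≤D rest rest-vanishes) (scalar-T {h} (scalar-below i i≤D h (λ j lt _ → h-above lt)))))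
        where
        i≤D = ℕₚ.≤-trans (ℕₚ.n≤1+n i) le
        c = + cs (suc i)
        h : ℕ → ℤ
        h j = ⟦ does (j ℕ.≤? i) ⟧
        h-above : ∀ {j} → i ℕ.< j → h j ≡ 0ℤ
        h-above {j} lt = cong ⟦_⟧ (dec-false (j ℕ.≤? i) (ℕₚ.<⇒≱ lt))
        h-at : h i ≡ 1ℤ
        h-at = cong ⟦_⟧ (dec-true (i ℕ.≤? i) ℕₚ.≤-refl)
        rest : ℕ → ℤ
        rest j = c * g j - g (suc i) * T h j
        recombine : ∀ c s a t → 1ℤ * (c * a - s * t) + s * t ≡ c * a
        recombine = solve-∀
        T-top : T h (suc i) ≡ c
        T-top rewrite h-above {suc i} ℕₚ.≤-refl | h-above {suc (suc i)} (ℕₚ.n≤1+n (suc i)) | h-at = eq (+ k) c (+ bs (suc i))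
          where
          eq : ∀ k c b → 0ℤ * k + ((1ℤ - 0ℤ) * c + (0ℤ - 0ℤ) * b) ≡ c
          eq = solve-∀
        T-above : ∀ j → suc i ℕ.< j → T h j ≡ 0ℤ
        T-above (suc j) (ℕ.s≤s lt) rewrite h-above lt | h-above {suc j} (ℕₚ.m≤n⇒m≤1+n lt) | h-above {suc (suc j)} (ℕₚ.m≤n⇒m≤1+n (ℕₚ.m≤n⇒m≤1+n lt)) =
          eq (+ k) (+ cs (suc j)) (+ bs (suc j))
          where
          eq : ∀ k c b → 0ℤ * k + ((0ℤ - 0ℤ) * c + (0ℤ - 0ℤ) * b) ≡ 0ℤ
          eq = solve-∀
        rest-vanishes : ∀ j → i ℕ.< j → j ℕ.≤ D → rest j ≡ 0ℤ
        rest-vanishes j lt jD with ℕₚ.m≤n⇒m<n∨m≡n lt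
        ... | inj₂ refl rewrite T-top = eq c (g (suc i))
          where
          eq : ∀ c s → c * s - s * c ≡ 0ℤ
          eq = solve-∀
        ... | inj₁ gt rewrite v j gt jD | T-above j gt = eq c (g (suc i))
          where
          eq : ∀ c s → c * 0ℤ - s * 0ℤ ≡ 0ℤ
          eq = solve-∀

      scalar : ∀ g → Scalar g
      scalar g = scalar-below D ℕₚ.≤-refl g (λ j lt le → ⊥-elim (ℕₚ.<⇒≱ lt le))

      -- E x y = w (dist x y) satisfies E² = cE with c > 0.
      radial-psd : ∀ (w : ℕ → ℤ) → (∀ i → i ℕ.≤ D → κ * T w i ≡ θ * w i) → 0ℤ < w 0 →
                   ∀ f → 0ℤ ≤ quad (λ x y → w (dist x y)) f
      radial-psd w eig w₀>0 f = cancel-nonneg v v>0 (subst (0ℤ ≤_) (sym squares) (nonneg-* (ℤₚ.<⇒≤ τ>0) (sum-nonneg (λ y → square-nonneg (E y)))))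
        where
        open ≡-Reasoning
        col : Fin n → Fin n → ℤ
        col x y = w (dist x y)
        col-eigen : ∀ x → Eigen (col x)
        col-eigen x y = trans (cong (λ t → κ * t) (A-radial w x y)) (eig (dist x y) (dist≤D x y))
        τ = proj₁ (scalar w)
        v = proj₁ (proj₂ (scalar w))
        τ>0 = proj₁ (proj₂ (proj₂ (scalar w)))
        E² : ∀ x₀ x → τ * (sum λ y → col x y * col x₀ y) ≡ v * col x₀ x
        E² x₀ = proj₂ (proj₂ (proj₂ (scalar w))) (col x₀) (col-eigen x₀)
        E : Fin n → ℤ
        E y = sum λ x → f x * col x y
        -- Compare the diagonal entries in E² = (v / τ) E: on the left stands a sum of squares, one
        -- of which is the square of `w 0`.
        v>0 : 0ℤ < v
        v>0 = cancel-pos (w 0) (ℤₚ.<⇒≤ w₀>0) (subst (0ℤ <_) eq (pos-* τ>0 (ℤₚ.<-≤-trans (pos-* w₀>0 w₀>0) (subst (λ i → w i * w i ≤ sum (λ y → col x y * col x y)) (dist-refl x) (term≤sum {f = λ y → col x y * col x y} (λ y → square-nonneg (col x y)) x)))))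
          where
          x = proj₁ (proj₂ (proj₁ dr))
          eq : τ * (sum λ y → col x y * col x y) ≡ w 0 * v
          eq = trans (E² x x) (trans (cong (λ i → v * w i) (dist-refl x)) (ℤₚ.*-comm v (w 0)))
        squares : v * quad col f ≡ τ * (sum λ y → E y * E y)
        squares = begin
          v * quad col f
            ≡⟨ sym (sum²-* v (λ x x′ → col x x′ * (f x * f x′))) ⟩
          (sum λ x → sum λ x′ → v * (col x x′ * (f x * f x′)))
            ≡⟨ sum-cong-≗ (λ x → sum-cong-≗ (λ x′ → trans (sym (ℤₚ.*-assoc v (col x x′) (f x * f x′))) (trans (cong (_* (f x * f x′)) (sym (E² x x′))) (trans (ℤₚ.*-assoc τ _ _) (cong (λ t → τ * t) (trans (ℤₚ.*-comm _ (f x * f x′)) (sym (sum-* (f x * f x′) (λ y → col x′ y * col x y))))))))) ⟩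
          (sum λ x → sum λ x′ → τ * (sum λ y → f x * f x′ * (col x′ y * col x y)))
            ≡⟨ sum²-* τ (λ x x′ → sum λ y → f x * f x′ * (col x′ y * col x y)) ⟩
          τ * (sum λ x → sum λ x′ → sum λ y → f x * f x′ * (col x′ y * col x y))
            ≡⟨ cong (λ t → τ * t) (trans (sum-cong-≗ (λ x → ∑-comm (λ x′ y → f x * f x′ * (col x′ y * col x y)))) (∑-comm (λ x y → sum λ x′ → f x * f x′ * (col x′ y * col x y)))) ⟩
          τ * (sum λ y → sum λ x → sum λ x′ → f x * f x′ * (col x′ y * col x y))
            ≡⟨ cong (λ t → τ * t) (sum-cong-≗ (λ y → trans (sum-cong-≗ (λ x → sum-cong-≗ (λ x′ → pair (f x) (f x′) (col x′ y) (col x y)))) (sum-product (λ x → f x * col x y) (λ x′ → f x′ * col x′ y)))) ⟩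
          τ * (sum λ y → E y * E y) ∎
          where
          pair : ∀ a b c d → a * b * (c * d) ≡ a * d * (b * c)
          pair = solve-∀

  -- Classical parameters

  gauss-pow : ∀ t i → suc t ℕ.^ i ≡ 1 ℕ.+ t ℕ.* gauss i (suc t)
  gauss-pow t zero    = cong suc (sym (ℕₚ.*-zeroʳ t))
  gauss-pow t (suc i) = begin
    suc t ℕ.^ i ℕ.+ t ℕ.* suc t ℕ.^ i                    ≡⟨ cong (ℕ._+ t ℕ.* suc t ℕ.^ i) (gauss-pow t i) ⟩
    1 ℕ.+ t ℕ.* gauss i (suc t) ℕ.+ t ℕ.* suc t ℕ.^ i    ≡⟨ cong suc (sym (ℕₚ.*-distribˡ-+ t (gauss i (suc t)) (suc t ℕ.^ i))) ⟩
    1 ℕ.+ t ℕ.* gauss (suc i) (suc t)                    ∎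
    where open ≡-Reasoning

  gauss-suc : ∀ b i → gauss (suc i) b ≡ 1 ℕ.+ b ℕ.* gauss i b
  gauss-suc b zero    = cong suc (sym (ℕₚ.*-zeroʳ b))
  gauss-suc b (suc i) = trans (cong (ℕ._+ b ℕ.^ suc i) (gauss-suc b i)) (cong suc (sym (ℕₚ.*-distribˡ-+ b (gauss i b) (b ℕ.^ i))))

  gauss-mono : ∀ b {i j} → i ℕ.≤ j → gauss i b ℕ.≤ gauss j b
  gauss-mono b le = go (ℕₚ.≤⇒≤′ le)
    where
    go : ∀ {i j} → i ℕ.≤′ j → gauss i b ℕ.≤ gauss j b
    go (ℕ.≤′-reflexive refl) = ℕₚ.≤-refl
    go (ℕ.≤′-step {j} p)     = ℕₚ.≤-trans (go p) (ℕₚ.m≤m+n _ _)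

  -- The classical parameters scaled by m = b + 1 = t + 2, which makes them integral:
  -- a = mα and β = mβ in the notation of the paper.
  module Classical (G : Graph) (D′ t : ℕ) (a β : ℤ) (bs cs : ℕ → ℕ)
    (dr : IsDistanceRegular G (suc D′) bs cs)
    (c-formula : ∀ i → i ℕ.≤ suc D′ → + suc (suc t) * + cs i ≡ + gauss i (suc t) * (+ suc (suc t) + a * + gauss (i ℕ.∸ 1) (suc t)))
    (b-formula : ∀ i → i ℕ.≤ suc D′ → + suc (suc t) * + bs i ≡ (+ gauss (suc D′) (suc t) - + gauss i (suc t)) * (β - a * + gauss i (suc t)))
    (a≥0 : 0ℤ ≤ a) (β-large : a * + gauss D′ (suc t) < β)
    where
    open Graph G
    open DistanceRegular G (suc D′) bs cs dr public

    D = suc D′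
    b m Γ H : ℤ
    b = + suc t
    m = + suc (suc t)
    Γ = + gauss D (suc t)
    H = + gauss D′ (suc t)

    g : ℕ → ℤ
    g i = + gauss i (suc t)

    m>0 : 0ℤ < m
    m>0 = ℤ.+<+ (ℕ.s≤s ℕ.z≤n)

    g-suc : ∀ i → g (suc i) ≡ 1ℤ + b * g i
    g-suc i = trans (cong +_ (gauss-suc (suc t) i)) (cong (λ u → 1ℤ + u) (ℤₚ.pos-* (suc t) (gauss i (suc t))))

    k-formula : m * + k ≡ Γ * β
    k-formula = trans (b-formula 0 ℕ.z≤n) (eq Γ β a)
      where
      eq : ∀ Γ β a → (Γ - 0ℤ) * (β - a * 0ℤ) ≡ Γ * β
      eq = solve-∀

    T-formula : ∀ w i → i ℕ.≤ D → m * T w i ≡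
      w i * (Γ * β) + ((w (i ℕ.∸ 1) - w i) * (g i * (m + a * g (i ℕ.∸ 1))) + (w (suc i) - w i) * ((Γ - g i) * (β - a * g i)))
    T-formula w i le = trans (distr m (w i) (+ k) (w (i ℕ.∸ 1) - w i) (+ cs i) (w (suc i) - w i) (+ bs i))
      (cong₂ (λ p q → w i * p + q) k-formula (cong₂ (λ p q → (w (i ℕ.∸ 1) - w i) * p + (w (suc i) - w i) * q) (c-formula i le) (b-formula i le)))
      where
      distr : ∀ m x k y c z b → m * (x * k + (y * c + z * b)) ≡ x * (m * k) + (y * (m * c) + z * (m * b))
      distr = solve-∀

    gap>0 : ∀ i → i ℕ.≤ D′ → 0ℤ < β - a * g i
    gap>0 i le = <-diff (ℤₚ.≤-<-trans (*-mono a a≥0 (ℤ.+≤+ (gauss-mono (suc t) le))) β-large)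

    ag≥0 : ∀ i → 0ℤ ≤ a * g i
    ag≥0 i = nonneg-* a≥0 (ℤ.+≤+ ℕ.z≤n)

    β>0 : 0ℤ < β
    β>0 = ℤₚ.≤-<-trans (ag≥0 D′) β-large

    -- The cosine sequence of the smallest eigenvalue -[D], cleared of denominators.
    module Smallest where
      -- Consecutive cosines have the ratio -(m + a [i]) / (β - a [i]). `up i` collects the
      -- numerators of the indices below i, and `dn (D - i)` the denominators of the indices i, ...,
      -- D - 1, so that all fractions share one denominator.
      up dn : ℕ → ℤ
      up zero    = 1ℤ
      up (suc i) = - (m + a * g i) * up i
      dn zero    = 1ℤ
      dn (suc s) = (β - a * g (D′ ℕ.∸ s)) * dn s

      w : ℕ → ℤ
      w i = up i * dn (D ℕ.∸ i)

      dn>0 : ∀ s → 0ℤ < dn s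
      dn>0 zero    = ℤ.+<+ (ℕ.s≤s ℕ.z≤n)
      dn>0 (suc s) = pos-* (gap>0 (D′ ℕ.∸ s) (ℕₚ.m∸n≤m D′ s)) (dn>0 s)

      ratio : ∀ i → i ℕ.≤ D′ → (β - a * g i) * w (suc i) ≡ - (m + a * g i) * w i
      ratio i le = trans (eq (β - a * g i) (- (m + a * g i)) (up i) (dn (D′ ℕ.∸ i))) (cong (λ d → - (m + a * g i) * (up i * d)) (sym dn-top))
        where
        eq : ∀ p q u d → p * (q * u * d) ≡ q * (u * (p * d))
        eq = solve-∀
        dn-top : dn (D ℕ.∸ i) ≡ (β - a * g i) * dn (D′ ℕ.∸ i)
        dn-top = trans (cong dn (ℕₚ.+-∸-assoc 1 le)) (cong (λ j → (β - a * g j) * dn (D′ ℕ.∸ i)) (ℕₚ.m∸[m∸n]≡n le))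

      -- c_i contains the factor m + a [i - 1] and b_i the factor β - a [i], so `ratio` turns the
      -- values at both neighbouring indices into multiples of `w i`. At the ends, where `ratio`
      -- does not apply, the coefficients [0] and Γ - [D] vanish.
      eigen : ∀ i → i ℕ.≤ D → m * T w i ≡ - (m * Γ) * w i
      eigen i le = trans (T-formula w i le) (trans (split (w i) (w (i ℕ.∸ 1)) (w (suc i)) (Γ * β) (g i * (m + a * g (i ℕ.∸ 1))) (Γ - g i) (β - a * g i))
        (trans (cong₂ (λ p q → w i * (Γ * β - g i * (m + a * g (i ℕ.∸ 1)) - (Γ - g i) * (β - a * g i)) + p + q) (lower i le) (upper i le))
               (collect Γ β m a (g i) (g (i ℕ.∸ 1)) (w i))))
        where
        split : ∀ x y z Γβ mc u v → x * Γβ + ((y - x) * mc + (z - x) * (u * v)) ≡ x * (Γβ - mc - u * v) + mc * y + u * (v * z)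
        split = solve-∀
        collect : ∀ Γ β m a g p x → x * (Γ * β - g * (m + a * p) - (Γ - g) * (β - a * g)) + - (g * (β - a * p)) * x + - ((Γ - g) * (m + a * g)) * x ≡ - (m * Γ) * x
        collect = solve-∀
        lower : ∀ i → i ℕ.≤ D → g i * (m + a * g (i ℕ.∸ 1)) * w (i ℕ.∸ 1) ≡ - (g i * (β - a * g (i ℕ.∸ 1))) * w i
        lower zero    _ = eq (m + a * 0ℤ) (w 0) (β - a * 0ℤ)
          where
          eq : ∀ p x q → 0ℤ * p * x ≡ - (0ℤ * q) * x
          eq = solve-∀
        lower (suc j) (ℕ.s≤s le′) = trans (eq₁ (g (suc j)) (m + a * g j) (w j)) (trans (cong (λ u → - (g (suc j) * u)) (sym (ratio j le′))) (eq₂ (g (suc j)) (β - a * g j) (w (suc j))))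
          where
          eq₁ : ∀ g p x → g * p * x ≡ - (g * (- p * x))
          eq₁ = solve-∀
          eq₂ : ∀ g p x → - (g * (p * x)) ≡ - (g * p) * x
          eq₂ = solve-∀
        upper : ∀ i → i ℕ.≤ D → (Γ - g i) * ((β - a * g i) * w (suc i)) ≡ - ((Γ - g i) * (m + a * g i)) * w i
        upper i le with ℕₚ.m≤n⇒m<n∨m≡n le
        ... | inj₁ (ℕ.s≤s lt) = trans (cong (λ u → (Γ - g i) * u) (ratio i lt)) (eq (Γ - g i) (m + a * g i) (w i))
          where
          eq : ∀ d p x → d * (- p * x) ≡ - (d * p) * x
          eq = solve-∀
        ... | inj₂ refl = eq Γ (m + a * g D) (w D) ((β - a * g D) * w (suc D))
          where
          eq : ∀ Γ p x y → (Γ - Γ) * y ≡ - ((Γ - Γ) * p) * x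
          eq = solve-∀

    -- The clique bound from the smallest eigenvalue

    Clique : (Fin n → Bool) → Set
    Clique K = ∀ p q → K p ≡ true → K q ≡ true → p ≢ q → adj p q ≡ true

    dist-adj : ∀ {x y} → adj x y ≡ true → dist x y ≡ 1
    dist-adj e = dist-unique (adj⇒atDist₁ e)

    quad-clique : ∀ (w : ℕ → ℤ) K → Clique K →
      quad (λ p q → w (dist p q)) (λ p → ⟦ K p ⟧) ≡ size K * (w 0 + (size K - 1ℤ) * w 1)
    quad-clique w K cl = begin
      quad (λ p q → w (dist p q)) (λ p → ⟦ K p ⟧)
        ≡⟨ sum-cong-≗ (λ p → trans (sum-cong-≗ (term p)) (trans (sum-linear (w 1 * ⟦ K p ⟧) (w 0 - w 1) (λ q → ⟦ K q ⟧) (λ q → δ p q * ⟦ K q ⟧))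
                              (cong (λ u → w 1 * ⟦ K p ⟧ * size K + (w 0 - w 1) * u) (sum-δ p (λ q → ⟦ K q ⟧))))) ⟩
      (sum λ p → w 1 * ⟦ K p ⟧ * size K + (w 0 - w 1) * ⟦ K p ⟧)
        ≡⟨ trans (sum-cong-≗ (λ p → assoc (w 1) ⟦ K p ⟧ (size K) (w 0))) (sum-* (w 1 * size K + (w 0 - w 1)) (λ p → ⟦ K p ⟧)) ⟩
      (w 1 * size K + (w 0 - w 1)) * size K
        ≡⟨ final (w 0) (w 1) (size K) ⟩
      size K * (w 0 + (size K - 1ℤ) * w 1) ∎
      where
      open ≡-Reasoning
      assoc : ∀ u p s v → u * p * s + (v - u) * p ≡ (u * s + (v - u)) * p
      assoc = solve-∀
      final : ∀ v u s → (u * s + (v - u)) * s ≡ s * (v + (s - 1ℤ) * u)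
      final = solve-∀
      term : ∀ p q → w (dist p q) * (⟦ K p ⟧ * ⟦ K q ⟧) ≡ w 1 * ⟦ K p ⟧ * ⟦ K q ⟧ + (w 0 - w 1) * (δ p q * ⟦ K q ⟧)
      term p q with p Fin.≟ q
      ... | yes refl rewrite dist-refl p | ⟦⟧-idem (K p) = eq (w 0) (w 1) ⟦ K p ⟧ (⟦⟧-idem (K p))
        where
        ring : ∀ v u k → u * k * k + (v - u) * (1ℤ * k) ≡ u * (k * k) + (v - u) * k
        ring = solve-∀
        ring′ : ∀ v u k → v * k ≡ u * k + (v - u) * k
        ring′ = solve-∀
        eq : ∀ v u k → k * k ≡ k → v * k ≡ u * k * k + (v - u) * (1ℤ * k)
        eq v u k e = trans (ring′ v u k) (trans (cong (λ z → u * z + (v - u) * k) (sym e)) (sym (ring v u k)))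
      ... | no ne with K p in kp | K q in kq
      ...   | true  | true  rewrite dist-adj (cl p q kp kq ne) = eq (w 0) (w 1)
        where
        eq : ∀ v u → u * (1ℤ * 1ℤ) ≡ u * 1ℤ * 1ℤ + (v - u) * (0ℤ * 1ℤ)
        eq = solve-∀
      ...   | true  | false = eq (w 0) (w 1) (w (dist p q))
        where
        eq : ∀ v u x → x * (1ℤ * 0ℤ) ≡ u * 1ℤ * 0ℤ + (v - u) * (0ℤ * 0ℤ)
        eq = solve-∀
      ...   | false | kq′   = eq (w 0) (w 1) (w (dist p q)) ⟦ kq′ ⟧
        where
        eq : ∀ v u x k → x * (0ℤ * k) ≡ u * 0ℤ * k + (v - u) * (0ℤ * k)
        eq = solve-∀

    -- Delsarte's bound. At the indicator of a clique with s elements the form is s (w 0 + (s - 1) w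
    -- 1), and w 1 / w 0 = - m / β.
    clique-bound : ∀ K → Clique K → 0ℤ < size K → m * (size K - 1ℤ) ≤ β
    clique-bound K cl s>0 = ≤-by (cancel-nonneg (w 0) w₀>0 (subst (0ℤ ≤_) expand (nonneg-* (ℤₚ.<⇒≤ β>0) half)))
      where
      open Smallest
      open ≡-Reasoning
      w₀>0 : 0ℤ < w 0
      w₀>0 = pos-* {1ℤ} (ℤ.+<+ (ℕ.s≤s ℕ.z≤n)) (dn>0 D)
      half : 0ℤ ≤ w 0 + (size K - 1ℤ) * w 1
      half = cancel-nonneg (size K) s>0 (subst (0ℤ ≤_) (quad-clique w K cl)
               (Eigenspace.radial-psd m (- (m * Γ)) m>0 w eigen w₀>0 (λ p → ⟦ K p ⟧)))
      ratio₀ : β * w 1 ≡ - m * w 0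
      ratio₀ = trans (eq₁ β a (w 1)) (trans (ratio 0 ℕ.z≤n) (eq₂ m a (w 0)))
        where
        eq₁ : ∀ β a x → β * x ≡ (β - a * 0ℤ) * x
        eq₁ = solve-∀
        eq₂ : ∀ m a x → - (m + a * 0ℤ) * x ≡ - m * x
        eq₂ = solve-∀
      expand : β * (w 0 + (size K - 1ℤ) * w 1) ≡ w 0 * (β - m * (size K - 1ℤ))
      expand = trans (eq₁ β (w 0) (size K - 1ℤ) (w 1)) (trans (cong (λ u → β * w 0 + (size K - 1ℤ) * u) ratio₀) (eq₂ β (w 0) (size K - 1ℤ) m))
        where
        eq₁ : ∀ β x s y → β * (x + s * y) ≡ β * x + s * (β * y)
        eq₁ = solve-∀
        eq₂ : ∀ β x s m → β * x + s * (- m * x) ≡ x * (β - m * s)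
        eq₂ = solve-∀

    -- The cosine sequence of the second largest eigenvalue is affine in b ^ -i.
    module Second (t>0 : 1 ℕ.≤ t) where
      -- The exponent is D + 1 - i rather than D - i, so that `e i` = b `e (suc i)` still holds at i
      -- = D and the eigenvalue equation needs no separate case there.
      e : ℕ → ℤ
      e i = + (suc t ℕ.^ (suc D ℕ.∸ i))

      -- θ / m is the eigenvalue b₁ / b - 1. The ratio of `K` to `P` is forced by the equation at i
      -- = 0, namely w 1 / w 0 = θ / (Γ β), the eigenvalue divided by the valency. With this scaling
      -- `w 0` = b e₁ t Γ β and `w 1` = b e₁ t θ, where e₁ is `e 1`.
      S K P θ : ℤ
      S = β + a * (Γ - 1ℤ) + b * m
      K = e 1 * β + a * (Γ - 1ℤ) + b * m
      P = b * e 1 * S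
      θ = H * (β - a) - m

      w : ℕ → ℤ
      w i = K * e i - P

      e-suc : ∀ i → i ℕ.≤ D → e i ≡ b * e (suc i)
      e-suc i le = trans (cong (λ j → + (suc t ℕ.^ j)) (ℕₚ.+-∸-assoc 1 le)) (ℤₚ.pos-* (suc t) _)

      pow-g : ∀ i → + (suc t ℕ.^ i) ≡ 1ℤ + + t * g i
      pow-g i = trans (cong +_ (gauss-pow t i)) (cong (λ u → 1ℤ + u) (ℤₚ.pos-* t (gauss i (suc t))))

      e₁ : e 1 ≡ 1ℤ + + t * Γ
      e₁ = pow-g D

      e-top : ∀ i → i ℕ.≤ D → e 1 ≡ e (suc i) * (1ℤ + + t * g i)
      e-top i le = trans (cong +_ (trans (cong (suc t ℕ.^_) (sym (ℕₚ.m∸n+n≡m le))) (ℕₚ.^-distribˡ-+-* (suc t) (D ℕ.∸ i) i)))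
                  (trans (ℤₚ.pos-* (suc t ℕ.^ (D ℕ.∸ i)) _) (cong (λ u → e (suc i) * u) (pow-g i)))

      eigen : ∀ i → i ℕ.≤ D → m * T w i ≡ θ * w i
      eigen i le = trans (T-formula w i le)
        (trans (cong₂ (λ p q → w i * (Γ * β) + (p + q * ((Γ - g i) * (β - a * g i)))) (lower i le) (upper {i} (e-suc i le)))
               (identity (+ t) Γ H (g i) a β (e (suc i)) (e 1) (e i) (e-suc i le) (e-top i le) e₁ (g-suc D′)))
        where
        lower : ∀ i → i ℕ.≤ D → (w (i ℕ.∸ 1) - w i) * (g i * (m + a * g (i ℕ.∸ 1))) ≡ K * + t * e (suc i) * (g i * (b * m + a * (g i - 1ℤ)))
        lower zero _ = eq (w 0 - w 0) (m + a * 0ℤ) (K * + t * e 1) (b * m + a * (0ℤ - 1ℤ))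
          where
          eq : ∀ x y u v → x * (0ℤ * y) ≡ u * (0ℤ * v)
          eq = solve-∀
        lower (suc j) le = eq (+ t) m a (g j) K P _ (e-suc (suc j) le) (e-suc j (ℕₚ.≤-trans (ℕₚ.n≤1+n j) le)) (g-suc j)
          where
          ring : ∀ t m a h K P e → let b = 1ℤ + t in (K * (b * (b * e)) - P - (K * (b * e) - P)) * ((1ℤ + b * h) * (m + a * h)) ≡ K * t * e * ((1ℤ + b * h) * (b * m + a * ((1ℤ + b * h) - 1ℤ)))
          ring = solve-∀
          eq : ∀ t m a h K P e {e₁ e₂ g} → let b = 1ℤ + t in e₁ ≡ b * e → e₂ ≡ b * e₁ → g ≡ 1ℤ + b * h →
               (K * e₂ - P - (K * e₁ - P)) * (g * (m + a * h)) ≡ K * t * e * (g * (b * m + a * (g - 1ℤ)))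
          eq t m a h K P e refl refl refl = ring t m a h K P e
        upper : ∀ {i} → e i ≡ b * e (suc i) → w (suc i) - w i ≡ - (K * + t * e (suc i))
        upper {i} eq = trans (cong (λ u → K * e (suc i) - P - (K * u - P)) eq) (ring (+ t) K P (e (suc i)))
          where
          ring : ∀ t K P e → K * e - P - (K * ((1ℤ + t) * e) - P) ≡ - (K * t * e)
          ring = solve-∀
        identity : ∀ t Γ H g a β e E e′ → let b = 1ℤ + t; m = 1ℤ + b; S = β + a * (Γ - 1ℤ) + b * m; K = E * β + a * (Γ - 1ℤ) + b * m; w = K * e′ - b * E * S in
          e′ ≡ b * e → E ≡ e * (1ℤ + t * g) → E ≡ 1ℤ + t * Γ → Γ ≡ 1ℤ + b * H →
          w * (Γ * β) + (K * t * e * (g * (b * m + a * (g - 1ℤ))) + - (K * t * e) * ((Γ - g) * (β - a * g))) ≡ (H * (β - a) - m) * w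
        -- The relations among the powers of b are used only as t Γ = E - 1, t e g = E - e and b H =
        -- Γ - 1. The ring identities between the substitutions expose exactly these products.
        identity t Γ H g a β e E _ refl p q r = begin
          _ ≡⟨ ring₁ t Γ g a β e E (E * β + a * (Γ - 1ℤ) + (1ℤ + t) * (1ℤ + (1ℤ + t))) ⟩
          _ ≡⟨ cong₂ (λ u v → ((E * β + a * (Γ - 1ℤ) + (1ℤ + t) * (1ℤ + (1ℤ + t))) * e - E * (β + a * (Γ - 1ℤ) + (1ℤ + t) * (1ℤ + (1ℤ + t)))) * (Γ * β + u * β)
                              + (E * β + a * (Γ - 1ℤ) + (1ℤ + t) * (1ℤ + (1ℤ + t))) * (v * (β + a * (Γ - 1ℤ) + (1ℤ + t) * (1ℤ + (1ℤ + t))) - e * u * β))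
                     (shift₁ {E} {t * Γ} q) (shift₂ p) ⟩
          _ ≡⟨ ring₂ t Γ a β e E ⟩
          _ ≡⟨ cong (λ u → ((E * β + a * (Γ - 1ℤ) + (1ℤ + t) * (1ℤ + (1ℤ + t))) * e - E * (β + a * (Γ - 1ℤ) + (1ℤ + t) * (1ℤ + (1ℤ + t)))) * (u * (β - a) - (1ℤ + t) * (1ℤ + (1ℤ + t)))) (sym (shift₁ {Γ} {(1ℤ + t) * H} r)) ⟩
          _ ≡⟨ ring₃ t H a β e E (E * β + a * (Γ - 1ℤ) + (1ℤ + t) * (1ℤ + (1ℤ + t))) (β + a * (Γ - 1ℤ) + (1ℤ + t) * (1ℤ + (1ℤ + t))) ⟩
          _ ∎
          where
          open ≡-Reasoning
          shift₁ : ∀ {x y} → x ≡ 1ℤ + y → y ≡ x - 1ℤ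
          shift₁ {y = y} refl = eq y
            where
            eq : ∀ y → y ≡ 1ℤ + y - 1ℤ
            eq = solve-∀
          shift₂ : E ≡ e * (1ℤ + t * g) → t * e * g ≡ E - e
          shift₂ p = trans (eq t e g) (cong (λ u → u - e) (sym p))
            where
            eq : ∀ t e g → t * e * g ≡ e * (1ℤ + t * g) - e
            eq = solve-∀
          ring₁ : ∀ t Γ g a β e E K → let b = 1ℤ + t; m = 1ℤ + b; S = β + a * (Γ - 1ℤ) + b * m in
            (K * (b * e) - b * E * S) * (Γ * β) + (K * t * e * (g * (b * m + a * (g - 1ℤ))) + - (K * t * e) * ((Γ - g) * (β - a * g)))
            ≡ (K * e - E * S) * (Γ * β + t * Γ * β) + K * (t * e * g * S - e * (t * Γ) * β)
          ring₁ = solve-∀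
          ring₂ : ∀ t Γ a β e E → let b = 1ℤ + t; m = 1ℤ + b; S = β + a * (Γ - 1ℤ) + b * m; K = E * β + a * (Γ - 1ℤ) + b * m in
            (K * e - E * S) * (Γ * β + (E - 1ℤ) * β) + K * ((E - e) * S - e * (E - 1ℤ) * β)
            ≡ (K * e - E * S) * ((Γ - 1ℤ) * (β - a) - b * m)
          ring₂ = solve-∀
          ring₃ : ∀ t H a β e E K S → let b = 1ℤ + t; m = 1ℤ + b in
            (K * e - E * S) * (b * H * (β - a) - b * m) ≡ (H * (β - a) - m) * (K * (b * e) - b * E * S)
          ring₃ = solve-∀

      -- Testing the idempotent at `w 0` f - `w 1` F δ_x, with F the sum of f, takes the Schur
      -- complement with respect to `x`. Two neighbours of `x` are at distance 0, 1 or 2, so on the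
      -- local graph the matrix is a combination of the identity, A and the all-ones matrix.
      local-psd : ∀ x f → (∀ y → adj x y ≡ false → f y ≡ 0ℤ) → 0ℤ ≤ quad A f + m * (sum λ y → f y * f y)
      local-psd x f supp = cancel-nonneg ((w 0) * (w 1 - w 2)) (pos-* w₀>0 w₁>w₂)
        (ℤₚ.≤-trans (nonneg-* (nonneg-* (nonneg-* (ℤₚ.<⇒≤ K>0) P≥0) (nonneg-* {e 2} (ℤ.+≤+ ℕ.z≤n) (square-nonneg (+ t)))) (square-nonneg F))
          (≤-by (subst (0ℤ ≤_) final (cancel-nonneg (w 0) w₀>0 (subst (0ℤ ≤_) shifted (Eigenspace.radial-psd m θ m>0 w eigen w₀>0 v))))))
        where
        open ≡-Reasoning
        F N₂ : ℤ
        F = sum f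
        N₂ = sum λ y → f y * f y
        M : Fin n → Fin n → ℤ
        M y z = w (dist y z)
        v : Fin n → ℤ
        v y = w 0 * f y + - (w 1 * F) * δ x y
        Γ≥1 : 0ℤ ≤ Γ - 1ℤ
        Γ≥1 = subst (λ u → 0ℤ ≤ u - 1ℤ) (sym (g-suc D′)) (subst (0ℤ ≤_) (eq (b * H)) (nonneg-* {b} {H} (ℤ.+≤+ ℕ.z≤n) (ℤ.+≤+ ℕ.z≤n)))
          where
          eq : ∀ u → u ≡ 1ℤ + u - 1ℤ
          eq = solve-∀
        Γ>0 : 0ℤ < Γ
        Γ>0 = ℤₚ.<-≤-trans (ℤ.+<+ (ℕ.s≤s ℕ.z≤n)) (≤-by {1ℤ} Γ≥1)
        t>0ℤ : 0ℤ < + t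
        t>0ℤ = ℤ.+<+ t>0
        e>0 : ∀ i → 0ℤ < e i
        e>0 i = ℤ.+<+ (ℕₚ.m^n>0 (suc t) (suc D ℕ.∸ i))
        bm≥0 : 0ℤ ≤ b * m
        bm≥0 = nonneg-* {b} {m} (ℤ.+≤+ ℕ.z≤n) (ℤ.+≤+ ℕ.z≤n)
        S≥0 : 0ℤ ≤ S
        S≥0 = nonneg-+ (nonneg-+ (ℤₚ.<⇒≤ β>0) (nonneg-* a≥0 Γ≥1)) bm≥0
        P≥0 : 0ℤ ≤ P
        P≥0 = nonneg-* (nonneg-* {b} {e 1} (ℤ.+≤+ ℕ.z≤n) (ℤ.+≤+ ℕ.z≤n)) S≥0
        K>0 : 0ℤ < K
        K>0 = ℤₚ.+-mono-<-≤ (ℤₚ.+-mono-<-≤ (pos-* (e>0 1) β>0) (nonneg-* a≥0 Γ≥1)) bm≥0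
        w₀>0 : 0ℤ < w 0
        w₀>0 = subst (0ℤ <_) (sym (trans (cong (λ u → K * u - P) (e-suc 0 ℕ.z≤n)) (trans (eq b (e 1) β (a * (Γ - 1ℤ)) (b * m)) (cong (λ u → b * e 1 * ((u - 1ℤ) * β)) e₁))))
                       (pos-* (pos-* {b} (ℤ.+<+ (ℕ.s≤s ℕ.z≤n)) (e>0 1)) (pos-* (subst (0ℤ <_) (eq′ (+ t * Γ)) (pos-* t>0ℤ Γ>0)) β>0))
          where
          eq : ∀ b E β s q → (E * β + s + q) * (b * E) - b * E * (β + s + q) ≡ b * E * ((E - 1ℤ) * β)
          eq = solve-∀
          eq′ : ∀ u → u ≡ 1ℤ + u - 1ℤ
          eq′ = solve-∀
        e₁≡ : e 1 ≡ b * e 2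
        e₁≡ = e-suc 1 (ℕ.s≤s ℕ.z≤n)
        e₀≡ : e 0 ≡ b * (b * e 2)
        e₀≡ = trans (e-suc 0 ℕ.z≤n) (cong (λ u → b * u) e₁≡)
        w₁>w₂ : 0ℤ < w 1 - w 2
        w₁>w₂ = subst (0ℤ <_) (sym (eq (+ t) K P (e 2) e₁≡)) (pos-* (pos-* K>0 t>0ℤ) (e>0 2))
          where
          ring : ∀ t K P e → K * ((1ℤ + t) * e) - P - (K * e - P) ≡ K * t * e
          ring = solve-∀
          eq : ∀ t K P e {e₁} → e₁ ≡ (1ℤ + t) * e → K * e₁ - P - (K * e - P) ≡ K * t * e
          eq t K P e refl = ring t K P e
        radial₁ : ∀ y → w (dist x y) * f y ≡ w 1 * f y
        radial₁ y with adj x y in xy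
        ... | true  = cong (λ i → w i * f y) (dist-adj xy)
        ... | false rewrite supp y xy = trans (ℤₚ.*-zeroʳ (w (dist x y))) (sym (ℤₚ.*-zeroʳ (w 1)))
        radial₂ : ∀ y → w (dist y x) * f y ≡ w 1 * f y
        radial₂ y with adj x y in xy
        ... | true  = cong (λ i → w i * f y) (dist-adj (adj-comm xy))
        ... | false rewrite supp y xy = trans (ℤₚ.*-zeroʳ (w (dist y x))) (sym (ℤₚ.*-zeroʳ (w 1)))
        shifted : quad M v ≡ w 0 * (w 0 * quad M f - w 1 * w 1 * (F * F))
        shifted = begin
          quad M v
            ≡⟨ quad-shift M f x (w 0) (- (w 1 * F)) ⟩
          w 0 * w 0 * quad M f + w 0 * - (w 1 * F) * ((sum λ y → M x y * f y) + (sum λ y → M y x * f y)) + - (w 1 * F) * - (w 1 * F) * M x x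
            ≡⟨ cong₂ (λ p q → w 0 * w 0 * quad M f + w 0 * - (w 1 * F) * p + - (w 1 * F) * - (w 1 * F) * q)
                 (cong₂ _+_ (trans (sum-cong-≗ radial₁) (sum-* (w 1) f)) (trans (sum-cong-≗ radial₂) (sum-* (w 1) f))) (cong w (dist-refl x)) ⟩
          w 0 * w 0 * quad M f + w 0 * - (w 1 * F) * (w 1 * F + w 1 * F) + - (w 1 * F) * - (w 1 * F) * w 0
            ≡⟨ eq (w 0) (w 1) F (quad M f) ⟩
          w 0 * (w 0 * quad M f - w 1 * w 1 * (F * F)) ∎
          where
          eq : ∀ x y F q → x * x * q + x * - (y * F) * (y * F + y * F) + - (y * F) * - (y * F) * x ≡ x * (x * q - y * y * (F * F))
          eq = solve-∀
        entry : ∀ y z → M y z * (f y * f z) ≡ w 2 * (f y * f z) + ((w 1 - w 2) * (A y z * (f y * f z)) + (w 0 - w 2) * (δ y z * (f y * f z)))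
        entry y z with adj x y in xy
        ... | false rewrite supp y xy = eq (M y z) (w 0) (w 1) (w 2) (A y z) (δ y z) (f z)
          where
          eq : ∀ q u v w a d k → q * (0ℤ * k) ≡ w * (0ℤ * k) + ((v - w) * (a * (0ℤ * k)) + (u - w) * (d * (0ℤ * k)))
          eq = solve-∀
        ... | true with adj x z in xz
        ...   | false rewrite supp z xz = eq (M y z) (w 0) (w 1) (w 2) (A y z) (δ y z) (f y)
          where
          eq : ∀ q u v w a d k → q * (k * 0ℤ) ≡ w * (k * 0ℤ) + ((v - w) * (a * (k * 0ℤ)) + (u - w) * (d * (k * 0ℤ)))
          eq = solve-∀
        ...   | true with y Fin.≟ z
        ...     | yes refl rewrite dist-refl y | adj-irr y = eq (w 0) (w 1) (w 2) (f y * f y)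
          where
          eq : ∀ u v w k → u * k ≡ w * k + ((v - w) * (0ℤ * k) + (u - w) * (1ℤ * k))
          eq = solve-∀
        ...     | no ne with adj y z in yz
        ...       | true rewrite dist-adj yz = eq (w 0) (w 1) (w 2) (f y * f z)
          where
          eq : ∀ u v w k → v * k ≡ w * k + ((v - w) * (1ℤ * k) + (u - w) * (0ℤ * k))
          eq = solve-∀
        ...       | false = trans (cong (λ i → w i * (f y * f z)) (dist-unique {y} {z} {2} (atDist₂ {y} {z} {x} ne yz (adj-comm xy) xz))) (eq (w 0) (w 1) (w 2) (f y * f z))
          where
          eq : ∀ u v w k → w * k ≡ w * k + ((v - w) * (0ℤ * k) + (u - w) * (0ℤ * k))
          eq = solve-∀
        quad-M : quad M f ≡ w 2 * (F * F) + ((w 1 - w 2) * quad A f + (w 0 - w 2) * N₂)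
        quad-M = begin
          quad M f
            ≡⟨ sum-cong-≗ (λ y → trans (sum-cong-≗ (entry y)) (trans (sum-+ (λ z → w 2 * (f y * f z)) (λ z → (w 1 - w 2) * (A y z * (f y * f z)) + (w 0 - w 2) * (δ y z * (f y * f z))))
                 (cong₂ _+_ (sum-* (w 2) (λ z → f y * f z)) (trans (sum-linear (w 1 - w 2) (w 0 - w 2) (λ z → A y z * (f y * f z)) (λ z → δ y z * (f y * f z)))
                   (cong (λ u → (w 1 - w 2) * (sum λ z → A y z * (f y * f z)) + (w 0 - w 2) * u) (sum-δ y (λ z → f y * f z))))))) ⟩
          (sum λ y → w 2 * (sum λ z → f y * f z) + ((w 1 - w 2) * (sum λ z → A y z * (f y * f z)) + (w 0 - w 2) * (f y * f y)))
            ≡⟨ trans (sum-+ (λ y → w 2 * (sum λ z → f y * f z)) (λ y → (w 1 - w 2) * (sum λ z → A y z * (f y * f z)) + (w 0 - w 2) * (f y * f y)))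
                 (cong₂ _+_ (trans (sum-* (w 2) (λ y → sum λ z → f y * f z)) (cong (λ u → w 2 * u) (sum-product f f)))
                            (sum-linear (w 1 - w 2) (w 0 - w 2) (λ y → sum λ z → A y z * (f y * f z)) (λ y → f y * f y))) ⟩
          w 2 * (F * F) + ((w 1 - w 2) * quad A f + (w 0 - w 2) * N₂) ∎
        -- Since `w` is affine in b ^ -i, (w 0 - w 2) / (w 1 - w 2) = b + 1 = m, and the coefficient
        -- w 0 w 2 - (w 1)² of F² is - K P e₂ t², where e₂ is `e 2`. Its sign allows the F² term to
        -- be dropped.
        final : w 0 * quad M f - w 1 * w 1 * (F * F) ≡ w 0 * (w 1 - w 2) * (quad A f + m * N₂) - K * P * (e 2 * (+ t * + t)) * (F * F)
        final = trans (cong (λ u → w 0 * u - w 1 * w 1 * (F * F)) quad-M) (eq (+ t) K P (e 2) (quad A f) N₂ (F * F) e₁≡ e₀≡)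
          where
          ring : ∀ t K P e q s h → let b = 1ℤ + t; w₀ = K * (b * (b * e)) - P; w₁ = K * (b * e) - P; w₂ = K * e - P in
            w₀ * (w₂ * h + ((w₁ - w₂) * q + (w₀ - w₂) * s)) - w₁ * w₁ * h ≡ w₀ * (w₁ - w₂) * (q + (1ℤ + b) * s) - K * P * (e * (t * t)) * h
          ring = solve-∀
          eq : ∀ t K P e q s h {e₁ e₀} → let b = 1ℤ + t in e₁ ≡ b * e → e₀ ≡ b * (b * e) → let w₀ = K * e₀ - P; w₁ = K * e₁ - P; w₂ = K * e - P in
            w₀ * (w₂ * h + ((w₁ - w₂) * q + (w₀ - w₂) * s)) - w₁ * w₁ * h ≡ w₀ * (w₁ - w₂) * (q + (1ℤ + b) * s) - K * P * (e * (t * t)) * h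
          eq t K P e q s h refl refl = ring t K P e q s h

  -- Cliques and independent sets in the local graph

  module LocalGraph {n : ℕ} (adj : Fin n → Fin n → Bool) (adj-sym : ∀ p q → adj p q ≡ adj q p) (adj-irr : ∀ p → adj p p ≡ false)
    (X : Fin n → Bool) (m ν μ : ℤ) (k : ℕ) (m>1 : 1ℤ < m)
    (psd : ∀ f → (∀ y → X y ≡ false → f y ≡ 0ℤ) → 0ℤ ≤ quad (λ p q → ⟦ adj p q ⟧) f + m * (sum λ y → f y * f y))
    (order : size X ≡ + k)
    (valency : ∀ p → X p ≡ true → size (λ q → X q ∧ adj p q) ≡ ν)
    (common : ∀ p q → X p ≡ true → X q ≡ true → p ≢ q → adj p q ≡ false → size (λ r → X r ∧ (adj p r ∧ adj q r)) ≤ μ)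
    where

    A M : Fin n → Fin n → ℤ
    A p q = ⟦ adj p q ⟧
    M p q = A p q + m * δ p q

    m>0 : 0ℤ < m
    m>0 = ℤₚ.<-trans (ℤ.+<+ (ℕ.s≤s ℕ.z≤n)) m>1

    _⊆_ : (Fin n → Bool) → (Fin n → Bool) → Set
    C ⊆ K = ∀ p → C p ≡ true → K p ≡ true

    Clique Independent : (Fin n → Bool) → Set
    Clique K = ∀ p q → K p ≡ true → K q ≡ true → p ≢ q → adj p q ≡ true
    Independent Z = ∀ p q → Z p ≡ true → Z q ≡ true → p ≢ q → adj p q ≡ false

    clique-insert : ∀ {K y} → Clique K → (∀ p → K p ≡ true → adj y p ≡ true) → Clique (insert y K)
    clique-insert {K} {y} cl h p q hp hq ne with insert-elim {y = y} {p} {K} hp | insert-elim {y = y} {q} {K} hq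
    ... | inj₁ refl | inj₁ refl = ⊥-elim (ne refl)
    ... | inj₁ refl | inj₂ kq   = h q kq
    ... | inj₂ kp   | inj₁ refl = trans (adj-sym p q) (h p kp)
    ... | inj₂ kp   | inj₂ kq   = cl p q kp kq ne

    independent-insert : ∀ {Z y} → Independent Z → (∀ p → Z p ≡ true → adj y p ≡ false) → Independent (insert y Z)
    independent-insert {Z} {y} ind h p q hp hq ne with insert-elim {y = y} {p} {Z} hp | insert-elim {y = y} {q} {Z} hq
    ... | inj₁ refl | inj₁ refl = ⊥-elim (ne refl)
    ... | inj₁ refl | inj₂ zq   = h q zq
    ... | inj₂ zp   | inj₁ refl = trans (adj-sym p q) (h p zp)
    ... | inj₂ zp   | inj₂ zq   = ind p q zp zq ne

    insert-⊆ : ∀ {C K y} → C ⊆ K → K y ≡ true → insert y C ⊆ K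
    insert-⊆ {C} {K} {y} s h p hp with insert-elim {y = y} {p} {C} hp
    ... | inj₁ refl = h
    ... | inj₂ cp   = s p cp

    quad-M : ∀ f → quad M f ≡ quad A f + m * (sum λ y → f y * f y)
    quad-M f = trans (sum-cong-≗ (λ p → trans (sum-cong-≗ (λ q → distr (A p q) m (δ p q) (f p * f q))) (trans (sum-+ (λ q → A p q * (f p * f q)) (λ q → m * (δ p q * (f p * f q))))
        (cong (λ u → (sum λ q → A p q * (f p * f q)) + u) (trans (sum-* m (λ q → δ p q * (f p * f q))) (cong (λ u → m * u) (sum-δ p (λ q → f p * f q))))))))
      (trans (sum-+ (λ p → sum λ q → A p q * (f p * f q)) (λ p → m * (f p * f p))) (cong (λ u → quad A f + u) (sum-* m (λ p → f p * f p))))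
      where
      distr : ∀ a m d x → (a + m * d) * x ≡ a * x + m * (d * x)
      distr = solve-∀

    supported : (Fin n → ℤ) → Set
    supported f = ∀ y → X y ≡ false → f y ≡ 0ℤ

    -- The form A + mI at c f + d δ_y, for f vanishing at y.
    psd-shift : ∀ f y c d → supported f → X y ≡ true → f y ≡ 0ℤ →
      0ℤ ≤ c * c * quad M f + (c * d * (+ 2) * (sum λ p → A y p * f p) + d * d * m)
    psd-shift f y c d supp Xy fy = subst (0ℤ ≤_) expand (subst (0ℤ ≤_) (sym (quad-M v)) (psd v v-supp))
      where
      v : Fin n → ℤ
      v p = c * f p + d * δ y p
      v-supp : supported v
      v-supp p Xp with y Fin.≟ p
      ... | yes refl = ⊥-elim (true≢false Xy Xp)
      ... | no _ rewrite supp p Xp = eq c d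
        where
        eq : ∀ c d → c * 0ℤ + d * 0ℤ ≡ 0ℤ
        eq = solve-∀
      row : (sum λ p → M y p * f p) ≡ sum λ p → A y p * f p
      row = trans (sum-cong-≗ (λ p → distr (A y p) m (δ y p) (f p))) (trans (sum-+ (λ p → A y p * f p) (λ p → m * (δ y p * f p)))
              (trans (cong (λ u → (sum λ p → A y p * f p) + u) (trans (sum-* m (λ p → δ y p * f p)) (cong (λ u → m * u) (trans (sum-δ y f) fy)))) (eq (sum λ p → A y p * f p) m)))
        where
        distr : ∀ a m d x → (a + m * d) * x ≡ a * x + m * (d * x)
        distr = solve-∀
        eq : ∀ s m → s + m * 0ℤ ≡ s
        eq = solve-∀
      M-sym : ∀ p q → M p q ≡ M q p
      M-sym p q = cong₂ (λ u v → ⟦ u ⟧ + m * v) (adj-sym p q) (δ-sym p q)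
      M-diag : M y y ≡ m
      M-diag rewrite adj-irr y | δ-refl y = eq m
        where
        eq : ∀ m → 0ℤ + m * 1ℤ ≡ m
        eq = solve-∀
      expand : quad M v ≡ c * c * quad M f + (c * d * (+ 2) * (sum λ p → A y p * f p) + d * d * m)
      expand = trans (quad-shift M f y c d)
        (trans (cong₂ (λ u v → c * c * quad M f + c * d * u + d * d * v) (cong₂ _+_ row (trans (sum-cong-≗ (λ p → cong (_* f p) (M-sym p y))) row)) M-diag)
               (eq c d (quad M f) (sum λ p → A y p * f p) m))
        where
        eq : ∀ c d q s m → c * c * q + c * d * (s + s) + d * d * m ≡ c * c * q + (c * d * (+ 2) * s + d * d * m)
        eq = solve-∀

    indicator-supported : ∀ {C} → C ⊆ X → ∀ (g : Fin n → ℤ) → supported (λ p → ⟦ C p ⟧ * g p)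
    indicator-supported {C} s g y h with C y in cy
    ... | true  = ⊥-elim (true≢false (s y cy) h)
    ... | false = ℤₚ.*-zeroˡ (g y)

    -- On a clique A + I is the all-ones matrix, which leaves m - 1 on the diagonal.
    quad-clique : ∀ {C} → Clique C → ∀ (g : Fin n → ℤ) → let f = λ p → ⟦ C p ⟧ * g p in
      quad M f ≡ sum f * sum f + (m - 1ℤ) * (sum λ p → f p * f p)
    quad-clique {C} cl g = trans (quad-M f) (trans (cong (λ u → u + m * Σf²) quadA) (eq (sum f) m Σf²))
      where
      f : Fin n → ℤ
      f p = ⟦ C p ⟧ * g p
      Σf² = sum λ p → f p * f p
      eq : ∀ s m t → s * s - t + m * t ≡ s * s + (m - 1ℤ) * t
      eq = solve-∀
      entry : ∀ p q → A p q * (f p * f q) ≡ f p * f q - δ p q * (f p * f q)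
      entry p q with p Fin.≟ q
      ... | yes refl rewrite adj-irr p = ring (f p * f p)
        where
        ring : ∀ x → 0ℤ * x ≡ x - 1ℤ * x
        ring = solve-∀
      ... | no ne with C p in cp | C q in cq
      ...   | true  | true  rewrite cl p q cp cq ne = ring (1ℤ * g p * (1ℤ * g q))
        where
        ring : ∀ x → 1ℤ * x ≡ x - 0ℤ * x
        ring = solve-∀
      ...   | true  | false = ring (A p q) (g p) (g q)
        where
        ring : ∀ a x y → a * (1ℤ * x * (0ℤ * y)) ≡ 1ℤ * x * (0ℤ * y) - 0ℤ * (1ℤ * x * (0ℤ * y))
        ring = solve-∀
      ...   | false | cq′   = ring (A p q) (g p) (⟦ cq′ ⟧ * g q)
        where
        ring : ∀ a x y → a * (0ℤ * x * y) ≡ 0ℤ * x * y - 0ℤ * (0ℤ * x * y)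
        ring = solve-∀
      quadA : quad A f ≡ sum f * sum f - Σf²
      quadA = trans (sum-cong-≗ (λ p → trans (sum-cong-≗ (entry p)) (trans (sum-- (λ q → f p * f q) (λ q → δ p q * (f p * f q))) (cong (λ u → (sum λ q → f p * f q) - u) (sum-δ p (λ q → f p * f q))))))
        (trans (sum-- (λ p → sum λ q → f p * f q) (λ p → f p * f p)) (cong (λ u → u - Σf²) (sum-product f f)))

    deg : (Fin n → Bool) → Fin n → ℤ
    deg C y = size (λ p → C p ∧ adj y p)

    -- A large clique: test vector constant on the neighbours and on the non-neighbours of y, of sum zero on C.
    deg-clique : ∀ {C y} → C ⊆ X → Clique C → X y ≡ true → C y ≡ false →
      let c = size C; a = deg C y in 0ℤ < a * (c - a) → a * (c - a) ≤ (m - 1ℤ) * m * c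
    deg-clique {C} {y} s cl Xy Cy Q>0 = ≤-by (cancel-nonneg (m * Q) (pos-* m>0 Q>0) (subst (0ℤ ≤_) total
        (psd-shift f y m (- Q) (indicator-supported {C} s g) Xy f-y)))
      where
      c a Q : ℤ
      c = size C
      a = deg C y
      Q = a * (c - a)
      g f I : Fin n → ℤ
      g p = c * A y p - a
      f p = ⟦ C p ⟧ * g p
      I p = ⟦ C p ∧ adj y p ⟧
      f-y : f y ≡ 0ℤ
      f-y rewrite Cy = ℤₚ.*-zeroˡ (g y)
      sum-f : sum f ≡ 0ℤ
      sum-f = trans (sum-cong-≗ (λ p → trans (distr ⟦ C p ⟧ c (A y p) a) (cong (λ u → c * u + - a * ⟦ C p ⟧) (sym (⟦⟧-∧ (C p) (adj y p))))))
                    (trans (sum-linear c (- a) I (λ p → ⟦ C p ⟧)) (eq c a))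
        where
        distr : ∀ x c y a → x * (c * y - a) ≡ c * (x * y) + - a * x
        distr = solve-∀
        eq : ∀ c a → c * a + - a * c ≡ 0ℤ
        eq = solve-∀
      sum-f² : (sum λ p → f p * f p) ≡ c * Q
      sum-f² = trans (sum-cong-≗ term) (trans (sum-linear (c * (c - + 2 * a)) (a * a) I (λ p → ⟦ C p ⟧)) (eq c a))
        where
        term : ∀ p → f p * f p ≡ c * (c - + 2 * a) * I p + a * a * ⟦ C p ⟧
        term p with C p | adj y p
        ... | true  | true  = ring c a
          where
          ring : ∀ c a → 1ℤ * (c * 1ℤ - a) * (1ℤ * (c * 1ℤ - a)) ≡ c * (c - + 2 * a) * 1ℤ + a * a * 1ℤ
          ring = solve-∀
        ... | true  | false = ring c a
          where
          ring : ∀ c a → 1ℤ * (c * 0ℤ - a) * (1ℤ * (c * 0ℤ - a)) ≡ c * (c - + 2 * a) * 0ℤ + a * a * 1ℤ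
          ring = solve-∀
        ... | false | e = ring c a ⟦ e ⟧
          where
          ring : ∀ c a e → 0ℤ * (c * e - a) * (0ℤ * (c * e - a)) ≡ c * (c - + 2 * a) * 0ℤ + a * a * 0ℤ
          ring = solve-∀
        eq : ∀ c a → c * (c - + 2 * a) * a + a * a * c ≡ c * (a * (c - a))
        eq = solve-∀
      row : (sum λ p → A y p * f p) ≡ Q
      row = trans (sum-cong-≗ term) (trans (sum-* (c - a) I) (ℤₚ.*-comm (c - a) a))
        where
        term : ∀ p → A y p * f p ≡ (c - a) * I p
        term p with C p | adj y p
        ... | true  | true  = ring c a
          where
          ring : ∀ c a → 1ℤ * (1ℤ * (c * 1ℤ - a)) ≡ (c - a) * 1ℤ
          ring = solve-∀
        ... | true  | false = ring c a
          where
          ring : ∀ c a → 0ℤ * (1ℤ * (c * 0ℤ - a)) ≡ (c - a) * 0ℤ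
          ring = solve-∀
        ... | false | e = ring c a ⟦ e ⟧
          where
          ring : ∀ c a e → e * (0ℤ * (c * e - a)) ≡ (c - a) * 0ℤ
          ring = solve-∀
      total : m * m * quad M f + (m * - Q * (+ 2) * (sum λ p → A y p * f p) + - Q * - Q * m) ≡ m * Q * ((m - 1ℤ) * m * c - Q)
      total = trans (cong₂ (λ u v → m * m * u + (m * - Q * (+ 2) * v + - Q * - Q * m))
                (trans (quad-clique {C} cl g) (cong₂ (λ u v → u * u + (m - 1ℤ) * v) sum-f sum-f²)) row) (eq m c Q)
        where
        eq : ∀ m c Q → m * m * (0ℤ * 0ℤ + (m - 1ℤ) * (c * Q)) + (m * - Q * (+ 2) * Q + - Q * - Q * m) ≡ m * Q * ((m - 1ℤ) * m * c - Q)
        eq = solve-∀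

    -- If `y` misses a single point `p` of the clique, then all its neighbours in the clique are
    -- common neighbours of the nonadjacent vertices `y` and `p`.
    deg≤μ : ∀ {C y p} → C ⊆ X → Clique C → X y ≡ true → C y ≡ false → C p ≡ true → adj y p ≡ false → deg C y ≤ μ
    deg≤μ {C} {y} {p} s cl Xy Cy Cp nadj = ℤₚ.≤-trans (size-mono incl) (common y p Xy (s p Cp) (λ { refl → true≢false Cp Cy }) nadj)
      where
      incl : ∀ q → C q ∧ adj y q ≡ true → X q ∧ (adj y q ∧ adj p q) ≡ true
      incl q h with ∧-true {C q} h
      ... | Cq , e = ∧-intro (s q Cq) (∧-intro e (cl p q Cp Cq (λ { refl → true≢false e nadj })))

    deg-self : ∀ {C p} → Clique C → C p ≡ true → deg C p ≡ size C - 1ℤ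
    deg-self {C} {p} cl Cp = trans (sum-cong-≗ term) (trans (sum-- (λ q → ⟦ C q ⟧) (λ q → δ p q * 1ℤ)) (cong (λ u → size C - u) (sum-δ p (λ _ → 1ℤ))))
      where
      term : ∀ q → ⟦ C q ∧ adj p q ⟧ ≡ ⟦ C q ⟧ - δ p q * 1ℤ
      term q with p Fin.≟ q
      ... | yes refl rewrite Cp | adj-irr p = refl
      ... | no ne with C q in Cq
      ...   | true rewrite cl p q Cp Cq ne = refl
      ...   | false = refl

    out-edges : ∀ {C} → C ⊆ X → Clique C → (sum λ y → (⟦ X y ⟧ - ⟦ C y ⟧) * deg C y) ≡ size C * (ν + 1ℤ - size C)
    out-edges {C} s cl = begin
      (sum λ y → (⟦ X y ⟧ - ⟦ C y ⟧) * deg C y)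
        ≡⟨ sum-cong-≗ (λ y → sym (sum-* (⟦ X y ⟧ - ⟦ C y ⟧) (λ p → ⟦ C p ∧ adj y p ⟧))) ⟩
      (sum λ y → sum λ p → (⟦ X y ⟧ - ⟦ C y ⟧) * ⟦ C p ∧ adj y p ⟧)
        ≡⟨ ∑-comm (λ y p → (⟦ X y ⟧ - ⟦ C y ⟧) * ⟦ C p ∧ adj y p ⟧) ⟩
      (sum λ p → sum λ y → (⟦ X y ⟧ - ⟦ C y ⟧) * ⟦ C p ∧ adj y p ⟧)
        ≡⟨ sum-cong-≗ inner ⟩
      (sum λ p → (ν + 1ℤ - size C) * ⟦ C p ⟧)
        ≡⟨ trans (sum-* (ν + 1ℤ - size C) (λ p → ⟦ C p ⟧)) (ℤₚ.*-comm (ν + 1ℤ - size C) (size C)) ⟩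
      size C * (ν + 1ℤ - size C) ∎
      where
      open ≡-Reasoning
      inner : ∀ p → (sum λ y → (⟦ X y ⟧ - ⟦ C y ⟧) * ⟦ C p ∧ adj y p ⟧) ≡ (ν + 1ℤ - size C) * ⟦ C p ⟧
      inner p with C p in Cp
      ... | false = trans (sum-≡0 (λ y → ℤₚ.*-zeroʳ (⟦ X y ⟧ - ⟦ C y ⟧))) (sym (ℤₚ.*-zeroʳ (ν + 1ℤ - size C)))
      ... | true  = trans (sum-cong-≗ term) (trans (sum-- (λ y → ⟦ X y ∧ adj p y ⟧) (λ y → ⟦ C y ∧ adj p y ⟧))
                      (trans (cong₂ _-_ (valency p (s p Cp)) (deg-self {C} cl Cp)) (eq ν (size C))))
        where
        distr : ∀ x c a → (x - c) * a ≡ x * a - c * a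
        distr = solve-∀
        eq : ∀ ν c → ν - (c - 1ℤ) ≡ (ν + 1ℤ - c) * 1ℤ
        eq = solve-∀
        term : ∀ y → (⟦ X y ⟧ - ⟦ C y ⟧) * A y p ≡ ⟦ X y ∧ adj p y ⟧ - ⟦ C y ∧ adj p y ⟧
        term y rewrite adj-sym y p = trans (distr ⟦ X y ⟧ ⟦ C y ⟧ (A p y)) (sym (cong₂ _-_ (⟦⟧-∧ (X y) (adj p y)) (⟦⟧-∧ (C y) (adj p y))))

    h : ℤ
    h = (m - 1ℤ) * m

    h>0 : 0ℤ < h
    h>0 = pos-* (<-diff m>1) m>0

    -- For a clique C with c elements, m times the number of edges leaving C exceeds m h (k - c) by
    -- (β - m c) (c - h Γ) + (Γ - 1) (a - m h) c.
    module LargeCliques (Γ a β : ℤ) (k-eq : m * + k ≡ Γ * β) (ν-eq : m * (ν + 1ℤ) ≡ β + a * (Γ - 1ℤ))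
      (clique≤ : ∀ K → K ⊆ X → Clique K → m * size K ≤ β)
      (Large : ℤ → Set) (large-suc : ∀ {c} → Large c → Large (1ℤ + c))
      (large-μ : ∀ {c} → Large c → μ + h + h * h + 1ℤ ≤ c)
      (large-gap : ∀ {c} → Large c → m * c ≤ β →
        0ℤ < (β - m * c) * (c - h * Γ) + (Γ - 1ℤ) * (a - m * h) * c) where

      -- The inequality d (c - d) ≤ h c puts d near 0 or near c, and `deg≤μ` rules out the upper
      -- range. Precisely, h + 1 ≤ d ≤ μ ≤ c - h - h² - 1 would give d (c - d) - h c ≥ 1; `eq`
      -- displays this difference as 1 plus products of nonnegative factors.
      deg-small : ∀ {C y p} → C ⊆ X → Clique C → X y ≡ true → C y ≡ false → C p ≡ true → adj y p ≡ false →
        μ + h + h * h + 1ℤ ≤ size C → deg C y ≤ h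
      deg-small {C} {y} {p} s cl Xy Cy Cp nadj large with deg C y ℤ.≤? h
      ... | yes le = le
      ... | no nle = ⊥-elim (ℤₚ.<⇒≱ (ℤ.+<+ (ℕ.s≤s ℕ.z≤n)) (ℤₚ.≤-trans positive (ℤₚ.≤-trans (ℤₚ.≤-reflexive (sym (eq c d h))) (ℤₚ.i≤j⇒i-j≤0 (deg-clique {C} s cl Xy Cy Q>0)))))
        where
        c d : ℤ
        c = size C
        d = deg C y
        u≥0 : 0ℤ ≤ d - h - 1ℤ
        u≥0 = subst (0ℤ ≤_) (ring d h) (≤-diff (ℤₚ.i<j⇒suc[i]≤j (ℤₚ.≰⇒> nle)))
          where
          ring : ∀ d h → d - (1ℤ + h) ≡ d - h - 1ℤ
          ring = solve-∀
        r≥0 : 0ℤ ≤ c - d - h - h * h - 1ℤ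
        r≥0 = subst (0ℤ ≤_) (ring c d h μ) (nonneg-+ (≤-diff large) (≤-diff (deg≤μ {C} s cl Xy Cy Cp nadj)))
          where
          ring : ∀ c d h μ → c - (μ + h + h * h + 1ℤ) + (μ - d) ≡ c - d - h - h * h - 1ℤ
          ring = solve-∀
        h²≥0 = nonneg-* (ℤₚ.<⇒≤ h>0) (ℤₚ.<⇒≤ h>0)
        d>0 : 0ℤ < d
        d>0 = ℤₚ.<-trans h>0 (ℤₚ.≰⇒> nle)
        Q>0 : 0ℤ < d * (c - d)
        Q>0 = pos-* d>0 (subst (0ℤ <_) (ring c d h) (ℤₚ.+-mono-≤-< r≥0 (ℤₚ.+-mono-<-≤ h>0 (nonneg-+ h²≥0 (ℤ.+≤+ (ℕ.z≤n {1}))))))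
          where
          ring : ∀ c d h → c - d - h - h * h - 1ℤ + (h + (h * h + 1ℤ)) ≡ c - d
          ring = solve-∀
        eq : ∀ c d h → d * (c - d) - h * c ≡ 1ℤ + ((d - h - 1ℤ) * (h * h) + (d - h - 1ℤ) + (d - h) * (c - d - h - h * h - 1ℤ))
        eq = solve-∀
        positive : 1ℤ ≤ 1ℤ + ((d - h - 1ℤ) * (h * h) + (d - h - 1ℤ) + (d - h) * (c - d - h - h * h - 1ℤ))
        positive = ℤₚ.+-monoʳ-≤ 1ℤ (nonneg-+ (nonneg-+ (nonneg-* u≥0 h²≥0) u≥0) (nonneg-* (ℤₚ.<⇒≤ (<-diff (ℤₚ.≰⇒> nle))) r≥0))

      not-saturated : ∀ {C} → C ⊆ X → Clique C → Large (size C) → ¬ (∀ y → X y ≡ true → C y ≡ false → deg C y ≤ h)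
      not-saturated {C} s cl large small = ℤₚ.<⇒≱ gap (subst (_≤ 0ℤ) (trans (expand m c (ν + 1ℤ) h (+ k)) (trans (cong₂ (λ u v → c * (u - m * c) - h * (v - m * c)) ν-eq k-eq) (eq m c a β Γ h)))
                        (subst (m * (c * (ν + 1ℤ - c) - h * (+ k - c)) ≤_) (ℤₚ.*-zeroʳ m) (*-mono m (ℤₚ.<⇒≤ m>0) (ℤₚ.i≤j⇒i-j≤0 count))))
        where
        c : ℤ
        c = size C
        bound : ∀ y → (⟦ X y ⟧ - ⟦ C y ⟧) * deg C y ≤ h * (⟦ X y ⟧ - ⟦ C y ⟧)
        bound y with C y in Cy
        ... | true rewrite s y Cy = ℤₚ.≤-reflexive (trans (ℤₚ.*-zeroˡ (deg C y)) (sym (ℤₚ.*-zeroʳ h)))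
        ... | false with X y in Xy
        ...   | true  = subst₂ _≤_ (sym (ℤₚ.*-identityˡ (deg C y))) (sym (ℤₚ.*-identityʳ h)) (small y Xy Cy)
        ...   | false = ℤₚ.≤-reflexive (trans (ℤₚ.*-zeroˡ (deg C y)) (sym (ℤₚ.*-zeroʳ h)))
        count : c * (ν + 1ℤ - c) ≤ h * (+ k - c)
        count = subst₂ _≤_ (out-edges {C} s cl) (trans (sum-* h (λ y → ⟦ X y ⟧ - ⟦ C y ⟧)) (cong (λ u → h * u) (trans (sum-- (λ y → ⟦ X y ⟧) (λ y → ⟦ C y ⟧)) (cong (_- c) order)))) (sum-≤ bound)
        expand : ∀ m c n h k → m * (c * (n - c) - h * (k - c)) ≡ c * (m * n - m * c) - h * (m * k - m * c)
        expand = solve-∀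
        eq : ∀ m c a β Γ h → c * (β + a * (Γ - 1ℤ) - m * c) - h * (Γ * β - m * c) ≡ (β - m * c) * (c - h * Γ) + (Γ - 1ℤ) * (a - m * h) * c
        eq = solve-∀
        gap : 0ℤ < (β - m * c) * (c - h * Γ) + (Γ - 1ℤ) * (a - m * h) * c
        gap = large-gap large (clique≤ C s cl)

      -- An outside vertex with more than `h` neighbours in the clique is adjacent to all of it by
      -- `deg-small`, so the clique can be enlarged. Otherwise `not-saturated` gives the
      -- contradiction. Largeness persists, and the counter `j` exceeds k - size C, so growth must
      -- stop.
      no-large-clique : ∀ C → C ⊆ X → Clique C → ¬ Large (size C)
      no-large-clique C s cl large = go (suc k) C s cl large (ℤₚ.<-≤-trans (ℤ.+<+ (ℕₚ.n<1+n k)) (subst (_≤ size C + + suc k) (ℤₚ.+-identityˡ (+ suc k)) (ℤₚ.+-monoˡ-≤ (+ suc k) (size-nonneg C))))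
        where
        go : ∀ j C → C ⊆ X → Clique C → Large (size C) → + k < size C + + j → ⊥
        go zero C s cl large lt = ℤₚ.<⇒≱ (subst₂ _<_ (sym order) (ℤₚ.+-identityʳ (size C)) lt) (size-mono s)
        go (suc j) C s cl large lt = not-saturated {C} s cl large small
          where
          small : ∀ y → X y ≡ true → C y ≡ false → deg C y ≤ h
          small y Xy Cy with deg C y ℤ.≤? h
          ... | yes le = le
          ... | no nle = ⊥-elim (go j (insert y C) (insert-⊆ {C} {X} {y} s Xy) (clique-insert {C} {y} cl all) (subst Large (sym grown) (large-suc large))
                   (subst (+ k <_) (trans (shuffle (size C) (+ j)) (cong (_+ + j) (sym grown))) lt))
            where
            all : ∀ p → C p ≡ true → adj y p ≡ true
            all p Cp with adj y p in e
            ... | true  = refl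
            ... | false = ⊥-elim (nle (deg-small {C} s cl Xy Cy Cp e (large-μ large)))
            grown : size (insert y C) ≡ 1ℤ + size C
            grown = size-insert {y = y} {C} Cy
            shuffle : ∀ c j → c + (1ℤ + j) ≡ 1ℤ + c + j
            shuffle = solve-∀

    -- Independent sets in the neighbourhood of a vertex of the local graph

    near : Fin n → Fin n → Bool
    near p z = does (p Fin.≟ z) ∨ adj p z

    near-refl : ∀ p → near p p ≡ true
    near-refl p with p Fin.≟ p
    ... | yes _ = refl
    ... | no ne = ⊥-elim (ne refl)

    near-false : ∀ {p z} → near p z ≡ false → p ≢ z × adj p z ≡ false
    near-false {p} {z} h with p Fin.≟ z
    ... | no ne = ne , h

    near-true : ∀ {p z} → near p z ≡ true → p ≡ z ⊎ adj p z ≡ true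
    near-true {p} {z} h with p Fin.≟ z
    ... | yes e = inj₁ e
    ... | no _  = inj₂ h

    module Neighbourhood (y : Fin n) (Xy : X y ≡ true) (ω : ℤ) (ω≥0 : 0ℤ ≤ ω) (μ≥0 : 0ℤ ≤ μ)
      (clique≤ω : ∀ K → K ⊆ X → Clique K → size K ≤ ω) where

      Λ : Fin n → Bool
      Λ p = X p ∧ adj y p

      Λ⊆X : Λ ⊆ X
      Λ⊆X p h = proj₁ (∧-true {X p} h)

      -- The form A + mI at u δ_y - m 1_U.
      star-bound : ∀ U d → U ⊆ Λ → 0ℤ ≤ d → (∀ p → U p ≡ true → deg U p ≤ d) → size U ≤ m * (d + m)
      star-bound U d s d≥0 degs with size U ℤ.≤? 0ℤ
      ... | yes u≤0 = ℤₚ.≤-trans u≤0 (nonneg-* (ℤₚ.<⇒≤ m>0) (nonneg-+ d≥0 (ℤₚ.<⇒≤ m>0)))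
      -- The form yields u² ≤ m (`quad A f` + m u), while `quad A f` ≤ d u. Cancelling one factor u
      -- is the reason for treating u ≤ 0 apart.
      ... | no u>0 = ≤-by (cancel-nonneg u (ℤₚ.≰⇒> u>0) (ℤₚ.≤-trans (cancel-nonneg m m>0 (subst (0ℤ ≤_) form (psd-shift f y (- m) u supp Xy f-y)))
                       (≤-by (subst (0ℤ ≤_) (eq′ m d u (quad A f)) (nonneg-* (ℤₚ.<⇒≤ m>0) (≤-diff quadA≤))))))
        where
        u : ℤ
        u = size U
        f : Fin n → ℤ
        f p = ⟦ U p ⟧
        eq′ : ∀ m d u q → m * (d * u - q) ≡ u * (m * (d + m) - u) - (m * (q + m * u) - u * u)
        eq′ = solve-∀
        supp : supported f
        supp p Xp = cong ⟦_⟧ (≢true (λ Up → true≢false (Λ⊆X p (s p Up)) Xp))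
        f-y : f y ≡ 0ℤ
        f-y = cong ⟦_⟧ (≢true (λ Uy → true≢false (proj₂ (∧-true {X y} (s y Uy))) (adj-irr y)))
        row : (sum λ p → A y p * f p) ≡ u
        row = sum-cong-≗ term
          where
          term : ∀ p → A y p * f p ≡ f p
          term p with U p in Up
          ... | false = ℤₚ.*-zeroʳ (A y p)
          ... | true rewrite proj₂ (∧-true {X p} (s p Up)) = refl
        form : - m * - m * quad M f + (- m * u * (+ 2) * (sum λ p → A y p * f p) + u * u * m) ≡ m * (m * (quad A f + m * u) - u * u)
        form = trans (cong₂ (λ q r → - m * - m * q + (- m * u * (+ 2) * r + u * u * m)) (trans (quad-M f) (cong (λ t → quad A f + m * t) (sum-cong-≗ (λ p → ⟦⟧-idem (U p))))) row)
                     (eq m u (quad A f))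
          where
          eq : ∀ m u q → - m * - m * (q + m * u) + (- m * u * (+ 2) * u + u * u * m) ≡ m * (m * (q + m * u) - u * u)
          eq = solve-∀
        quadA≤ : quad A f ≤ d * u
        quadA≤ = subst (quad A f ≤_) (sum-* d f) (sum-≤ bound)
          where
          swap : ∀ a x y → a * (x * y) ≡ x * (y * a)
          swap = solve-∀
          bound : ∀ p → (sum λ q → A p q * (f p * f q)) ≤ d * f p
          bound p = subst (_≤ d * f p) (sym (trans (sum-cong-≗ (λ q → trans (swap (A p q) (f p) (f q)) (cong (λ t → f p * t) (sym (⟦⟧-∧ (U q) (adj p q)))))) (sum-* (f p) (λ q → ⟦ U q ∧ adj p q ⟧)))) le
            where
            le : f p * deg U p ≤ d * f p
            le with U p in Up
            ... | true  = subst₂ _≤_ (sym (ℤₚ.*-identityˡ (deg U p))) (sym (ℤₚ.*-identityʳ d)) (degs p Up)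
            ... | false = ℤₚ.≤-reflexive (trans (ℤₚ.*-zeroˡ (deg U p)) (sym (ℤₚ.*-zeroʳ d)))

      independent-bound : ∀ Z → Z ⊆ Λ → Independent Z → size Z ≤ m * m
      independent-bound Z s ind = subst (size Z ≤_) (cong (λ t → m * t) (ℤₚ.+-identityˡ m)) (star-bound Z 0ℤ s ℤₚ.≤-refl (λ p Zp → ℤₚ.≤-reflexive (sum-≡0 (λ q → cong ⟦_⟧ (isolated p q Zp)))))
        where
        isolated : ∀ p q → Z p ≡ true → Z q ∧ adj p q ≡ false
        isolated p q Zp with Z q in Zq | p Fin.≟ q
        ... | false | _ = refl
        ... | true  | yes refl = adj-irr p
        ... | true  | no ne    = ind p q Zp Zq ne

      module Maximal (Z : Fin n → Bool) (Z⊆Λ : Z ⊆ Λ) (ind : Independent Z)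
        (maximal : ∀ Z′ → Z′ ⊆ Λ → Independent Z′ → size Z′ ≡ 1ℤ + size Z → ⊥) where

        s : ℤ
        s = size Z

        N : Fin n → Fin n → Bool
        N p z = Z z ∧ near p z

        d : Fin n → ℤ
        d p = size (N p)

        d≥1 : ∀ p → Λ p ≡ true → 1ℤ ≤ d p
        d≥1 p Λp with 1ℤ ℤ.≤? d p
        ... | yes le = le
        ... | no nle = ⊥-elim (maximal (insert p Z) (insert-⊆ {Z} {Λ} {p} Z⊆Λ Λp) (independent-insert {Z} {p} ind (λ z Zz → proj₂ (near-false {p} {z} (far z Zz))))
                         (size-insert {y = p} {Z} (≢true (λ Zp → true≢false (near-refl p) (far p Zp)))))
          where
          far : ∀ z → Z z ≡ true → near p z ≡ false
          far z Zz = ≢true (λ e → nle (ℤₚ.i<j⇒suc[i]≤j (size-pos {C = N p} {z} (∧-intro Zz e))))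

        d-unique : ∀ {p z z′} → d p ≤ 1ℤ → Z z ≡ true → near p z ≡ true → Z z′ ≡ true → z ≢ z′ → near p z′ ≡ false
        d-unique {p} {z} {z′} le Zz e Zz′ ne = ≢true (λ e′ → ℤₚ.<⇒≱ (ℤ.+<+ (ℕₚ.n<1+n 1))
          (ℤₚ.≤-trans (subst₂ (λ a b → ⟦ a ⟧ + ⟦ b ⟧ ≤ d p) (∧-intro Zz e) (∧-intro Zz′ e′) (two-terms≤sum {f = λ w → ⟦ N p w ⟧} (λ w → ⟦⟧-nonneg (N p w)) ne)) le))

        -- Otherwise p and q could replace z in Z.
        private-clique : ∀ {p q z} → Λ p ≡ true → Λ q ≡ true → d p ≤ 1ℤ → d q ≤ 1ℤ → Z z ≡ true → near p z ≡ true → near q z ≡ true → p ≢ q → adj p q ≡ true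
        private-clique {p} {q} {z} Λp Λq dp dq Zz ep eq p≢q with adj p q in pq
        ... | true  = refl
        ... | false = ⊥-elim (maximal Z₂ Z₂⊆Λ Z₂-ind Z₂-size)
          where
          Z₀ Z₁ Z₂ : Fin n → Bool
          Z₀ = remove z Z
          Z₁ = insert q Z₀
          Z₂ = insert p Z₁
          far : ∀ {p} → d p ≤ 1ℤ → near p z ≡ true → ∀ r → Z₀ r ≡ true → p ≢ r × adj p r ≡ false
          far dp ep r h = let ne , Zr = remove-elim {y = z} {r} {Z} h in near-false (d-unique dp Zz ep Zr ne)
          Z₀-ind : Independent Z₀
          Z₀-ind a b ha hb = ind a b (proj₂ (remove-elim {y = z} {a} {Z} ha)) (proj₂ (remove-elim {y = z} {b} {Z} hb))
          Z₁-ind : Independent Z₁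
          Z₁-ind = independent-insert {Z₀} {q} Z₀-ind (λ r h → proj₂ (far dq eq r h))
          Z₂-ind : Independent Z₂
          Z₂-ind = independent-insert {Z₁} {p} Z₁-ind nadj
            where
            nadj : ∀ r → Z₁ r ≡ true → adj p r ≡ false
            nadj r h with insert-elim {y = q} {r} {Z₀} h
            ... | inj₁ refl = pq
            ... | inj₂ h₀   = proj₂ (far dp ep r h₀)
          Z₂⊆Λ : Z₂ ⊆ Λ
          Z₂⊆Λ = insert-⊆ {Z₁} {Λ} {p} (insert-⊆ {Z₀} {Λ} {q} (λ r h → Z⊆Λ r (proj₂ (remove-elim {y = z} {r} {Z} h))) Λq) Λp
          q∉Z₀ : Z₀ q ≡ false
          q∉Z₀ = ≢true (λ h → proj₁ (far dq eq q h) refl)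
          p∉Z₁ : Z₁ p ≡ false
          p∉Z₁ = ≢true notin
            where
            notin : Z₁ p ≡ true → ⊥
            notin h with insert-elim {y = q} {p} {Z₀} h
            ... | inj₁ e  = p≢q (sym e)
            ... | inj₂ h₀ = proj₁ (far dp ep p h₀) refl
          Z₂-size : size Z₂ ≡ 1ℤ + s
          Z₂-size = trans (size-insert {y = p} {Z₁} p∉Z₁) (cong (λ t → 1ℤ + t) (trans (size-insert {y = q} {Z₀} q∉Z₀) (size-remove {y = z} {Z} Zz)))

        U : Fin n → Bool
        U p = Λ p ∧ does (d p ℤ.≟ 1ℤ)

        U-elim : ∀ {p} → U p ≡ true → Λ p ≡ true × d p ≡ 1ℤ
        U-elim {p} h with ∧-true {Λ p} h
        ... | Λp , h′ with d p ℤ.≟ 1ℤ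
        ...   | yes e = Λp , e

        U⊆Λ : U ⊆ Λ
        U⊆Λ p h = proj₁ (U-elim h)

        part≤ω : ∀ z → Z z ≡ true → size (λ p → U p ∧ near p z) ≤ ω
        part≤ω z Zz = clique≤ω (λ p → U p ∧ near p z) (λ p h → Λ⊆X p (U⊆Λ p (proj₁ (∧-true {U p} h)))) cl
          where
          cl : Clique (λ p → U p ∧ near p z)
          cl p q hp hq ne with ∧-true {U p} hp | ∧-true {U q} hq
          ... | Up , ep | Uq , eq with U-elim {p} Up | U-elim {q} Uq
          ...   | Λp , dp | Λq , dq = private-clique Λp Λq (ℤₚ.≤-reflexive dp) (ℤₚ.≤-reflexive dq) Zz ep eq ne

        μ-far : ∀ {p z} → X p ≡ true → X z ≡ true → near p z ≡ false → size (λ r → X r ∧ (adj p r ∧ adj z r)) ≤ μ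
        μ-far {p} {z} Xp Xz e = let ne , na = near-false {p} {z} e in common p z Xp Xz ne na

        -- Sort the neighbours of `p` in `U` by the unique point of `Z` near them. Those sharing the
        -- point of `p` lie in one clique, at most ω of them. For any other z in `Z`, `p` and z are
        -- distinct and nonadjacent, so at most μ neighbours belong to z.
        deg-U : ∀ p → U p ≡ true → deg U p ≤ ω + (s - 1ℤ) * μ
        deg-U p Up = ℤₚ.≤-trans (ℤₚ.≤-reflexive expand) (ℤₚ.≤-trans (sum-≤ inner) (ℤₚ.≤-reflexive collect))
          where
          expand : deg U p ≡ sum λ z → sum λ q → ⟦ U q ∧ adj p q ⟧ * ⟦ N q z ⟧
          expand = trans (sum-cong-≗ (λ q → trans (unit q) (sym (sum-* ⟦ U q ∧ adj p q ⟧ (λ z → ⟦ N q z ⟧))))) (∑-comm (λ q z → ⟦ U q ∧ adj p q ⟧ * ⟦ N q z ⟧))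
            where
            unit : ∀ q → ⟦ U q ∧ adj p q ⟧ ≡ ⟦ U q ∧ adj p q ⟧ * d q
            unit q with U q in Uq
            ... | false = sym (ℤₚ.*-zeroˡ (d q))
            ... | true rewrite proj₂ (U-elim {q} Uq) = sym (ℤₚ.*-identityʳ (A p q))
          inner : ∀ z → (sum λ q → ⟦ U q ∧ adj p q ⟧ * ⟦ N q z ⟧) ≤ (ω - μ) * ⟦ N p z ⟧ + μ * ⟦ Z z ⟧
          inner z with Z z in Zz
          ... | false = ℤₚ.≤-reflexive (trans (sum-≡0 (λ q → ℤₚ.*-zeroʳ ⟦ U q ∧ adj p q ⟧)) (sym (eq (ω - μ) μ)))
            where
            eq : ∀ a b → a * 0ℤ + b * 0ℤ ≡ 0ℤ
            eq = solve-∀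
          ... | true with near p z in pz
          ...   | true  = subst (_ ≤_) (eq ω μ) (ℤₚ.≤-trans (sum-≤ drop) (part≤ω z Zz))
            where
            eq : ∀ a b → a ≡ (a - b) * 1ℤ + b * 1ℤ
            eq = solve-∀
            drop : ∀ q → ⟦ U q ∧ adj p q ⟧ * ⟦ near q z ⟧ ≤ ⟦ U q ∧ near q z ⟧
            drop q = ℤₚ.≤-trans (ℤₚ.≤-reflexive (sym (⟦⟧-∧ (U q ∧ adj p q) (near q z))))
                       (⟦⟧-mono (λ h → let h₁ , h₂ = ∧-true {U q ∧ adj p q} h in ∧-intro (proj₁ (∧-true {U q} h₁)) h₂))
          ...   | false = subst (_ ≤_) (eq ω μ) (ℤₚ.≤-trans (sum-≤ drop) (μ-far {p} {z} (Λ⊆X p (U⊆Λ p Up)) (Λ⊆X z (Z⊆Λ z Zz)) pz))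
            where
            eq : ∀ a b → b ≡ (a - b) * 0ℤ + b * 1ℤ
            eq = solve-∀
            drop : ∀ q → ⟦ U q ∧ adj p q ⟧ * ⟦ near q z ⟧ ≤ ⟦ X q ∧ (adj p q ∧ adj z q) ⟧
            drop q = ℤₚ.≤-trans (ℤₚ.≤-reflexive (sym (⟦⟧-∧ (U q ∧ adj p q) (near q z)))) (⟦⟧-mono both)
              where
              both : (U q ∧ adj p q) ∧ near q z ≡ true → X q ∧ (adj p q ∧ adj z q) ≡ true
              both h with ∧-true {U q ∧ adj p q} h
              ... | h₁ , e with ∧-true {U q} h₁ | near-true {q} {z} e
              ...   | Uq , pq | inj₁ refl = ⊥-elim (true≢false pq (proj₂ (near-false {p} {z} pz)))
              ...   | Uq , pq | inj₂ qz   = ∧-intro (Λ⊆X q (U⊆Λ q Uq)) (∧-intro pq (trans (adj-sym z q) qz))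
          collect : (sum λ z → (ω - μ) * ⟦ N p z ⟧ + μ * ⟦ Z z ⟧) ≡ ω + (s - 1ℤ) * μ
          collect = trans (sum-linear (ω - μ) μ (λ z → ⟦ N p z ⟧) (λ z → ⟦ Z z ⟧)) (trans (cong (λ t → (ω - μ) * t + μ * s) (proj₂ (U-elim {p} Up))) (eq ω μ s))
            where
            eq : ∀ ω μ s → (ω - μ) * 1ℤ + μ * s ≡ ω + (s - 1ℤ) * μ
            eq = solve-∀

        -- Count triples of a point `p` of `Λ` and two distinct points of `Z` near it. As `Z` is
        -- independent, `p` cannot equal either of the two, hence is a common neighbour of two
        -- nonadjacent vertices.
        pairs : (sum λ p → ⟦ Λ p ⟧ * (d p * d p - d p)) ≤ (s * s - s) * μ
        pairs = ℤₚ.≤-trans (ℤₚ.≤-reflexive expand) (ℤₚ.≤-trans (sum-≤ (λ z → sum-≤ (inner z))) (ℤₚ.≤-reflexive collect))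
          where
          square : ∀ (Y : Fin n → Bool) → size Y * size Y - size Y ≡ sum λ z → sum λ w → (1ℤ - δ z w) * (⟦ Y z ⟧ * ⟦ Y w ⟧)
          square Y = sym (trans (sum-cong-≗ (λ z → trans (sum-cong-≗ (λ w → distr (δ z w) (⟦ Y z ⟧ * ⟦ Y w ⟧))) (trans (sum-- (λ w → ⟦ Y z ⟧ * ⟦ Y w ⟧) (λ w → δ z w * (⟦ Y z ⟧ * ⟦ Y w ⟧)))
                             (cong (λ t → (sum λ w → ⟦ Y z ⟧ * ⟦ Y w ⟧) - t) (trans (sum-δ z (λ w → ⟦ Y z ⟧ * ⟦ Y w ⟧)) (⟦⟧-idem (Y z)))))))
                           (trans (sum-- (λ z → sum λ w → ⟦ Y z ⟧ * ⟦ Y w ⟧) (λ z → ⟦ Y z ⟧)) (cong (_- size Y) (sum-product (λ z → ⟦ Y z ⟧) (λ w → ⟦ Y w ⟧)))))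
            where
            distr : ∀ d x → (1ℤ - d) * x ≡ x - d * x
            distr = solve-∀
          term : Fin n → Fin n → Fin n → ℤ
          term p z w = ⟦ Λ p ⟧ * ((1ℤ - δ z w) * (⟦ N p z ⟧ * ⟦ N p w ⟧))
          expand : (sum λ p → ⟦ Λ p ⟧ * (d p * d p - d p)) ≡ sum λ z → sum λ w → sum λ p → term p z w
          expand = trans (sum-cong-≗ (λ p → trans (cong (λ t → ⟦ Λ p ⟧ * t) (square (N p))) (sym (sum²-* ⟦ Λ p ⟧ (λ z w → (1ℤ - δ z w) * (⟦ N p z ⟧ * ⟦ N p w ⟧))))))
                  (trans (∑-comm (λ p z → sum λ w → term p z w)) (sum-cong-≗ (λ z → ∑-comm (λ p w → term p z w))))
          inner : ∀ z w → (sum λ p → term p z w) ≤ μ * ((1ℤ - δ z w) * (⟦ Z z ⟧ * ⟦ Z w ⟧))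
          inner z w with z Fin.≟ w
          ... | yes _ = ℤₚ.≤-reflexive (trans (sum-≡0 (λ p → eq₁ ⟦ Λ p ⟧ (⟦ N p z ⟧ * ⟦ N p w ⟧))) (sym (eq₁ μ (⟦ Z z ⟧ * ⟦ Z w ⟧))))
            where
            eq₁ : ∀ x y → x * ((1ℤ - 1ℤ) * y) ≡ 0ℤ
            eq₁ = solve-∀
          ... | no z≢w with Z z in Zz | Z w in Zw
          ...   | false | Zw′ = ℤₚ.≤-reflexive (trans (sum-≡0 (λ p → eq₁ ⟦ Λ p ⟧ ⟦ Zw′ ∧ near p w ⟧)) (sym (eq₁ μ ⟦ Zw′ ⟧)))
            where
            eq₁ : ∀ x y → x * ((1ℤ - 0ℤ) * (0ℤ * y)) ≡ 0ℤ
            eq₁ = solve-∀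
          ...   | true | false = ℤₚ.≤-reflexive (trans (sum-≡0 (λ p → eq₁ ⟦ Λ p ⟧ ⟦ near p z ⟧)) (sym (eq₁ μ 1ℤ)))
            where
            eq₁ : ∀ x y → x * ((1ℤ - 0ℤ) * (y * 0ℤ)) ≡ 0ℤ
            eq₁ = solve-∀
          ...   | true | true = subst (_ ≤_) (sym (ℤₚ.*-identityʳ μ)) (ℤₚ.≤-trans (sum-≤ bound) (common z w (Λ⊆X z (Z⊆Λ z Zz)) (Λ⊆X w (Z⊆Λ w Zw)) z≢w (ind z w Zz Zw z≢w)))
            where
            eq₂ : ∀ x y z → x * ((1ℤ - 0ℤ) * (y * z)) ≡ x * (y * z)
            eq₂ = solve-∀
            both : ∀ p → Λ p ∧ (near p z ∧ near p w) ≡ true → X p ∧ (adj z p ∧ adj w p) ≡ true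
            both p h with ∧-true {Λ p} h
            ... | Λp , h′ with ∧-true {near p z} h′
            ...   | e , e′ with near-true {p} {z} e | near-true {p} {w} e′
            ...     | inj₁ refl | inj₁ refl = ⊥-elim (z≢w refl)
            ...     | inj₁ refl | inj₂ a    = ⊥-elim (true≢false a (ind z w Zz Zw z≢w))
            ...     | inj₂ a    | inj₁ refl = ⊥-elim (true≢false a (ind w z Zw Zz (λ q → z≢w (sym q))))
            ...     | inj₂ a    | inj₂ a′   = ∧-intro (Λ⊆X p Λp) (∧-intro (trans (adj-sym z p) a) (trans (adj-sym w p) a′))
            bound : ∀ p → ⟦ Λ p ⟧ * ((1ℤ - 0ℤ) * (⟦ near p z ⟧ * ⟦ near p w ⟧)) ≤ ⟦ X p ∧ (adj z p ∧ adj w p) ⟧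
            bound p = ℤₚ.≤-trans (ℤₚ.≤-reflexive (trans (eq₂ ⟦ Λ p ⟧ ⟦ near p z ⟧ ⟦ near p w ⟧) (sym (trans (⟦⟧-∧ (Λ p) (near p z ∧ near p w)) (cong (λ t → ⟦ Λ p ⟧ * t) (⟦⟧-∧ (near p z) (near p w)))))))
                        (⟦⟧-mono (both p))
          collect : (sum λ z → sum λ w → μ * ((1ℤ - δ z w) * (⟦ Z z ⟧ * ⟦ Z w ⟧))) ≡ (s * s - s) * μ
          collect = trans (sum²-* μ (λ z w → (1ℤ - δ z w) * (⟦ Z z ⟧ * ⟦ Z w ⟧))) (trans (cong (λ t → μ * t) (sym (square Z))) (ℤₚ.*-comm μ (s * s - s)))

        -- Maximality gives d p ≥ 1 on `Λ`. A point outside `U` has d p ≥ 2 and is paid for by d p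
        -- (d p - 1) ≥ 2. Doubling avoids the halves of the binomial coefficient.
        rest : (+ 2) * size Λ ≤ (+ 2) * size U + (s * s - s) * μ
        rest = ℤₚ.≤-trans (subst₂ _≤_ (sum-* (+ 2) (λ p → ⟦ Λ p ⟧)) (trans (sum-+ (λ p → + 2 * ⟦ U p ⟧) (λ p → ⟦ Λ p ⟧ * (d p * d p - d p))) (cong (λ t → t + (sum λ p → ⟦ Λ p ⟧ * (d p * d p - d p))) (sum-* (+ 2) (λ p → ⟦ U p ⟧)))) (sum-≤ term))
                          (ℤₚ.+-monoʳ-≤ (+ 2 * size U) pairs)
          where
          term : ∀ p → + 2 * ⟦ Λ p ⟧ ≤ + 2 * ⟦ U p ⟧ + ⟦ Λ p ⟧ * (d p * d p - d p)
          term p with Λ p in Λp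
          ... | false = ℤₚ.≤-reflexive (eq (d p * d p - d p))
            where
            eq : ∀ x → + 2 * 0ℤ ≡ + 2 * 0ℤ + 0ℤ * x
            eq = solve-∀
          ... | true with d p ℤ.≟ 1ℤ
          ...   | yes e rewrite e = ℤₚ.≤-refl
          ...   | no ne = ≤-by (subst (0ℤ ≤_) (eq (d p)) (nonneg-* (≤-diff 2≤d) (nonneg-+ (≤-diff 2≤d) (ℤ.+≤+ (ℕ.z≤n {3})))))
            where
            2≤d : + 2 ≤ d p
            2≤d = ℤₚ.i<j⇒suc[i]≤j (ℤₚ.≤∧≢⇒< (d≥1 p Λp) (λ q → ne (sym q)))
            eq : ∀ x → (x - + 2) * (x - + 2 + + 3) ≡ + 2 * 0ℤ + 1ℤ * (x * x - x) - + 2 * 1ℤ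
            eq = solve-∀

        -- `Λ` has ν points. The estimates for `U` and for its complement in `Λ` grow with s, so s
        -- may be replaced by its bound m².
        valency≤ : + 2 * ν ≤ + 2 * (m * (ω + (m * m - 1ℤ) * μ + m)) + (m * m * (m * m) - m * m) * μ
        valency≤ = ℤₚ.≤-trans (subst (λ t → + 2 * t ≤ + 2 * size U + (s * s - s) * μ) (valency y Xy) rest)
          (ℤₚ.+-mono-≤ (*-mono (+ 2) (ℤ.+≤+ ℕ.z≤n) U≤) (≤-by (subst (0ℤ ≤_) (eq (m * m) s μ) (nonneg-* (nonneg-* (≤-diff s≤m²) (nonneg-+ m²-1≥0 (size-nonneg Z))) μ≥0))))
          where
          s≤m² : s ≤ m * m
          s≤m² = independent-bound Z Z⊆Λ ind
          m²-1≥0 : 0ℤ ≤ m * m - 1ℤ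
          m²-1≥0 = subst (0ℤ ≤_) (ring m) (nonneg-* (≤-diff (ℤₚ.<⇒≤ m>1)) (nonneg-+ (ℤₚ.<⇒≤ m>0) (ℤ.+≤+ (ℕ.z≤n {1}))))
            where
            ring : ∀ m → (m - 1ℤ) * (m + 1ℤ) ≡ m * m - 1ℤ
            ring = solve-∀
          eq : ∀ q s μ → (q - s) * (q - 1ℤ + s) * μ ≡ (q * q - q) * μ - (s * s - s) * μ
          eq = solve-∀
          U≤ : size U ≤ m * (ω + (m * m - 1ℤ) * μ + m)
          U≤ = star-bound U (ω + (m * m - 1ℤ) * μ) U⊆Λ (nonneg-+ ω≥0 (nonneg-* m²-1≥0 μ≥0))
                 (λ p Up → ℤₚ.≤-trans (deg-U p Up) (ℤₚ.+-monoʳ-≤ ω (≤-by (subst (0ℤ ≤_) (ring (m * m) s μ) (nonneg-* (≤-diff s≤m²) μ≥0)))))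
            where
            ring : ∀ q s μ → (q - s) * μ ≡ (q - 1ℤ) * μ - (s - 1ℤ) * μ
            ring = solve-∀

      -- Deciding the inequality beforehand turns the goal into a contradiction, so the independent
      -- set can be grown from the empty one: whenever it is not maximal the recursion continues
      -- with a larger set, and `independent-bound` stops it at m².
      local-valency≤ : + 2 * ν ≤ + 2 * (m * (ω + (m * m - 1ℤ) * μ + m)) + (m * m * (m * m) - m * m) * μ
      local-valency≤ with (+ 2 * ν) ℤ.≤? (+ 2 * (m * (ω + (m * m - 1ℤ) * μ + m)) + (m * m * (m * m) - m * m) * μ)
      ... | yes le = le
      ... | no nle = ⊥-elim (go (suc ℤ.∣ m * m ∣) (λ _ → false) (λ _ ()) (λ _ _ ()) start)
        where
        go : ∀ j Z → Z ⊆ Λ → Independent Z → m * m < size Z + + j → ⊥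
        go zero Z s ind lt = ℤₚ.<⇒≱ (subst (m * m <_) (ℤₚ.+-identityʳ (size Z)) lt) (independent-bound Z s ind)
        go (suc j) Z s ind lt = nle (Maximal.valency≤ Z s ind (λ Z′ s′ ind′ grown → go j Z′ s′ ind′
          (subst (m * m <_) (trans (shuffle (size Z) (+ j)) (cong (_+ + j) (sym grown))) lt)))
          where
          shuffle : ∀ c j → c + (1ℤ + j) ≡ 1ℤ + c + j
          shuffle = solve-∀
        start : m * m < size {n} (λ _ → false) + + suc ℤ.∣ m * m ∣
        start = subst₂ (λ a b → a < b + + suc ℤ.∣ m * m ∣) (ℤₚ.0≤i⇒+∣i∣≡i (square-nonneg m)) (sym (sum-≡0 {n} (λ _ → refl))) (ℤ.+<+ (ℕₚ.n<1+n ℤ.∣ m * m ∣))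

  -- Numerical estimates

  -- Polynomials in t with natural coefficients: with b = 2 + t and m = b + 1 = 3 + t, the estimates
  -- below hold coefficientwise.
  horner : List ℕ → ℤ → ℤ
  horner []       t = 0ℤ
  horner (c ∷ cs) t = + c + t * horner cs t

  horner-nonneg : ∀ cs {t} → 0ℤ ≤ t → 0ℤ ≤ horner cs t
  horner-nonneg []       t≥0 = ℤₚ.≤-refl
  horner-nonneg (c ∷ cs) t≥0 = nonneg-+ {+ c} (ℤ.+≤+ ℕ.z≤n) (nonneg-* t≥0 (horner-nonneg cs t≥0))

  -- At b = 2 this reads 243 ≤ 255, whereas [7] = 127 would be too small. This is the source of D -
  -- 1 ≥ 8.
  gauss₈-bound : ∀ t → 0ℤ ≤ t → let b = + 2 + t; m = + 3 + t in
    m * m * m * m * m ≤ 1ℤ + b * (1ℤ + b * (1ℤ + b * (1ℤ + b * (1ℤ + b * (1ℤ + b * (1ℤ + b * (1ℤ + b * 0ℤ)))))))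
  gauss₈-bound t t≥0 = ≤-by (subst (0ℤ ≤_) (sym (ring t)) (horner-nonneg (12 ∷ 364 ∷ 753 ∷ 679 ∷ 336 ∷ 96 ∷ 15 ∷ 1 ∷ []) t≥0))
    where
    ring : ∀ t → let b = + 2 + t; m = + 3 + t in
      1ℤ + b * (1ℤ + b * (1ℤ + b * (1ℤ + b * (1ℤ + b * (1ℤ + b * (1ℤ + b * (1ℤ + b * 0ℤ))))))) - m * m * m * m * m
      ≡ (+ 12 + t * (+ 364 + t * (+ 753 + t * (+ 679 + t * (+ 336 + t * (+ 96 + t * (+ 15 + t * (+ 1 + t * 0ℤ))))))))
    ring = solve-∀

  -- The coefficient of H is positive because (2 m - 1) b > m², that is b² > b + 1, for b ≥ 2. One
  -- copy of H outweighs the term free of H, which is m⁴ after division by b.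
  discriminant-bound : ∀ t a H → 0ℤ ≤ t → let b = + 2 + t; m = + 3 + t in b * b * (m * m) + 1ℤ ≤ a → m * m * m * m * m ≤ H →
    0ℤ < (+ 2 * m - 1ℤ) * (a * (b * H)) - m * m * m * ((b * m) * (1ℤ + b * H))
  discriminant-bound t a H t≥0 a-large H-large = subst (0ℤ <_) (sym (ring t a H)) (pos-* {+ 2 + t} (ℤₚ.+-mono-<-≤ {0ℤ} {+ 2} (ℤ.+<+ (ℕ.s≤s ℕ.z≤n)) t≥0)
      (ℤₚ.+-mono-≤-< (nonneg-+ (nonneg-* (nonneg-+ (horner-nonneg (22 ∷ 77 ∷ 89 ∷ 46 ∷ 11 ∷ 1 ∷ []) t≥0) (nonneg-* (nonneg-+ {+ 5} (ℤ.+≤+ ℕ.z≤n) (nonneg-+ t≥0 t≥0)) (≤-diff a-large))) H≥0) (≤-diff H-large))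
                     (pos-* (pos-* (pos-* (pos-* m>0 m>0) m>0) m>0) b>0)))
    where
    m>0 : 0ℤ < + 3 + t
    m>0 = ℤₚ.+-mono-<-≤ {0ℤ} {+ 3} (ℤ.+<+ (ℕ.s≤s ℕ.z≤n)) t≥0
    b>0 : 0ℤ < + 2 + t
    b>0 = ℤₚ.+-mono-<-≤ {0ℤ} {+ 2} (ℤ.+<+ (ℕ.s≤s ℕ.z≤n)) t≥0
    H≥0 : 0ℤ ≤ H
    H≥0 = ℤₚ.≤-trans (ℤₚ.<⇒≤ (pos-* (pos-* (pos-* (pos-* m>0 m>0) m>0) m>0) m>0)) H-large
    ring : ∀ t a H → let b = + 2 + t; m = + 3 + t in
      (+ 2 * m - 1ℤ) * (a * (b * H)) - m * m * m * ((b * m) * (1ℤ + b * H))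
      ≡ b * (((+ 22 + t * (+ 77 + t * (+ 89 + t * (+ 46 + t * (+ 11 + t * (+ 1 + t * 0ℤ)))))) + (+ 5 + (t + t)) * (a - (b * b * (m * m) + 1ℤ))) * H + (H - m * m * m * m * m) + m * m * m * m * b)
    ring = solve-∀

  -- Eliminating ω leaves ν + 1 ≤ (m⁴ + 2 m³ - m²) μ plus a polynomial in m, while a H < β gives ν +
  -- 1 > a H ≥ m⁵ a. The margin m⁵ - (m⁴ + 2 m³ - m²), equal to 117 at b = 2, absorbs the polynomial
  -- because a > b² m².
  alpha-contradiction : ∀ t a H ν ω μ β → 0ℤ ≤ t → let b = + 2 + t; m = + 3 + t; h = b * m in
    b * b * (m * m) + 1ℤ ≤ a → m * m * m * m * m ≤ H → a * H < β → m * (ν + 1ℤ) ≡ β + a * (b * H) → μ ≡ m + a →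
    + 2 * m * ω ≤ ν + 1ℤ →
    + 2 * ν ≤ + 2 * (m * (ω + (μ + h + h * h) + (m * m - 1ℤ) * μ + m)) + (m * m * (m * m) - m * m) * μ → ⊥
  alpha-contradiction t a H ν ω _ β t≥0 a-large H-large β-large ν-eq refl ω-small ν-small =
    -- `total` is a certificate: a combination of the hypotheses with nonnegative coefficients that
    -- vanishes identically, although its term β - a H is strictly positive.
    ℤₚ.<-irrefl refl (subst (0ℤ <_) (total β (β≡ ν-eq))
      (ℤₚ.+-mono-<-≤ (ℤₚ.+-mono-≤-< (nonneg-+ (nonneg-* m≥0 (≤-diff ν-small)) (nonneg-* m≥0 (≤-diff ω-small))) (<-diff β-large))
        (nonneg-* m≥0 (nonneg-+ (nonneg-+ (horner-nonneg (3679 ∷ 15153 ∷ 25903 ∷ 24886 ∷ 15005 ∷ 5925 ∷ 1537 ∷ 253 ∷ 24 ∷ 1 ∷ []) t≥0) (nonneg-* (horner-nonneg (117 ∷ 249 ∷ 199 ∷ 76 ∷ 14 ∷ 1 ∷ []) t≥0) (≤-diff a-large))) (nonneg-* a≥0 (≤-diff H-large))))))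
    where
    m≥0 : 0ℤ ≤ + 3 + t
    m≥0 = nonneg-+ {+ 3} (ℤ.+≤+ ℕ.z≤n) t≥0
    b≥0 : 0ℤ ≤ + 2 + t
    b≥0 = nonneg-+ {+ 2} (ℤ.+≤+ ℕ.z≤n) t≥0
    a≥0 : 0ℤ ≤ a
    a≥0 = ℤₚ.≤-trans (nonneg-+ (nonneg-* (nonneg-* b≥0 b≥0) (nonneg-* m≥0 m≥0)) (ℤ.+≤+ (ℕ.z≤n {1}))) a-large
    β≡ : ∀ {x y z} → x ≡ y + z → y ≡ x - z
    β≡ {y = y} {z} refl = eq y z
      where
      eq : ∀ y z → y ≡ y + z - z
      eq = solve-∀
    ring : ∀ t a H ν ω → let b = + 2 + t; m = + 3 + t; h = b * m; μ = m + a in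
      m * (+ 2 * (m * (ω + (μ + h + h * h) + (m * m - 1ℤ) * μ + m)) + (m * m * (m * m) - m * m) * μ - + 2 * ν) + m * (ν + 1ℤ - + 2 * m * ω)
      + (m * (ν + 1ℤ) - a * (b * H) - a * H)
      + m * ((+ 3679 + t * (+ 15153 + t * (+ 25903 + t * (+ 24886 + t * (+ 15005 + t * (+ 5925 + t * (+ 1537 + t * (+ 253 + t * (+ 24 + t * (+ 1 + t * 0ℤ)))))))))) + (+ 117 + t * (+ 249 + t * (+ 199 + t * (+ 76 + t * (+ 14 + t * (+ 1 + t * 0ℤ)))))) * (a - (b * b * (m * m) + 1ℤ)) + a * (H - m * m * m * m * m)) ≡ 0ℤ
    ring = solve-∀
    total : ∀ β → β ≡ (+ 3 + t) * (ν + 1ℤ) - a * ((+ 2 + t) * H) → let b = + 2 + t; m = + 3 + t; h = b * m; μ = m + a in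
      m * (+ 2 * (m * (ω + (μ + h + h * h) + (m * m - 1ℤ) * μ + m)) + (m * m * (m * m) - m * m) * μ - + 2 * ν) + m * (ν + 1ℤ - + 2 * m * ω)
      + (β - a * H)
      + m * (horner (3679 ∷ 15153 ∷ 25903 ∷ 24886 ∷ 15005 ∷ 5925 ∷ 1537 ∷ 253 ∷ 24 ∷ 1 ∷ []) t + horner (117 ∷ 249 ∷ 199 ∷ 76 ∷ 14 ∷ 1 ∷ []) t * (a - (b * b * (m * m) + 1ℤ)) + a * (H - m * m * m * m * m)) ≡ 0ℤ
    total _ refl = ring t a H ν ω

  -- Inserting ω into the valency bound gives 2 m² h Γ = 2 b m³ Γ as leading term and m⁵ + 2 m⁴ - m³
  -- + 2 as coefficient of a. Its excess 2 m³ b over the coefficient m⁵ + m³ + 2 is moved into the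
  -- constant by a ≤ b² m².
  beta-contradiction : ∀ t a Γ ν ω μ β → 0ℤ ≤ t → let b = + 2 + t; m = + 3 + t; h = b * m in
    a ≤ b * b * (m * m) → m * (ν + 1ℤ) ≡ β + a * (Γ - 1ℤ) → μ ≡ m + a → ω ≡ h * Γ + (μ + h + h * h) →
    + 2 * ν ≤ + 2 * (m * (ω + (m * m - 1ℤ) * μ + m)) + (m * m * (m * m) - m * m) * μ →
    + 2 * β < + 2 * (b * (m * m * m) - a) * Γ + + 2 * (m * m * m * m * m * m * m * b) + (m * m * m * (m * m + 1ℤ) + + 2) * a - + 2 * (b * m)
  beta-contradiction t a Γ ν _ _ β t≥0 a-small ν-eq refl refl ν-small = ℤₚ.≰⇒> λ large →
    ℤₚ.<-irrefl refl (subst (0ℤ <_) (total β (β≡ ν-eq))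
      (ℤₚ.+-mono-≤-< (nonneg-+ (nonneg-+ (nonneg-* m≥0 (≤-diff ν-small)) (≤-diff large)) (nonneg-* (nonneg-* (nonneg-* (nonneg-* (nonneg-* {+ 2} (ℤ.+≤+ ℕ.z≤n) m≥0) m≥0) m≥0) b≥0) (≤-diff a-small)))
        (ℤₚ.+-mono-<-≤ {0ℤ} {+ 2898} (ℤ.+<+ (ℕ.s≤s ℕ.z≤n)) (nonneg-* t≥0 (horner-nonneg (8574 ∷ 10393 ∷ 6804 ∷ 2622 ∷ 598 ∷ 75 ∷ 4 ∷ []) t≥0)))))
    where
    m≥0 : 0ℤ ≤ + 3 + t
    m≥0 = nonneg-+ {+ 3} (ℤ.+≤+ ℕ.z≤n) t≥0
    b≥0 : 0ℤ ≤ + 2 + t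
    b≥0 = nonneg-+ {+ 2} (ℤ.+≤+ ℕ.z≤n) t≥0
    β≡ : ∀ {x y z} → x ≡ y + z → y ≡ x - z
    β≡ {y = y} {z} refl = eq y z
      where
      eq : ∀ y z → y ≡ y + z - z
      eq = solve-∀
    ring : ∀ t a Γ ν → let b = + 2 + t; m = + 3 + t; h = b * m; μ = m + a; ω = h * Γ + (μ + h + h * h); β = m * (ν + 1ℤ) - a * (Γ - 1ℤ) in
      m * (+ 2 * (m * (ω + (m * m - 1ℤ) * μ + m)) + (m * m * (m * m) - m * m) * μ - + 2 * ν)
      + (+ 2 * β - (+ 2 * (b * (m * m * m) - a) * Γ + + 2 * (m * m * m * m * m * m * m * b) + (m * m * m * (m * m + 1ℤ) + + 2) * a - + 2 * (b * m)))
      + + 2 * m * m * m * b * (b * b * (m * m) - a) + (+ 2898 + t * (+ 8574 + t * (+ 10393 + t * (+ 6804 + t * (+ 2622 + t * (+ 598 + t * (+ 75 + t * (+ 4 + t * 0ℤ)))))))) ≡ 0ℤ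
    ring = solve-∀
    total : ∀ β → β ≡ (+ 3 + t) * (ν + 1ℤ) - a * (Γ - 1ℤ) → let b = + 2 + t; m = + 3 + t; h = b * m; μ = m + a; ω = h * Γ + (μ + h + h * h) in
      m * (+ 2 * (m * (ω + (m * m - 1ℤ) * μ + m)) + (m * m * (m * m) - m * m) * μ - + 2 * ν)
      + (+ 2 * β - (+ 2 * (b * (m * m * m) - a) * Γ + + 2 * (m * m * m * m * m * m * m * b) + (m * m * m * (m * m + 1ℤ) + + 2) * a - + 2 * (b * m)))
      + + 2 * m * m * m * b * (b * b * (m * m) - a) + horner (2898 ∷ 8574 ∷ 10393 ∷ 6804 ∷ 2622 ∷ 598 ∷ 75 ∷ 4 ∷ []) t ≡ 0ℤ
    total _ refl = ring t a Γ ν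

  -- The bounds for integral scaled parameters

  gap-above : ∀ {m h Γ a β c} → h * Γ ≤ c → m * c ≤ β → 0ℤ < h → 1ℤ < Γ → m * h < a →
    0ℤ < (β - m * c) * (c - h * Γ) + (Γ - 1ℤ) * (a - m * h) * c
  gap-above z≤c mc≤β h>0 Γ>1 a-large = ℤₚ.+-mono-≤-< (nonneg-* (≤-diff mc≤β) (≤-diff z≤c))
    (pos-* (pos-* (<-diff Γ>1) (<-diff a-large)) (ℤₚ.<-≤-trans (pos-* h>0 (ℤₚ.<-trans (ℤ.+<+ (ℕ.s≤s ℕ.z≤n)) Γ>1)) z≤c))

  -- Completing the square in c; the discriminant is bounded by hypothesis.
  gap-below : ∀ {m h Γ a β c} → c ≤ h * Γ → β + a * (Γ - 1ℤ) ≤ m * (+ 2 * m * c) → 0ℤ < h → 1ℤ < Γ → 1ℤ < m →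
    0ℤ < (+ 2 * m - 1ℤ) * (a * (Γ - 1ℤ)) - m * m * m * (h * Γ) →
    0ℤ < (β - m * c) * (c - h * Γ) + (Γ - 1ℤ) * (a - m * h) * c
  gap-below {m} {h} {Γ} {a} {β} {c} c≤z c-large h>0 Γ>1 m>1 disc =
    cancel-pos (+ 4 * (+ 2 * m - 1ℤ)) (ℤₚ.<⇒≤ 4K>0) (subst (0ℤ <_) (sym (ring m h Γ a β c))
      (ℤₚ.+-mono-<-≤ (ℤₚ.+-mono-≤-< (nonneg-+ (nonneg-* (nonneg-* (ℤₚ.<⇒≤ 4K>0) (≤-diff c≤z)) (≤-diff c-large))
                                               (nonneg-* m≥0 (square-nonneg (+ 2 * (+ 2 * m - 1ℤ) * c - + 2 * m * (h * Γ) + h))))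
                                     (pos-* (pos-* {+ 4} (ℤ.+<+ (ℕ.s≤s ℕ.z≤n)) (pos-* h>0 Γ>0)) disc))
                     (nonneg-* (nonneg-* m≥0 (nonneg-* (ℤₚ.<⇒≤ h>0) (ℤₚ.<⇒≤ h>0))) (≤-diff (ℤₚ.i<j⇒suc[i]≤j (pos-* {+ 4 * m} (pos-* {+ 4} (ℤ.+<+ (ℕ.s≤s ℕ.z≤n)) m>0) Γ>0))))))
    where
    m>0 : 0ℤ < m
    m>0 = ℤₚ.<-trans (ℤ.+<+ (ℕ.s≤s ℕ.z≤n)) m>1
    m≥0 = ℤₚ.<⇒≤ m>0
    Γ>0 : 0ℤ < Γ
    Γ>0 = ℤₚ.<-trans (ℤ.+<+ (ℕ.s≤s ℕ.z≤n)) Γ>1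
    4K>0 : 0ℤ < + 4 * (+ 2 * m - 1ℤ)
    4K>0 = pos-* {+ 4} (ℤ.+<+ (ℕ.s≤s ℕ.z≤n)) (subst (0ℤ <_) (eq m) (ℤₚ.+-mono-<-≤ m>0 (≤-diff (ℤₚ.<⇒≤ m>1))))
      where
      eq : ∀ m → m + (m - 1ℤ) ≡ + 2 * m - 1ℤ
      eq = solve-∀
    -- As c ≤ z, β may be replaced by its upper bound 2 m² c - a (Γ - 1). What remains is m K c² - m
    -- (2 m z - h) c + a (Γ - 1) z, whose multiple by 4 K contains the square m q².
    ring : ∀ m h Γ a β c → let K = + 2 * m - 1ℤ; z = h * Γ; q = + 2 * K * c - + 2 * m * z + h in
      + 4 * K * ((β - m * c) * (c - z) + (Γ - 1ℤ) * (a - m * h) * c)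
      ≡ + 4 * K * (z - c) * (m * (+ 2 * m * c) - (β + a * (Γ - 1ℤ))) + m * (q * q)
        + + 4 * z * (K * (a * (Γ - 1ℤ)) - m * m * m * z) + m * (h * h) * (+ 4 * m * Γ - 1ℤ)
    ring = solve-∀

  quotient : ∀ d i → 0ℤ ≤ i → ∃ λ q → 0ℤ ≤ q × + suc d * q ≤ i × i < + suc d * (q + 1ℤ)
  quotient d i i≥0 = q , q≥0 , le , lt
    where
    q = i ℤᵈ./ℕ suc d
    r = i ℤᵈ.%ℕ suc d
    i≡ : i ≡ + r + q * + suc d
    i≡ = ℤᵈ.a≡a%ℕn+[a/ℕn]*n i (suc d)
    le : + suc d * q ≤ i
    le = ≤-by (subst (0ℤ ≤_) (trans (eq (+ r) q (+ suc d)) (cong (_- + suc d * q) (sym i≡))) (ℤ.+≤+ (ℕ.z≤n {r})))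
      where
      eq : ∀ r q d → r ≡ r + q * d - d * q
      eq = solve-∀
    lt : i < + suc d * (q + 1ℤ)
    lt = subst₂ _<_ (sym i≡) (eq q (+ suc d)) (ℤₚ.+-monoˡ-< (q * + suc d) (ℤ.+<+ (ℤᵈ.n%ℕd<d i (suc d))))
      where
      eq : ∀ q d → d + q * d ≡ d * (q + 1ℤ)
      eq = solve-∀
    q≥0 : 0ℤ ≤ q
    q≥0 = subst (0ℤ ≤_) (eq q) (≤-diff (ℤₚ.i<j⇒suc[i]≤j (cancel-pos (+ suc d) (ℤ.+≤+ ℕ.z≤n) (ℤₚ.≤-<-trans i≥0 lt))))
      where
      eq : ∀ q → q + 1ℤ - (1ℤ + 0ℤ) ≡ q
      eq = solve-∀

  module Bounds (G : Graph) (D′ t : ℕ) (a β : ℤ) (bs cs : ℕ → ℕ)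
    (dr : IsDistanceRegular G (suc D′) bs cs)
    (c-formula : ∀ i → i ℕ.≤ suc D′ → + suc (suc (suc t)) * + cs i ≡ + gauss i (suc (suc t)) * (+ suc (suc (suc t)) + a * + gauss (i ℕ.∸ 1) (suc (suc t))))
    (b-formula : ∀ i → i ℕ.≤ suc D′ → + suc (suc (suc t)) * + bs i ≡ (+ gauss (suc D′) (suc (suc t)) - + gauss i (suc (suc t))) * (β - a * + gauss i (suc (suc t))))
    (a≥0 : 0ℤ ≤ a) (β-large : a * + gauss D′ (suc (suc t)) < β) (D-large : 8 ℕ.≤ D′)
    where
    open Graph G
    open Classical G D′ (suc t) a β bs cs dr c-formula b-formula a≥0 β-large
    open Second (ℕ.s≤s ℕ.z≤n) using (local-psd)

    -- ν is the intersection number a₁ = k - b₁ - c₁ with c₁ = 1, and μ is c₂ = [2] (1 + α), where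
    -- [2] = m.
    ν μ h : ℤ
    ν = + k - 1ℤ - + bs 1
    μ = m + a
    h = b * m

    1≤D : 1 ℕ.≤ D
    1≤D = ℕ.s≤s ℕ.z≤n

    2≤D : 2 ℕ.≤ D
    2≤D = ℕ.s≤s (ℕₚ.≤-trans (ℕ.s≤s ℕ.z≤n) D-large)

    Γ≡ : Γ ≡ 1ℤ + b * H
    Γ≡ = g-suc D′

    c₁ : + cs 1 ≡ 1ℤ
    c₁ = ℤₚ.*-cancelˡ-≡ m (+ cs 1) 1ℤ (trans (c-formula 1 1≤D) (eq m a))
      where
      eq : ∀ m a → 1ℤ * (m + a * 0ℤ) ≡ m * 1ℤ
      eq = solve-∀

    c₂ : + cs 2 ≡ μ
    c₂ = ℤₚ.*-cancelˡ-≡ m (+ cs 2) μ (trans (c-formula 2 2≤D) (trans (cong (_* (m + a * 1ℤ)) (g-suc 1)) (eq b a)))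
      where
      eq : ∀ b a → (1ℤ + b * 1ℤ) * (1ℤ + b + a * 1ℤ) ≡ (1ℤ + b) * (1ℤ + b + a)
      eq = solve-∀

    ν-eq : m * (ν + 1ℤ) ≡ β + a * (Γ - 1ℤ)
    ν-eq = trans (eq₁ m (+ k) (+ bs 1)) (trans (cong₂ _-_ k-formula (b-formula 1 1≤D)) (eq₂ Γ β a))
      where
      eq₁ : ∀ m k b → m * (k - 1ℤ - b + 1ℤ) ≡ m * k - m * b
      eq₁ = solve-∀
      eq₂ : ∀ Γ β a → Γ * β - (Γ - 1ℤ) * (β - a * 1ℤ) ≡ β + a * (Γ - 1ℤ)
      eq₂ = solve-∀

    x y : Fin n
    x = proj₁ (at-distance 1≤D)
    y = proj₁ (proj₂ (at-distance 1≤D))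

    x∼y : adj x y ≡ true
    x∼y = atDist₁⇒adj {x} {y} (proj₂ (proj₂ (at-distance 1≤D)))

    -- The neighbours common to `x` and `p` are counted by applying `T` to the indicator of distance
    -- 1 and evaluating at distance 1.
    valency : ∀ p → adj x p ≡ true → size (λ q → adj x q ∧ adj p q) ≡ ν
    valency p xp = trans (sum-cong-≗ term) (trans (A-radial at₁ x p) (trans (cong (T at₁) (dist-adj xp)) (trans (cong (λ c → 1ℤ * + k + ((0ℤ - 1ℤ) * c + (0ℤ - 1ℤ) * + bs 1)) c₁) (eq (+ k) (+ bs 1)))))
      where
      at₁ : ℕ → ℤ
      at₁ j = ⟦ does (j ℕ.≟ 1) ⟧
      eq : ∀ k b → 1ℤ * k + ((0ℤ - 1ℤ) * 1ℤ + (0ℤ - 1ℤ) * b) ≡ k - 1ℤ - b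
      eq = solve-∀
      term : ∀ q → ⟦ adj x q ∧ adj p q ⟧ ≡ A p q * at₁ (dist x q)
      term q with adj x q in xq
      ... | true  = sym (trans (cong (λ j → A p q * at₁ j) (dist-adj xq)) (ℤₚ.*-identityʳ (A p q)))
      ... | false = sym (trans (cong (λ c → A p q * ⟦ c ⟧) (dec-false (dist x q ℕ.≟ 1) far)) (ℤₚ.*-zeroʳ (A p q)))
        where
        far : dist x q ≢ 1
        far e = true≢false (atDist₁⇒adj {x} {q} (subst (λ j → atDist G x q j ≡ true) e (atDist-dist x q))) xq

    common : ∀ p q → adj x p ≡ true → adj x q ≡ true → p ≢ q → adj p q ≡ false → size (λ r → adj x r ∧ (adj p r ∧ adj q r)) ≤ μ
    common p q xp xq ne na = ℤₚ.≤-trans (size-mono incl) (ℤₚ.≤-reflexive (trans (sym (countFin-sum (λ r → adj q r ∧ atDist G p r 1))) (trans (cong +_ (c-count {2} {p} {q} 2≤D (atDist₂ {p} {q} {x} ne na (adj-comm xp) xq))) c₂)))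
      where
      incl : ∀ r → adj x r ∧ (adj p r ∧ adj q r) ≡ true → adj q r ∧ atDist G p r 1 ≡ true
      incl r h with ∧-true {adj p r} (proj₂ (∧-true {adj x r} h))
      ... | pr , qr = ∧-intro qr (adj⇒atDist₁ {p} {r} pr)

    module L = LocalGraph adj adj-sym adj-irr (adj x) m ν μ k (ℤ.+<+ (ℕ.s≤s (ℕ.s≤s ℕ.z≤n))) (local-psd x) (degree x) valency common

    -- Adding `x` to a clique of its local graph gives a clique of the whole graph, and this extra
    -- vertex absorbs the 1 in `clique-bound`.
    clique≤ : ∀ K → K L.⊆ adj x → Clique K → m * size K ≤ β
    clique≤ K s cl = subst (λ c → m * c ≤ β) (trans (cong (_- 1ℤ) (size-insert {y = x} {K} x∉K)) (eq (size K)))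
      (clique-bound (insert x K) (L.clique-insert {K} {x} cl s) (size-pos {C = insert x K} {x} (cong (_∨ K x) (dec-true (x Fin.≟ x) refl))))
      where
      x∉K : K x ≡ false
      x∉K = ≢true (λ Kx → true≢false (s x Kx) (adj-irr x))
      eq : ∀ c → 1ℤ + c - 1ℤ ≡ c
      eq = solve-∀

    b>0 : 0ℤ < b
    b>0 = ℤ.+<+ (ℕ.s≤s ℕ.z≤n)

    h>0 : 0ℤ < h
    h>0 = pos-* {b} {m} b>0 m>0

    H-large : m * m * m * m * m ≤ H
    H-large = ℤₚ.≤-trans (gauss₈-bound (+ t) (ℤ.+≤+ ℕ.z≤n)) (ℤₚ.≤-trans (ℤₚ.≤-reflexive (sym g₈)) (ℤ.+≤+ (gauss-mono (suc (suc t)) D-large)))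
      where
      step : ∀ {i z} → g i ≡ z → g (suc i) ≡ 1ℤ + b * z
      step {i} e = trans (g-suc i) (cong (λ z → 1ℤ + b * z) e)
      g₈ : g 8 ≡ 1ℤ + b * (1ℤ + b * (1ℤ + b * (1ℤ + b * (1ℤ + b * (1ℤ + b * (1ℤ + b * (1ℤ + b * 0ℤ)))))))
      g₈ = step {7} (step {6} (step {5} (step {4} (step {3} (step {2} (step {1} (step {0} refl)))))))

    H>0 : 0ℤ < H
    H>0 = ℤₚ.<-≤-trans (pos-* (pos-* (pos-* (pos-* m>0 m>0) m>0) m>0) m>0) H-large

    Γ>1 : 1ℤ < Γ
    Γ>1 = subst (1ℤ <_) (sym Γ≡) (ℤₚ.+-monoʳ-< 1ℤ (pos-* {b} b>0 H>0))

    μ≥0 : 0ℤ ≤ μ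
    μ≥0 = nonneg-+ {m} (ℤ.+≤+ ℕ.z≤n) a≥0

    slack≥0 : 0ℤ ≤ μ + h + h * h
    slack≥0 = nonneg-+ (nonneg-+ μ≥0 (ℤₚ.<⇒≤ h>0)) (nonneg-* (ℤₚ.<⇒≤ h>0) (ℤₚ.<⇒≤ h>0))

    -- For c < h Γ the term (β - m c) (c - h Γ) is nonpositive and has to be outweighed; this is
    -- what a > b² m² and ν + 1 ≤ 2 m c achieve through `gap-below`. The summand μ + h + h² in `ω`
    -- makes every clique larger than `ω` satisfy both conditions of `Large`.
    alpha-bound : a ≤ b * b * (m * m)
    alpha-bound with a ℤ.≤? b * b * (m * m)
    ... | yes le = le
    ... | no nle = ⊥-elim (alpha-contradiction (+ t) a H ν ω₁ μ β (ℤ.+≤+ ℕ.z≤n) a-large H-large β-large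
                     (trans ν-eq (cong (λ X → β + a * X) X≡)) refl 2mω₁≤
                     (L.Neighbourhood.local-valency≤ y x∼y ω (nonneg-+ ω₁≥0 slack≥0) μ≥0 clique≤ω))
      where
      X≡ : Γ - 1ℤ ≡ b * H
      X≡ = trans (cong (_- 1ℤ) Γ≡) (eq (b * H))
        where
        eq : ∀ z → 1ℤ + z - 1ℤ ≡ z
        eq = solve-∀
      a-large : b * b * (m * m) + 1ℤ ≤ a
      a-large = subst (_≤ a) (ℤₚ.+-comm 1ℤ (b * b * (m * m))) (ℤₚ.i<j⇒suc[i]≤j (ℤₚ.≰⇒> nle))
      a>mh : m * h < a
      a>mh = ℤₚ.≤-<-trans (≤-by (subst (0ℤ ≤_) (eq (+ suc t)) (nonneg-* {+ suc t} (ℤ.+≤+ ℕ.z≤n) (nonneg-* {b} {m * m} (ℤ.+≤+ ℕ.z≤n) (ℤ.+≤+ ℕ.z≤n))))) (ℤₚ.≰⇒> nle)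
        where
        eq : ∀ u → let b = 1ℤ + u; m = 1ℤ + b in u * (b * (m * m)) ≡ b * b * (m * m) - m * (b * m)
        eq = solve-∀
      ν+1≥0 : 0ℤ ≤ ν + 1ℤ
      ν+1≥0 = cancel-nonneg m m>0 (subst (0ℤ ≤_) (sym ν-eq) (nonneg-+ (ℤₚ.<⇒≤ β>0) (nonneg-* a≥0 (ℤₚ.<⇒≤ (<-diff Γ>1)))))
      -- `quotient` divides by the successor of its first argument, which is 2 (t + 3) = 2 m here.
      division = quotient (suc (2 ℕ.* suc (suc t) ℕ.+ 0)) (ν + 1ℤ) ν+1≥0
      ω₁ ω : ℤ
      ω₁ = proj₁ division
      ω = ω₁ + (μ + h + h * h)
      ω₁≥0 = proj₁ (proj₂ division)
      2m≡ : + suc (suc (2 ℕ.* suc (suc t) ℕ.+ 0)) ≡ + 2 * m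
      2m≡ = cong +_ (eq t)
        where
        eq : ∀ t → suc (suc (2 ℕ.* suc (suc t) ℕ.+ 0)) ≡ 2 ℕ.* suc (suc (suc t))
        eq t = trans (cong (λ z → suc (suc z)) (ℕₚ.+-identityʳ (2 ℕ.* suc (suc t)))) (sym (ℕₚ.*-suc 2 (suc (suc t))))
      2mω₁≤ : + 2 * m * ω₁ ≤ ν + 1ℤ
      2mω₁≤ = subst (λ d → d * ω₁ ≤ ν + 1ℤ) 2m≡ (proj₁ (proj₂ (proj₂ division)))
      <2m : ν + 1ℤ < + 2 * m * (ω₁ + 1ℤ)
      <2m = subst (λ d → ν + 1ℤ < d * (ω₁ + 1ℤ)) 2m≡ (proj₂ (proj₂ (proj₂ division)))
      Large : ℤ → Set
      Large c = ν + 1ℤ ≤ + 2 * m * c × μ + h + h * h + 1ℤ ≤ c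
      2m≥0 : 0ℤ ≤ + 2 * m
      2m≥0 = nonneg-* {+ 2} {m} (ℤ.+≤+ ℕ.z≤n) (ℤ.+≤+ ℕ.z≤n)
      large-suc : ∀ {c} → Large c → Large (1ℤ + c)
      large-suc {c} (p , q) = ℤₚ.≤-trans p (*-mono (+ 2 * m) 2m≥0 (ℤₚ.i≤suc[i] c)) , ℤₚ.≤-trans q (ℤₚ.i≤suc[i] c)
      large-gap : ∀ {c} → Large c → m * c ≤ β → 0ℤ < (β - m * c) * (c - h * Γ) + (Γ - 1ℤ) * (a - m * h) * c
      large-gap {c} (p , _) mc≤β with h * Γ ℤ.≤? c
      ... | yes z≤c = gap-above {m} {h} {Γ} {a} {β} {c} z≤c mc≤β h>0 Γ>1 a>mh
      ... | no z≰c  = gap-below {m} {h} {Γ} {a} {β} {c} (ℤₚ.<⇒≤ (ℤₚ.≰⇒> z≰c)) (subst (_≤ m * (+ 2 * m * c)) ν-eq (*-mono m (ℤₚ.<⇒≤ m>0) p)) h>0 Γ>1 (ℤ.+<+ (ℕ.s≤s (ℕ.s≤s ℕ.z≤n)))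
                        (subst (0ℤ <_) (cong₂ (λ X z → (+ 2 * m - 1ℤ) * (a * X) - m * m * m * (h * z)) (sym X≡) (sym Γ≡)) (discriminant-bound (+ t) a H (ℤ.+≤+ ℕ.z≤n) a-large H-large))
      clique≤ω : ∀ K → K L.⊆ adj x → L.Clique K → size K ≤ ω
      clique≤ω K s cl with size K ℤ.≤? ω
      ... | yes le = le
      ... | no nle = ⊥-elim (L.LargeCliques.no-large-clique Γ a β k-formula ν-eq clique≤ Large large-suc proj₂ large-gap K s cl
          ( ℤₚ.≤-trans (ℤₚ.<⇒≤ <2m) (*-mono (+ 2 * m) 2m≥0 (ℤₚ.≤-trans (subst₂ _≤_ (ℤₚ.+-identityʳ (ω₁ + 1ℤ)) (eq₁ ω₁ (μ + h + h * h)) (ℤₚ.+-monoʳ-≤ (ω₁ + 1ℤ) slack≥0)) big))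
          , ℤₚ.≤-trans (subst₂ _≤_ (ℤₚ.+-identityˡ _) (eq₂ ω₁ (μ + h + h * h)) (ℤₚ.+-monoˡ-≤ (μ + h + h * h + 1ℤ) ω₁≥0)) big))
        where
        big : 1ℤ + ω ≤ size K
        big = ℤₚ.i<j⇒suc[i]≤j (ℤₚ.≰⇒> nle)
        eq₁ : ∀ w s → w + 1ℤ + s ≡ 1ℤ + (w + s)
        eq₁ = solve-∀
        eq₂ : ∀ w s → w + (s + 1ℤ) ≡ 1ℤ + (w + s)
        eq₂ = solve-∀

    -- Here only cliques with at least h Γ elements have to be excluded, and for these a > m h
    -- suffices by `gap-above`.
    beta-bound : m * h < a →
      + 2 * β < + 2 * (b * (m * m * m) - a) * Γ + + 2 * (m * m * m * m * m * m * m * b) + (m * m * m * (m * m + 1ℤ) + + 2) * a - + 2 * (b * m)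
    beta-bound a>mh = beta-contradiction (+ t) a Γ ν ω μ β (ℤ.+≤+ ℕ.z≤n) alpha-bound ν-eq refl refl
      (L.Neighbourhood.local-valency≤ y x∼y ω (nonneg-+ z≥0 slack≥0) μ≥0 clique≤ω)
      where
      ω : ℤ
      ω = h * Γ + (μ + h + h * h)
      z≥0 : 0ℤ ≤ h * Γ
      z≥0 = nonneg-* {h} {Γ} (ℤₚ.<⇒≤ h>0) (ℤ.+≤+ ℕ.z≤n)
      Large : ℤ → Set
      Large c = h * Γ ≤ c × μ + h + h * h + 1ℤ ≤ c
      clique≤ω : ∀ K → K L.⊆ adj x → L.Clique K → size K ≤ ω
      clique≤ω K s cl with size K ℤ.≤? ω
      ... | yes le = le
      ... | no nle = ⊥-elim (L.LargeCliques.no-large-clique Γ a β k-formula ν-eq clique≤ Large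
          (λ {c} (p , q) → ℤₚ.≤-trans p (ℤₚ.i≤suc[i] c) , ℤₚ.≤-trans q (ℤₚ.i≤suc[i] c)) proj₂ (λ {c} (z≤c , _) mc≤β → gap-above {m} {h} {Γ} {a} {β} {c} z≤c mc≤β h>0 Γ>1 a>mh) K s cl
          ( ℤₚ.≤-trans (subst (_≤ ω) (ℤₚ.+-identityʳ (h * Γ)) (ℤₚ.+-monoʳ-≤ (h * Γ) slack≥0)) (ℤₚ.<⇒≤ (ℤₚ.≰⇒> nle))
          , ℤₚ.≤-trans (subst₂ _≤_ (ℤₚ.+-identityˡ _) (eq (h * Γ) (μ + h + h * h)) (ℤₚ.+-monoˡ-≤ (μ + h + h * h + 1ℤ) z≥0)) (ℤₚ.i<j⇒suc[i]≤j (ℤₚ.≰⇒> nle))))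
        where
        eq : ∀ w s → w + (s + 1ℤ) ≡ 1ℤ + (w + s)
        eq = solve-∀

open import Data.Nat using (ℕ; _≤_; _+_; _*_; _^_)
open import Data.Product using (Σ; _×_)
open import Data.Sum using (_⊎_)
open import Relation.Binary.PropositionalEquality using (_≡_)
open import Data.Rational using (ℚ; ½) renaming (_+_ to _+ℚ_; _*_ to _*ℚ_; _-_ to _-ℚ_; _≤_ to _≤ℚ_; _<_ to _<ℚ_)
open Integral using (≤-diff; cancel-pos; pos-*; module DistanceRegular; module Bounds)

-- Rational parameters

ℚ-ring : AlmostCommutativeRing 0ℓ 0ℓ
ℚ-ring = fromCommutativeRing ℚₚ.+-*-commutativeRing (λ q → dec⇒maybe (0ℚ ℚₚ.≟ q))

ι : ℤ → ℚ
ι i = i ℚ./ 1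

-- For a variable `i` the normalised fraction does not reduce. The homomorphism laws are therefore
-- proved on unnormalised fractions, where numerator and denominator are explicit.
ι-toℚᵘ : ∀ i → toℚᵘ (ι i) ≃ᵘ mkℚᵘ i 0
ι-toℚᵘ i = ℚₚ.toℚᵘ-fromℚᵘ (mkℚᵘ i 0)

ι-+ : ∀ i j → ι (i ℤ.+ j) ≡ ι i +ℚ ι j
ι-+ i j = ℚₚ.toℚᵘ-injective (ℚᵘₚ.≃-trans (ι-toℚᵘ (i ℤ.+ j)) (ℚᵘₚ.≃-trans (*≡* (eq i j)) (ℚᵘₚ.≃-sym
  (ℚᵘₚ.≃-trans (ℚₚ.toℚᵘ-homo-+ (ι i) (ι j)) (ℚᵘₚ.+-cong (ι-toℚᵘ i) (ι-toℚᵘ j))))))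
  where
  eq : ∀ i j → (i ℤ.+ j) ℤ.* 1ℤ ≡ (i ℤ.* 1ℤ ℤ.+ j ℤ.* 1ℤ) ℤ.* 1ℤ
  eq = ℤ-Solver.solve-∀

ι-* : ∀ i j → ι (i ℤ.* j) ≡ ι i *ℚ ι j
ι-* i j = ℚₚ.toℚᵘ-injective (ℚᵘₚ.≃-trans (ι-toℚᵘ (i ℤ.* j)) (ℚᵘₚ.≃-sym
  (ℚᵘₚ.≃-trans (ℚₚ.toℚᵘ-homo-* (ι i) (ι j)) (ℚᵘₚ.*-cong (ι-toℚᵘ i) (ι-toℚᵘ j)))))

ι-neg : ∀ i → ι (ℤ.- i) ≡ ℚ.- ι i
ι-neg i = ℚₚ.toℚᵘ-injective (ℚᵘₚ.≃-trans (ι-toℚᵘ (ℤ.- i)) (ℚᵘₚ.≃-sym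
  (ℚᵘₚ.≃-trans (ℚₚ.toℚᵘ-homo‿- (ι i)) (ℚᵘₚ.-‿cong (ι-toℚᵘ i)))))

ι-- : ∀ i j → ι (i ℤ.- j) ≡ ι i -ℚ ι j
ι-- i j = trans (ι-+ i (ℤ.- j)) (cong (ι i +ℚ_) (ι-neg j))

ι-injective : ∀ {i j} → ι i ≡ ι j → i ≡ j
ι-injective {i} {j} e with ℚᵘₚ.≃-trans (ℚᵘₚ.≃-sym (ι-toℚᵘ i)) (ℚᵘₚ.≃-trans (ℚᵘₚ.≃-reflexive (cong toℚᵘ e)) (ι-toℚᵘ j))
... | *≡* q = trans (sym (ℤₚ.*-identityʳ i)) (trans q (ℤₚ.*-identityʳ j))

ι-mono-≤ : ∀ {i j} → i ℤ.≤ j → ι i ≤ℚ ι j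
ι-mono-≤ {i} {j} le = ℚₚ.toℚᵘ-cancel-≤ (ℚᵘₚ.≤-respˡ-≃ (ℚᵘₚ.≃-sym (ι-toℚᵘ i)) (ℚᵘₚ.≤-respʳ-≃ (ℚᵘₚ.≃-sym (ι-toℚᵘ j))
  (*≤* (subst₂ ℤ._≤_ (sym (ℤₚ.*-identityʳ i)) (sym (ℤₚ.*-identityʳ j)) le))))

ι-mono-< : ∀ {i j} → i ℤ.< j → ι i <ℚ ι j
ι-mono-< {i} {j} lt = ℚₚ.toℚᵘ-cancel-< (ℚᵘₚ.<-respˡ-≃ (ℚᵘₚ.≃-sym (ι-toℚᵘ i)) (ℚᵘₚ.<-respʳ-≃ (ℚᵘₚ.≃-sym (ι-toℚᵘ j))
  (*<* (subst₂ ℤ._<_ (sym (ℤₚ.*-identityʳ i)) (sym (ℤₚ.*-identityʳ j)) lt))))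

module Scaled (M a : ℤ) (α : ℚ) (M>0 : 0ℤ ℤ.< M) (α-scaled : ι M *ℚ α ≡ ι a) where

  private instance
    ιM-positive : ℚ.Positive (ι M)
    ιM-positive = ℚ.positive (ι-mono-< M>0)

  α≤ι : ∀ z → a ℤ.≤ M ℤ.* z → α ≤ℚ ι z
  α≤ι z le = ℚₚ.*-cancelˡ-≤-pos (ι M) (subst₂ _≤ℚ_ (sym α-scaled) (ι-* M z) (ι-mono-≤ le))

  ι<α : ∀ z → M ℤ.* z ℤ.< a → ι z <ℚ α
  ι<α z lt = ℚₚ.*-cancelˡ-<-nonNeg (ι M) {{ℚₚ.pos⇒nonNeg (ι M)}} (subst₂ _<ℚ_ (ι-* M z) (sym α-scaled) (ι-mono-< lt))

  c-scaled : ∀ c g p → ι c ≡ ι g *ℚ (1ℚ +ℚ α *ℚ ι p) → M ℤ.* c ≡ g ℤ.* (M ℤ.+ a ℤ.* p)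
  c-scaled c g p h = ι-injective (trans (ι-* M c) (trans (cong (ι M *ℚ_) h) (trans (eq (ι M) (ι g) α (ι p))
    (trans (cong (λ u → ι g *ℚ (ι M +ℚ u *ℚ ι p)) α-scaled)
           (sym (trans (ι-* g (M ℤ.+ a ℤ.* p)) (cong (ι g *ℚ_) (trans (ι-+ M (a ℤ.* p)) (cong (ι M +ℚ_) (ι-* a p))))))))))
    where
    eq : ∀ m g α p → m *ℚ (g *ℚ (1ℚ +ℚ α *ℚ p)) ≡ g *ℚ (m +ℚ m *ℚ α *ℚ p)
    eq = RingSolver.solve-∀ ℚ-ring

  module _ (b : ℤ) (β : ℚ) (β-scaled : ι M *ℚ β ≡ ι b) where

    b-scaled : ∀ c Γ g → ι c ≡ (ι Γ -ℚ ι g) *ℚ (β -ℚ α *ℚ ι g) → M ℤ.* c ≡ (Γ ℤ.- g) ℤ.* (b ℤ.- a ℤ.* g)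
    b-scaled c Γ g h = ι-injective (trans (ι-* M c) (trans (cong (ι M *ℚ_) h) (trans (eq (ι M) (ι Γ) (ι g) α β)
      (trans (cong₂ (λ u v → (ι Γ -ℚ ι g) *ℚ (v -ℚ u *ℚ ι g)) α-scaled β-scaled)
             (sym (trans (ι-* (Γ ℤ.- g) (b ℤ.- a ℤ.* g)) (cong₂ _*ℚ_ (ι-- Γ g) (trans (ι-- b (a ℤ.* g)) (cong (ι b -ℚ_) (ι-* a g))))))))))
      where
      eq : ∀ m Γ g α β → m *ℚ ((Γ -ℚ g) *ℚ (β -ℚ α *ℚ g)) ≡ (Γ -ℚ g) *ℚ (m *ℚ β -ℚ m *ℚ α *ℚ g)
      eq = RingSolver.solve-∀ ℚ-ring

    β-bound′ : ∀ Γ u v w z →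
      + 2 ℤ.* b ℤ.< + 2 ℤ.* (M ℤ.* u ℤ.- a) ℤ.* Γ ℤ.+ + 2 ℤ.* (M ℤ.* v) ℤ.+ (w ℤ.+ + 2) ℤ.* a ℤ.- + 2 ℤ.* (z ℤ.* M) →
      β <ℚ ((ι u -ℚ α) *ℚ ι Γ) +ℚ ι v +ℚ (((ι w *ℚ ½) +ℚ ι 1ℤ) *ℚ α) -ℚ ι z
    β-bound′ Γ u v w z lt = ℚₚ.*-cancelˡ-<-nonNeg (ι M) {{ℚₚ.pos⇒nonNeg (ι M)}} (ℚₚ.*-cancelˡ-<-nonNeg (ι (+ 2))
      (subst₂ _<ℚ_ (trans (ι-* (+ 2) b) (cong (ι (+ 2) *ℚ_) (sym β-scaled))) (trans push (trans pull (eq (ι M) (ι u) (ι Γ) (ι v) (ι w) (ι z) α))) (ι-mono-< lt)))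
      where
      push : ι (+ 2 ℤ.* (M ℤ.* u ℤ.- a) ℤ.* Γ ℤ.+ + 2 ℤ.* (M ℤ.* v) ℤ.+ (w ℤ.+ + 2) ℤ.* a ℤ.- + 2 ℤ.* (z ℤ.* M))
        ≡ ι (+ 2) *ℚ (ι M *ℚ ι u -ℚ ι a) *ℚ ι Γ +ℚ ι (+ 2) *ℚ (ι M *ℚ ι v) +ℚ (ι w +ℚ ι (+ 2)) *ℚ ι a -ℚ ι (+ 2) *ℚ (ι z *ℚ ι M)
      push = trans (ι-- (+ 2 ℤ.* (M ℤ.* u ℤ.- a) ℤ.* Γ ℤ.+ + 2 ℤ.* (M ℤ.* v) ℤ.+ (w ℤ.+ + 2) ℤ.* a) (+ 2 ℤ.* (z ℤ.* M)))
        (cong₂ _-ℚ_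
          (trans (ι-+ (+ 2 ℤ.* (M ℤ.* u ℤ.- a) ℤ.* Γ ℤ.+ + 2 ℤ.* (M ℤ.* v)) ((w ℤ.+ + 2) ℤ.* a))
            (cong₂ _+ℚ_
              (trans (ι-+ (+ 2 ℤ.* (M ℤ.* u ℤ.- a) ℤ.* Γ) (+ 2 ℤ.* (M ℤ.* v)))
                (cong₂ _+ℚ_
                  (trans (ι-* (+ 2 ℤ.* (M ℤ.* u ℤ.- a)) Γ)
                    (cong (_*ℚ ι Γ) (trans (ι-* (+ 2) (M ℤ.* u ℤ.- a)) (cong (ι (+ 2) *ℚ_) (trans (ι-- (M ℤ.* u) a) (cong (_-ℚ ι a) (ι-* M u)))))))
                  (trans (ι-* (+ 2) (M ℤ.* v)) (cong (ι (+ 2) *ℚ_) (ι-* M v)))))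
              (trans (ι-* (w ℤ.+ + 2) a) (cong (_*ℚ ι a) (ι-+ w (+ 2))))))
          (trans (ι-* (+ 2) (z ℤ.* M)) (cong (ι (+ 2) *ℚ_) (ι-* z M))))
      pull : ι (+ 2) *ℚ (ι M *ℚ ι u -ℚ ι a) *ℚ ι Γ +ℚ ι (+ 2) *ℚ (ι M *ℚ ι v) +ℚ (ι w +ℚ ι (+ 2)) *ℚ ι a -ℚ ι (+ 2) *ℚ (ι z *ℚ ι M)
        ≡ ι (+ 2) *ℚ (ι M *ℚ ι u -ℚ ι M *ℚ α) *ℚ ι Γ +ℚ ι (+ 2) *ℚ (ι M *ℚ ι v) +ℚ (ι w *ℚ (ι (+ 2) *ℚ ½) +ℚ ι (+ 2) *ℚ ι 1ℤ) *ℚ (ι M *ℚ α) -ℚ ι (+ 2) *ℚ (ι z *ℚ ι M)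
      -- `ι (+ 2) *ℚ ½` computes to 1, so multiplying by 1 introduces the factor ½ of the goal. The
      -- identity `general` then treats 2, ½ and 1 as variables.
      pull = cong₂ (λ s t → ι (+ 2) *ℚ (ι M *ℚ ι u -ℚ s) *ℚ ι Γ +ℚ ι (+ 2) *ℚ (ι M *ℚ ι v) +ℚ (t +ℚ ι (+ 2)) *ℚ s -ℚ ι (+ 2) *ℚ (ι z *ℚ ι M))
               (sym α-scaled) (sym (ℚₚ.*-identityʳ (ι w)))
      eq : ∀ m u Γ v w z α →
        ι (+ 2) *ℚ (m *ℚ u -ℚ m *ℚ α) *ℚ Γ +ℚ ι (+ 2) *ℚ (m *ℚ v) +ℚ (w *ℚ (ι (+ 2) *ℚ ½) +ℚ ι (+ 2) *ℚ ι 1ℤ) *ℚ (m *ℚ α) -ℚ ι (+ 2) *ℚ (z *ℚ m)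
        ≡ ι (+ 2) *ℚ (m *ℚ (((u -ℚ α) *ℚ Γ) +ℚ v +ℚ (((w *ℚ ½) +ℚ ι 1ℤ) *ℚ α) -ℚ z))
      eq m u Γ v w z α = general (ι (+ 2)) ½ (ι 1ℤ) m u Γ v w z α
        where
        general : ∀ p q r m u Γ v w z α →
          p *ℚ (m *ℚ u -ℚ m *ℚ α) *ℚ Γ +ℚ p *ℚ (m *ℚ v) +ℚ (w *ℚ (p *ℚ q) +ℚ p *ℚ r) *ℚ (m *ℚ α) -ℚ p *ℚ (z *ℚ m)
          ≡ p *ℚ (m *ℚ (((u -ℚ α) *ℚ Γ) +ℚ v +ℚ (((w *ℚ q) +ℚ r) *ℚ α) -ℚ z))
        general = RingSolver.solve-∀ ℚ-ring

    β-bound : ∀ z Γ {u v w} → u ≡ z ℤ.* (M ℤ.* M) → v ≡ M ℤ.* M ℤ.* M ℤ.* M ℤ.* M ℤ.* M ℤ.* z → w ≡ M ℤ.* M ℤ.* M ℤ.* (M ℤ.* M ℤ.+ 1ℤ) →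
      + 2 ℤ.* b ℤ.< + 2 ℤ.* (z ℤ.* (M ℤ.* M ℤ.* M) ℤ.- a) ℤ.* Γ ℤ.+ + 2 ℤ.* (M ℤ.* M ℤ.* M ℤ.* M ℤ.* M ℤ.* M ℤ.* M ℤ.* z) ℤ.+ (M ℤ.* M ℤ.* M ℤ.* (M ℤ.* M ℤ.+ 1ℤ) ℤ.+ + 2) ℤ.* a ℤ.- + 2 ℤ.* (z ℤ.* M) →
      β <ℚ ((ι u -ℚ α) *ℚ ι Γ) +ℚ ι v +ℚ (((ι w *ℚ ½) +ℚ ι 1ℤ) *ℚ α) -ℚ ι z
    β-bound z Γ {u} {v} {w} refl refl refl lt = β-bound′ Γ u v w z (subst (+ 2 ℤ.* b ℤ.<_) (eq z M a Γ) lt)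
      where
      eq : ∀ z m a Γ → + 2 ℤ.* (z ℤ.* (m ℤ.* m ℤ.* m) ℤ.- a) ℤ.* Γ ℤ.+ + 2 ℤ.* (m ℤ.* m ℤ.* m ℤ.* m ℤ.* m ℤ.* m ℤ.* m ℤ.* z) ℤ.+ (m ℤ.* m ℤ.* m ℤ.* (m ℤ.* m ℤ.+ 1ℤ) ℤ.+ + 2) ℤ.* a ℤ.- + 2 ℤ.* (z ℤ.* m)
        ≡ + 2 ℤ.* (m ℤ.* (z ℤ.* (m ℤ.* m)) ℤ.- a) ℤ.* Γ ℤ.+ + 2 ℤ.* (m ℤ.* (m ℤ.* m ℤ.* m ℤ.* m ℤ.* m ℤ.* m ℤ.* z)) ℤ.+ (m ℤ.* m ℤ.* m ℤ.* (m ℤ.* m ℤ.+ 1ℤ) ℤ.+ + 2) ℤ.* a ℤ.- + 2 ℤ.* (z ℤ.* m)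
      eq = ℤ-Solver.solve-∀

pos-^-suc : ∀ p i → + (p ^ suc i) ≡ + p ℤ.* + (p ^ i)
pos-^-suc p i = ℤₚ.pos-* p (p ^ i)

pos-^² : ∀ p → + (p ^ 2) ≡ + p ℤ.* + p
pos-^² p = trans (pos-^-suc p 1) (cong (λ q → + p ℤ.* + q) (ℕₚ.*-identityʳ p))

pos-^³ : ∀ p → + (p ^ 3) ≡ + p ℤ.* + p ℤ.* + p
pos-^³ p = trans (pos-^-suc p 2) (trans (cong (λ q → + p ℤ.* q) (pos-^² p)) (sym (ℤₚ.*-assoc (+ p) (+ p) (+ p))))

≤⊎> : ∀ i j → i ℤ.≤ j ⊎ j ℤ.< i
≤⊎> i j with i ℤ.≤? j
... | yes p = inj₁ p
... | no p  = inj₂ (ℤₚ.≰⇒> p)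

-- From the rational parameters to the integral bounds and back

module Conclusion (G : Graph) (D′ t : ℕ) (α β : ℚ) (D-large : 8 ≤ D′)
  (bs cs : ℕ → ℕ) (dr : IsDistanceRegular G (suc D′) bs cs)
  (c-formula : ∀ i → i ≤ suc D′ → ℕ→ℚ (cs i) ≡ ℕ→ℚ (gauss i (suc (suc t))) *ℚ (1ℚ +ℚ α *ℚ ℕ→ℚ (gauss (i ∸ 1) (suc (suc t)))))
  (b-formula : ∀ i → i ≤ suc D′ → ℕ→ℚ (bs i) ≡ (ℕ→ℚ (gauss (suc D′) (suc (suc t))) -ℚ ℕ→ℚ (gauss i (suc (suc t)))) *ℚ (β -ℚ α *ℚ ℕ→ℚ (gauss i (suc (suc t)))))
  where

  module R = DistanceRegular G (suc D′) bs cs dr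

  b : ℕ
  b = suc (suc t)

  -- `a` and `b′` are mα and mβ read off from intersection numbers, which makes them integers: c₂ =
  -- m (1 + α), and b₀ - b₁ = β + α (Γ - 1).
  M Γ a b′ : ℤ
  M  = + suc b
  Γ  = + gauss (suc D′) b
  a  = + cs 2 ℤ.- M
  b′ = M ℤ.* (+ bs 0 ℤ.- + bs 1) ℤ.- a ℤ.* (Γ ℤ.- 1ℤ)

  M>0 : 0ℤ ℤ.< M
  M>0 = ℤ.+<+ (s≤s z≤n)

  2≤D : 2 ≤ suc D′
  2≤D = s≤s (ℕₚ.≤-trans (s≤s z≤n) D-large)

  3≤D : 3 ≤ suc D′
  3≤D = s≤s (ℕₚ.≤-trans (s≤s (s≤s z≤n)) D-large)

  gauss₂ : + gauss 2 b ≡ M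
  gauss₂ = cong (λ z → + suc z) (ℕₚ.*-identityʳ b)

  α-scaled : ι M *ℚ α ≡ ι a
  α-scaled = trans (eq (ι M) α) (trans (cong (_-ℚ ι M) (sym (trans (c-formula 2 2≤D) (cong (λ z → ι z *ℚ (1ℚ +ℚ α *ℚ 1ℚ)) gauss₂)))) (sym (ι-- (+ cs 2) M)))
    where
    eq : ∀ m α → m *ℚ α ≡ m *ℚ (1ℚ +ℚ α *ℚ 1ℚ) -ℚ m
    eq = RingSolver.solve-∀ ℚ-ring

  β-scaled : ι M *ℚ β ≡ ι b′
  β-scaled = trans (eq (ι M) α β (ι Γ)) (trans (cong₂ (λ u v → ι M *ℚ u -ℚ v *ℚ (ι Γ -ℚ 1ℚ)) (sym (cong₂ _-ℚ_ (b-formula 0 z≤n) (b-formula 1 (s≤s z≤n)))) α-scaled)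
    (sym (trans (ι-- (M ℤ.* (+ bs 0 ℤ.- + bs 1)) (a ℤ.* (Γ ℤ.- 1ℤ))) (cong₂ _-ℚ_
      (trans (ι-* M (+ bs 0 ℤ.- + bs 1)) (cong (ι M *ℚ_) (ι-- (+ bs 0) (+ bs 1))))
      (trans (ι-* a (Γ ℤ.- 1ℤ)) (cong (ι a *ℚ_) (ι-- Γ 1ℤ)))))))
    where
    eq : ∀ m α β Γ → m *ℚ β ≡ m *ℚ ((Γ -ℚ 0ℚ) *ℚ (β -ℚ α *ℚ 0ℚ) -ℚ (Γ -ℚ 1ℚ) *ℚ (β -ℚ α *ℚ 1ℚ)) -ℚ m *ℚ α *ℚ (Γ -ℚ 1ℚ)
    eq = RingSolver.solve-∀ ℚ-ring

  open Scaled M a α M>0 α-scaled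

  c-integral : ∀ i → i ≤ suc D′ → M ℤ.* + cs i ≡ + gauss i b ℤ.* (M ℤ.+ a ℤ.* + gauss (i ∸ 1) b)
  c-integral i le = c-scaled (+ cs i) (+ gauss i b) (+ gauss (i ∸ 1) b) (c-formula i le)

  b-integral : ∀ i → i ≤ suc D′ → M ℤ.* + bs i ≡ (Γ ℤ.- + gauss i b) ℤ.* (b′ ℤ.- a ℤ.* + gauss i b)
  b-integral i le = b-scaled b′ β β-scaled (+ bs i) Γ (+ gauss i b) (b-formula i le)

  -- c₃ = [3] (1 + a) is positive.
  a≥0 : 0ℤ ℤ.≤ a
  a≥0 = subst (0ℤ ℤ.≤_) (eq a) (≤-diff (ℤₚ.i<j⇒suc[i]≤j (cancel-pos M (ℤₚ.<⇒≤ M>0) (cancel-pos (+ gauss 3 b) (ℤ.+≤+ z≤n)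
    (subst (0ℤ ℤ.<_) (trans (c-integral 3 3≤D) (cong (+ gauss 3 b ℤ.*_) (trans (cong (λ z → M ℤ.+ a ℤ.* z) gauss₂) (eq′ M a)))) (pos-* M>0 (ℤ.+<+ (R.c-pos 3≤D))))))))
    where
    eq : ∀ a → 1ℤ ℤ.+ a ℤ.- (1ℤ ℤ.+ 0ℤ) ≡ a
    eq = ℤ-Solver.solve-∀
    eq′ : ∀ M a → M ℤ.+ a ℤ.* M ≡ M ℤ.* (1ℤ ℤ.+ a)
    eq′ = ℤ-Solver.solve-∀

  -- b_{D-1} is positive, and its factor [D] - [D - 1] is nonnegative, so the other factor is
  -- positive.
  β-large : a ℤ.* + gauss D′ b ℤ.< b′
  β-large = subst₂ ℤ._<_ (ℤₚ.+-identityˡ _) (eq b′ (a ℤ.* + gauss D′ b)) (ℤₚ.+-monoˡ-< (a ℤ.* + gauss D′ b) (cancel-pos (Γ ℤ.- + gauss D′ b) (≤-diff (ℤ.+≤+ (ℕₚ.m≤m+n (gauss D′ b) (b ^ D′))))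
    (subst (0ℤ ℤ.<_) (b-integral D′ (ℕₚ.n≤1+n D′)) (pos-* M>0 (ℤ.+<+ (R.b-pos ℕₚ.≤-refl))))))
    where
    eq : ∀ x y → x ℤ.- y ℤ.+ y ≡ x
    eq = ℤ-Solver.solve-∀

  open Bounds G D′ t a b′ bs cs dr c-integral b-integral a≥0 β-large D-large using (alpha-bound; beta-bound)

  b+1 : b + 1 ≡ suc b
  b+1 = ℕₚ.+-comm b 1

  cast₁ : + (b * (b + 1)) ≡ + b ℤ.* M
  cast₁ = trans (ℤₚ.pos-* b (b + 1)) (cong (λ z → + b ℤ.* + z) b+1)

  cast₂ : + (b ^ 2 * (b + 1)) ≡ + b ℤ.* + b ℤ.* M
  cast₂ = trans (ℤₚ.pos-* (b ^ 2) (b + 1)) (cong₂ (λ y z → y ℤ.* + z) (pos-^² b) b+1)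

  cast₃ : + (b * (b + 1) ^ 2) ≡ + b ℤ.* (M ℤ.* M)
  cast₃ = trans (ℤₚ.pos-* b ((b + 1) ^ 2)) (cong (+ b ℤ.*_) (trans (cong (λ z → + (z ^ 2)) b+1) (pos-^² (suc b))))

  cast₄ : + ((b + 1) ^ 6 * b) ≡ M ℤ.* M ℤ.* M ℤ.* M ℤ.* M ℤ.* M ℤ.* + b
  cast₄ = trans (cong (λ z → + (z ^ 6 * b)) b+1) (trans (ℤₚ.pos-* (suc b ^ 6) b) (cong (ℤ._* + b)
    (trans (trans (cong +_ (ℕₚ.^-distribˡ-+-* (suc b) 3 3)) (ℤₚ.pos-* (suc b ^ 3) (suc b ^ 3))) (trans (cong₂ ℤ._*_ (pos-^³ (suc b)) (pos-^³ (suc b))) (eq M)))))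
    where
    eq : ∀ m → m ℤ.* m ℤ.* m ℤ.* (m ℤ.* m ℤ.* m) ≡ m ℤ.* m ℤ.* m ℤ.* m ℤ.* m ℤ.* m
    eq = ℤ-Solver.solve-∀

  cast₅ : + ((b + 1) ^ 3 * ((b + 1) ^ 2 + 1)) ≡ M ℤ.* M ℤ.* M ℤ.* (M ℤ.* M ℤ.+ 1ℤ)
  cast₅ = trans (cong (λ z → + (z ^ 3 * (z ^ 2 + 1))) b+1) (trans (ℤₚ.pos-* (suc b ^ 3) (suc b ^ 2 + 1)) (cong₂ (λ y z → y ℤ.* (z ℤ.+ 1ℤ)) (pos-^³ (suc b)) (pos-^² (suc b))))

  α-integral : ℕ→ℚ (b + 1) *ℚ α ≡ ℕ→ℚ ℤ.∣ a ∣
  α-integral = trans (cong (λ z → ℕ→ℚ z *ℚ α) b+1) (trans α-scaled (cong ι (sym (ℤₚ.0≤i⇒+∣i∣≡i a≥0))))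

  a≤ : a ℤ.≤ M ℤ.* (+ b ℤ.* + b ℤ.* M)
  a≤ = subst (a ℤ.≤_) (eq (+ b) M) alpha-bound
    where
    eq : ∀ b m → b ℤ.* b ℤ.* (m ℤ.* m) ≡ m ℤ.* (b ℤ.* b ℤ.* m)
    eq = ℤ-Solver.solve-∀

  α≤ : α ≤ℚ ℕ→ℚ (b ^ 2 * (b + 1))
  α≤ = subst (λ z → α ≤ℚ ι z) (sym cast₂) (α≤ι (+ b ℤ.* + b ℤ.* M) a≤)

  α< : α <ℚ ℕ→ℚ (b ^ 2 * (b + 1) + 1)
  α< = ℚₚ.≤-<-trans α≤ (ι-mono-< (ℤ.+<+ (subst (ℕ._≤ b ^ 2 * (b + 1) + 1) (ℕₚ.+-comm (b ^ 2 * (b + 1)) 1) ℕₚ.≤-refl)))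

  β< : M ℤ.* (+ b ℤ.* M) ℤ.< a →
    β <ℚ (((ℕ→ℚ (b * (b + 1) ^ 2) -ℚ α) *ℚ ℕ→ℚ (gauss (suc D′) b))
          +ℚ ℕ→ℚ ((b + 1) ^ 6 * b)
          +ℚ (((ℕ→ℚ ((b + 1) ^ 3 * ((b + 1) ^ 2 + 1)) *ℚ ½) +ℚ ℕ→ℚ 1) *ℚ α)
          -ℚ ℕ→ℚ b)
  β< large = β-bound b′ β β-scaled (+ b) Γ cast₃ cast₄ cast₅ (beta-bound large)

  small-or-large : (α ≤ℚ ℕ→ℚ (b * (b + 1)))
    ⊎ ((ℕ→ℚ (b * (b + 1)) <ℚ α)
       × (α <ℚ ℕ→ℚ (b ^ 2 * (b + 1) + 1))
       × (β <ℚ (((ℕ→ℚ (b * (b + 1) ^ 2) -ℚ α) *ℚ ℕ→ℚ (gauss (suc D′) b))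
                +ℚ ℕ→ℚ ((b + 1) ^ 6 * b)
                +ℚ (((ℕ→ℚ ((b + 1) ^ 3 * ((b + 1) ^ 2 + 1)) *ℚ ½) +ℚ ℕ→ℚ 1) *ℚ α)
                -ℚ ℕ→ℚ b)))
  small-or-large = Sum.map (λ small → subst (λ z → α ≤ℚ ι z) (sym cast₁) (α≤ι (+ b ℤ.* M) small))
    (λ large → subst (λ z → ι z <ℚ α) (sym cast₁) (ι<α (+ b ℤ.* M) large) , α< , β< large) (≤⊎> a (M ℤ.* (+ b ℤ.* M)))

theorem5p2 : (G : Graph) (D b : ℕ) (α β : ℚ) →
    1 ≤ D → 1 ≤ b →
    HasClassicalParameters G D b α β →
    9 ≤ D → 2 ≤ b →
    (Σ ℕ (λ k → ℕ→ℚ (b + 1) *ℚ α ≡ ℕ→ℚ k)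
    × ((α ≤ℚ ℕ→ℚ (b * (b + 1)))
    ⊎ ((ℕ→ℚ (b * (b + 1)) <ℚ α)
    × (α <ℚ ℕ→ℚ (b ^ 2 * (b + 1) + 1))
    × (β <ℚ (((ℕ→ℚ (b * (b + 1) ^ 2) -ℚ α) *ℚ ℕ→ℚ (gauss D b))
    +ℚ ℕ→ℚ ((b + 1) ^ 6 * b)
    +ℚ (((ℕ→ℚ ((b + 1) ^ 3 * ((b + 1) ^ 2 + 1)) *ℚ ½) +ℚ ℕ→ℚ 1) *ℚ α)
    -ℚ ℕ→ℚ b)))))
    × (10 ≤ D → α ≤ℚ ℕ→ℚ (b ^ 2 * (b + 1)))
theorem5p2 G (suc D′) (suc (suc t)) α β _ _ (bs , cs , dr , formulas) (s≤s D-large) _ =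
  ((ℤ.∣ a ∣ , α-integral) , small-or-large) , λ _ → α≤
  where
  open Conclusion G D′ t α β D-large bs cs dr (λ i le → proj₁ (formulas i le)) (λ i le → proj₂ (formulas i le))
theorem5p2 G D (suc zero) α β _ _ _ _ (s≤s ())
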